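{- Let $n, r$ be positive integers with $r \ge 2$. Then $$\widetilde{A}_{n,r}(t) \ = \ \widetilde{A}^+_{n,r}(t) \, + \, \widetilde{A}^-_{n,r}(t)$$ for some polynomials $\widetilde{A}^+_{n,r}(t)$ and $\widetilde{A}^-_{n,r}(t)$ such that (i) $\widetilde{A}^+_{n,r}(t)$ is a $\gamma$-positive polynomial with center $n/2$; (ii) $\widetilde{A}^-_{n,r}(t)$ is a $\gamma$-positive polynomial with center $(n+1)/2$ and zero constant term. Moreover, $\widetilde{A}^+_{n,r}(t)$ equals the $h$-polynomial of the boundary complex of an $n$-dimensional flag simplicial polytope (that is, an $n$-dimensional simplicial polytope whose boundary complex is a flag simplicial complex).
   Context: **Colored permutations.** Elements of the wreath product $\mathbb{Z}_r \wr \mathfrak{S}_n$ are represented as $r$-colored permutations, i.e. pairs $w = (\sigma, \varepsilon)$ with $\sigma \in \mathfrak{S}_n$ and $\varepsilon = (\varepsilon_1,\dots,\varepsilon_n) \in \{0,1,\dots,r-1\}^n$, where $\varepsilon_k$ is the color of $\sigma(k)$. An index $k \in \{1,\dots,n\}$ is a descent of $w$ if either $\varepsilon_k > \varepsilon_{k+1}$, or $\varepsilon_k = \varepsilon_{k+1}$ and $\sigma(k) > \sigma(k+1)$, where $\sigma(n+1) := n+1$ and $\varepsilon_{n+1} := 0$. The number of descents is $\mathrm{des}(w)$. **Polynomials.** Set $A_{n,r}(t) = \sum_{w \in \mathbb{Z}_r \wr \mathfrak{S}_n} t^{\mathrm{des}(w)}$ for $n \ge 1$, $A_{0,r}(t)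 = 1$, and $$\widetilde{A}_{n,r}(t) = \sum_{m=0}^n \binom{n}{m} t^{n-m} A_{m,r}(t).$$ **$\gamma$-positivity.** A polynomial $f(t)$ is $\gamma$-positive with center $d/2$ ($d\in\mathbb{N}$) if $f(t) = \sum_{i=0}^{\lfloor d/2 \rfloor} \gamma_i\, t^i (1+t)^{d-2i}$ for some nonnegative integers $\gamma_i$. **Simplicial complexes.** The $h$-polynomial of an $(n-1)$-dimensional simplicial complex $\Delta$ is $h(\Delta,t) = \sum_{i=0}^n f_{i-1}(\Delta)\, t^i (1-t)^{n-i}$, where $f_i(\Delta)$ is the number of $i$-dimensional faces. A simplicial complex is flag if it contains every simplex whose one-dimensional skeleton is a subcomplex. -}

module Defs where

open import Algebra.Bundles using (RawSemiring)
open import Data.Bool.Base using (true; false)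
open import Data.Fin.Base using (Fin; toℕ; inject₁) renaming (suc to fsuc)
open import Data.Fin.Properties using () renaming (_≟_ to _≟ᶠ_)
open import Data.Fin.Subset using (Subset; _∈_; _∉_; _⊆_; ⊥; ⊤; ⁅_⁆; ∣_∣)
open import Data.Integer.Base as ℤ using (ℤ; 0ℤ; 1ℤ)
open import Data.List.Base as List using (List; []; _∷_; allFin; length; filter; cartesianProduct)
open import Data.Nat.Base as ℕ using (ℕ; zero; suc; _∸_; ⌊_/2⌋)
open import Data.Nat.Combinatorics using (_C_)
import Data.Nat.Properties as ℕ
open import Data.Product.Base using (_×_; _,_; ∃₂; Σ-syntax; ∃-syntax)
open import Data.Rational.Base as ℚ using (ℚ; 0ℚ; 1ℚ; ½)
import Data.Rational.Properties as ℚ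
open import Data.Rational.Solver using (module +-*-Solver)
open import Data.Sum.Base using (_⊎_)
open import Data.Vec.Base as Vec using (Vec; _∷ʳ_; lookup)
open import Data.Vec.Functional using (Vector)
open import Data.Vec.Relation.Unary.AllPairs using (allPairs?)
open import Data.Vec.Relation.Unary.Unique.Propositional using (Unique)
open import Function.Bundles using (_⇔_)
open import Level using (0ℓ)
open import Relation.Binary.PropositionalEquality using (_≡_; refl; sym; cong; cong₂; subst; module ≡-Reasoning)
open import Relation.Nullary using (¬_)
open import Relation.Nullary.Decidable using (¬?; _×-dec_; _⊎-dec_)
open import Relation.Unary using (Pred; Decidable)

------------------------------------------------------------------------
-- Polynomials in one variable t over ℤ.  Lists of coefficients, lowest
-- degree first; trailing zeros are allowed, so equality is _≈ₚ_.

Poly : Set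
Poly = List ℤ

coeff : Poly → ℕ → ℤ
coeff []      _       = 0ℤ
coeff (a ∷ _) zero    = a
coeff (_ ∷ p) (suc k) = coeff p k

infix 4 _≈ₚ_
_≈ₚ_ : Poly → Poly → Set
p ≈ₚ q = ∀ k → coeff p k ≡ coeff q k

0ₚ 1ₚ X : Poly
0ₚ = []
1ₚ = 1ℤ ∷ []
X  = 0ℤ ∷ 1ℤ ∷ []

infixl 6 _+ₚ_
_+ₚ_ : Poly → Poly → Poly
[]      +ₚ q       = q
(a ∷ p) +ₚ []      = a ∷ p
(a ∷ p) +ₚ (b ∷ q) = (a ℤ.+ b) ∷ (p +ₚ q)

-ₚ_ : Poly → Poly
-ₚ_ = List.map (ℤ.-_)

infixl 7 _*ₚ_
_*ₚ_ : Poly → Poly → Poly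
[]      *ₚ q = []
(a ∷ p) *ₚ q = List.map (a ℤ.*_) q +ₚ (0ℤ ∷ (p *ₚ q))

polySemiring : RawSemiring 0ℓ 0ℓ
polySemiring = record
  { Carrier = Poly ; _≈_ = _≈ₚ_ ; _+_ = _+ₚ_ ; _*_ = _*ₚ_ ; 0# = 0ₚ ; 1# = 1ₚ }

-- k · p is the natural multiple, p ^ k the power, and sumₚ {n} f is
-- f 0 + … + f (n - 1).
open import Algebra.Definitions.RawSemiring polySemiring public
  using (_^_) renaming (_×_ to _·_; sum to sumₚ)

sumListₚ : List Poly → Poly
sumListₚ = List.foldr _+ₚ_ 0ₚ

-- The center of symmetry is d/2.
GammaPositive : ℕ → Poly → Set
GammaPositive d f =
  Σ[ γ ∈ Vector ℕ (suc ⌊ d /2⌋) ]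
    f ≈ₚ sumₚ λ i →
      γ i · ((X ^ toℕ i) *ₚ ((1ₚ +ₚ X) ^ (d ∸ 2 ℕ.* toℕ i)))

------------------------------------------------------------------------
-- Colored permutations

words : ∀ {A : Set} → List A → ∀ n → List (Vec A n)
words as zero    = Vec.[] ∷ []
words as (suc n) = List.cartesianProductWith Vec._∷_ as (words as n)

-- σ in one-line notation, together with the colors; letters are
-- numbered from 0.
ColoredWord : ℕ → ℕ → Set
ColoredWord n r = Vec (Fin n) n × Vec (Fin r) n

unique? : ∀ {m n} → Decidable (Unique {A = Fin m} {n})
unique? = allPairs? λ i j → ¬? (i ≟ᶠ j)

permutations : ∀ n → List (Vec (Fin n) n)
permutations n = filter unique? (words (allFin n) n)

coloredPermutations : ∀ n r → List (ColoredWord n r)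
coloredPermutations n r = cartesianProduct (permutations n) (words (allFin r) n)

-- The convention for position n + 1: since letters are numbered from 0,
-- the letter there is n.
extLetters extColors : ∀ {n r} → ColoredWord n r → Vec ℕ (suc n)
extLetters {n} (σ , _) = Vec.map toℕ σ ∷ʳ n
extColors      (_ , ε) = Vec.map toℕ ε ∷ʳ 0

Descent : ∀ {n r} → ColoredWord n r → Pred (Fin n) 0ℓ
Descent w k =
    c (inject₁ k) ℕ.> c (fsuc k)
  ⊎ (c (inject₁ k) ≡ c (fsuc k) × s (inject₁ k) ℕ.> s (fsuc k))
  where
  c = lookup (extColors w)
  s = lookup (extLetters w)

descent? : ∀ {n r} (w : ColoredWord n r) → Decidable (Descent w)
descent? w k =
  (_ ℕ.>? _) ⊎-dec ((_ ℕ.≟ _) ×-dec (_ ℕ.>? _))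

des : ∀ {n r} → ColoredWord n r → ℕ
des {n} w = length (filter (descent? w) (allFin n))

A : ℕ → ℕ → Poly
A zero      r = 1ₚ
A n@(suc _) r = sumListₚ (List.map (λ w → X ^ des w) (coloredPermutations n r))

Ã : ℕ → ℕ → Poly
Ã n r = sumₚ {suc n} λ m → (n C toℕ m) · ((X ^ (n ∸ toℕ m)) *ₚ A (toℕ m) r)

------------------------------------------------------------------------
-- Abstract simplicial complexes with vertices among Fin m

record SimplicialComplex (m : ℕ) : Set₁ where
  field
    Face     : Pred (Subset m) 0ℓ
    face?    : Decidable Face
    ∅-face   : Face ⊥
    ⊆-closed : ∀ {S T} → T ⊆ S → Face S → Face T

open SimplicialComplex public using (Face)

subsets : ∀ m → List (Subset m)
subsets = words (true ∷ false ∷ [])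

-- The number of faces with i vertices, that is, f_{i-1}.
faceCount : ∀ {m} → SimplicialComplex m → ℕ → ℕ
faceCount {m} Δ i =
  length (filter (λ S → face? S ×-dec (∣ S ∣ ℕ.≟ i)) (subsets m))
  where open SimplicialComplex Δ using (face?)

-- For Δ of dimension n - 1.
hPolynomial : ∀ n {m} → SimplicialComplex m → Poly
hPolynomial n Δ = sumₚ {suc n} λ i →
  faceCount Δ (toℕ i) · ((X ^ toℕ i) *ₚ ((1ₚ +ₚ (-ₚ X)) ^ (n ∸ toℕ i)))

-- The one-dimensional skeleton of the simplex S consists of the subsets
-- of S with at most two elements.
Flag : ∀ {m} → SimplicialComplex m → Set
Flag Δ = ∀ S → (∀ T → T ⊆ S → ∣ T ∣ ℕ.≤ 2 → Face Δ T) → Face Δ S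

------------------------------------------------------------------------
-- Real numbers, as Cauchy sequences of rationals

private
  module Identities where
    open +-*-Solver

    split-difference : ∀ a b → a ≡ (a ℚ.- b) ℚ.+ b
    split-difference = solve 2 (λ a b → a := (a :- b) :+ b) refl

    difference-+ : ∀ a b c d →
      (a ℚ.+ b) ℚ.- (c ℚ.+ d) ≡ (a ℚ.- c) ℚ.+ (b ℚ.- d)
    difference-+ = solve 4 (λ a b c d →
      (a :+ b) :- (c :+ d) := (a :- c) :+ (b :- d)) refl

    difference-* : ∀ a b c d →
      a ℚ.* b ℚ.- c ℚ.* d ≡ (a ℚ.- c) ℚ.* b ℚ.+ c ℚ.* (b ℚ.- d)
    difference-* = solve 4 (λ a b c d →
      (a :* b) :- (c :* d) := ((a :- c) :* b) :+ (c :* (b :- d))) refl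

    factor-out : ∀ b c d → d ℚ.* c ℚ.+ b ℚ.* d ≡ d ℚ.* (b ℚ.+ c)
    factor-out = solve 3 (λ b c d →
      (d :* c) :+ (b :* d) := d :* (b :+ c)) refl

  open Identities

Cauchy : (ℕ → ℚ) → Set
Cauchy s = ∀ ε → 0ℚ ℚ.< ε →
  ∃[ N ] ∀ m n → N ℕ.≤ m → N ℕ.≤ n → ℚ.∣ s m ℚ.- s n ∣ ℚ.≤ ε

record ℝ : Set where
  constructor mkℝ
  field
    seq    : ℕ → ℚ
    cauchy : Cauchy seq

open ℝ public

infix 4 _≈ᵣ_ _≤ᵣ_

_≈ᵣ_ _≤ᵣ_ : ℝ → ℝ → Set
x ≈ᵣ y = ∀ ε → 0ℚ ℚ.< ε → ∃[ N ] ∀ n → N ℕ.≤ n → ℚ.∣ seq x n ℚ.- seq y n ∣ ℚ.≤ ε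
x ≤ᵣ y = ∀ ε → 0ℚ ℚ.< ε → ∃[ N ] ∀ n → N ℕ.≤ n → seq x n ℚ.≤ seq y n ℚ.+ ε

-- Equality, order and arithmetic of reals only look at the sequences, so
-- the proofs of convergence are kept from unfolding.
abstract

  const-cauchy : ∀ q → Cauchy (λ _ → q)
  const-cauchy q ε 0<ε = 0 , λ _ _ _ _ →
    subst (λ z → ℚ.∣ z ∣ ℚ.≤ ε) (sym (ℚ.+-inverseʳ q)) (ℚ.<⇒≤ 0<ε)

  +-cauchy : ∀ x y → Cauchy (λ n → seq x n ℚ.+ seq y n)
  +-cauchy x y ε 0<ε =
    let 0<δ    = subst (ℚ._< ½ ℚ.* ε) (ℚ.*-zeroʳ ½) (ℚ.*-monoʳ-<-pos ½ 0<ε)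
        M , pM = cauchy x (½ ℚ.* ε) 0<δ
        N , pN = cauchy y (½ ℚ.* ε) 0<δ
    in M ℕ.⊔ N , λ m n ≤m ≤n →
       bound ε m n
         (pM m n (ℕ.m⊔n≤o⇒m≤o M N ≤m) (ℕ.m⊔n≤o⇒m≤o M N ≤n))
         (pN m n (ℕ.m⊔n≤o⇒n≤o M N ≤m) (ℕ.m⊔n≤o⇒n≤o M N ≤n))
    where
    s : ℕ → ℚ
    s n = seq x n ℚ.+ seq y n

    open ℚ.≤-Reasoning

    bound : ∀ ε m n →
            ℚ.∣ seq x m ℚ.- seq x n ∣ ℚ.≤ ½ ℚ.* ε →
            ℚ.∣ seq y m ℚ.- seq y n ∣ ℚ.≤ ½ ℚ.* ε →
            ℚ.∣ s m ℚ.- s n ∣ ℚ.≤ ε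
    bound ε m n p q = begin
      ℚ.∣ s m ℚ.- s n ∣
        ≡⟨ cong ℚ.∣_∣ (difference-+ (seq x m) (seq y m) (seq x n) (seq y n)) ⟩
      ℚ.∣ (seq x m ℚ.- seq x n) ℚ.+ (seq y m ℚ.- seq y n) ∣
        ≤⟨ ℚ.∣p+q∣≤∣p∣+∣q∣ (seq x m ℚ.- seq x n) (seq y m ℚ.- seq y n) ⟩
      ℚ.∣ seq x m ℚ.- seq x n ∣ ℚ.+ ℚ.∣ seq y m ℚ.- seq y n ∣
        ≤⟨ ℚ.+-mono-≤ p q ⟩
      ½ ℚ.* ε ℚ.+ ½ ℚ.* ε
        ≡⟨ sym (ℚ.*-distribʳ-+ ε ½ ½) ⟩
      1ℚ ℚ.* ε
        ≡⟨ ℚ.*-identityˡ ε ⟩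
      ε ∎

  eventuallyBounded : ∀ x → ∃₂ λ B N →
    0ℚ ℚ.< B × (∀ n → N ℕ.≤ n → ℚ.∣ seq x n ∣ ℚ.≤ B)
  eventuallyBounded x with cauchy x 1ℚ (ℚ.positive⁻¹ 1ℚ)
  ... | N , p = 1ℚ ℚ.+ ℚ.∣ seq x N ∣ , N
              , ℚ.+-mono-<-≤ (ℚ.positive⁻¹ 1ℚ) (ℚ.0≤∣p∣ (seq x N))
              , λ n N≤n → begin
    ℚ.∣ seq x n ∣
      ≡⟨ cong ℚ.∣_∣ (split-difference (seq x n) (seq x N)) ⟩
    ℚ.∣ (seq x n ℚ.- seq x N) ℚ.+ seq x N ∣
      ≤⟨ ℚ.∣p+q∣≤∣p∣+∣q∣ (seq x n ℚ.- seq x N) (seq x N) ⟩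
    ℚ.∣ seq x n ℚ.- seq x N ∣ ℚ.+ ℚ.∣ seq x N ∣
      ≤⟨ ℚ.+-monoˡ-≤ ℚ.∣ seq x N ∣ (p n N N≤n ℕ.≤-refl) ⟩
    1ℚ ℚ.+ ℚ.∣ seq x N ∣ ∎
    where
    open ℚ.≤-Reasoning

  quotient : ∀ ε d → 0ℚ ℚ.< ε → 0ℚ ℚ.< d → ∃[ δ ] 0ℚ ℚ.< δ × δ ℚ.* d ≡ ε
  quotient ε d 0<ε 0<d = δ , 0<δ , δ*d≡ε
    where
    instance
      d-pos : ℚ.Positive d
      d-pos = ℚ.positive 0<d

      d-nonZero : ℚ.NonZero d
      d-nonZero = ℚ.pos⇒nonZero d

    δ : ℚ
    δ = ε ℚ.* ℚ.1/ d

    0<δ : 0ℚ ℚ.< δ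
    0<δ = ℚ.≤-<-trans (ℚ.≤-reflexive (sym (ℚ.*-zeroˡ (ℚ.1/ d))))
            (ℚ.*-monoˡ-<-pos (ℚ.1/ d) {{ℚ.1/pos⇒pos d}} {0ℚ} {ε} 0<ε)

    δ*d≡ε : δ ℚ.* d ≡ ε
    δ*d≡ε = begin
      ε ℚ.* ℚ.1/ d ℚ.* d    ≡⟨ ℚ.*-assoc ε (ℚ.1/ d) d ⟩
      ε ℚ.* (ℚ.1/ d ℚ.* d)  ≡⟨ cong (ε ℚ.*_) (ℚ.*-inverseˡ d) ⟩
      ε ℚ.* 1ℚ              ≡⟨ ℚ.*-identityʳ ε ⟩
      ε                     ∎
      where open ≡-Reasoning

  *-cauchy : ∀ x y → Cauchy (λ n → seq x n ℚ.* seq y n)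
  *-cauchy x y = cauchy-s
    where
    s : ℕ → ℚ
    s n = seq x n ℚ.* seq y n

    open ℚ.≤-Reasoning

    bound : ∀ B B′ δ m n → 0ℚ ℚ.< B → 0ℚ ℚ.≤ δ →
            ℚ.∣ seq x n ∣ ℚ.≤ B → ℚ.∣ seq y m ∣ ℚ.≤ B′ →
            ℚ.∣ seq x m ℚ.- seq x n ∣ ℚ.≤ δ →
            ℚ.∣ seq y m ℚ.- seq y n ∣ ℚ.≤ δ →
            ℚ.∣ s m ℚ.- s n ∣ ℚ.≤ δ ℚ.* (B ℚ.+ B′)
    bound B B′ δ m n 0<B 0≤δ xB yB p q = begin
      ℚ.∣ s m ℚ.- s n ∣
        ≡⟨ cong ℚ.∣_∣ (difference-* (seq x m) (seq y m) (seq x n) (seq y n)) ⟩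
      ℚ.∣ dx ℚ.* seq y m ℚ.+ seq x n ℚ.* dy ∣
        ≤⟨ ℚ.∣p+q∣≤∣p∣+∣q∣ (dx ℚ.* seq y m) (seq x n ℚ.* dy) ⟩
      ℚ.∣ dx ℚ.* seq y m ∣ ℚ.+ ℚ.∣ seq x n ℚ.* dy ∣
        ≡⟨ cong₂ ℚ._+_ (ℚ.∣p*q∣≡∣p∣*∣q∣ dx (seq y m)) (ℚ.∣p*q∣≡∣p∣*∣q∣ (seq x n) dy) ⟩
      ℚ.∣ dx ∣ ℚ.* ℚ.∣ seq y m ∣ ℚ.+ ℚ.∣ seq x n ∣ ℚ.* ℚ.∣ dy ∣
        ≤⟨ ℚ.+-mono-≤ (*-mono p yB 0≤δ (ℚ.0≤∣p∣ (seq y m)))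
                      (*-mono xB q (ℚ.<⇒≤ 0<B) (ℚ.0≤∣p∣ dy)) ⟩
      δ ℚ.* B′ ℚ.+ B ℚ.* δ
        ≡⟨ factor-out B B′ δ ⟩
      δ ℚ.* (B ℚ.+ B′) ∎
      where
      dx dy : ℚ
      dx = seq x m ℚ.- seq x n
      dy = seq y m ℚ.- seq y n

      *-mono : ∀ {a b c d} → a ℚ.≤ b → c ℚ.≤ d → 0ℚ ℚ.≤ b → 0ℚ ℚ.≤ c →
               a ℚ.* c ℚ.≤ b ℚ.* d
      *-mono {b = b} {c = c} a≤b c≤d 0≤b 0≤c =
        ℚ.≤-trans (ℚ.*-monoʳ-≤-nonNeg c {{ℚ.nonNegative 0≤c}} a≤b)
                  (ℚ.*-monoˡ-≤-nonNeg b {{ℚ.nonNegative 0≤b}} c≤d)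

    cauchy-s : Cauchy s
    cauchy-s ε 0<ε =
      let B  , K , 0<B  , xB = eventuallyBounded x
          B′ , L , 0<B′ , yB = eventuallyBounded y
          δ , 0<δ , δ*[B+B′]≡ε = quotient ε (B ℚ.+ B′) 0<ε (ℚ.+-mono-< 0<B 0<B′)
          M , pM = cauchy x δ 0<δ
          N , pN = cauchy y δ 0<δ
      in (K ℕ.⊔ L) ℕ.⊔ (M ℕ.⊔ N) , λ m n ≤m ≤n →
        let KL≤m = ℕ.m⊔n≤o⇒m≤o (K ℕ.⊔ L) (M ℕ.⊔ N) ≤m
            KL≤n = ℕ.m⊔n≤o⇒m≤o (K ℕ.⊔ L) (M ℕ.⊔ N) ≤n
            MN≤m = ℕ.m⊔n≤o⇒n≤o (K ℕ.⊔ L) (M ℕ.⊔ N) ≤m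
            MN≤n = ℕ.m⊔n≤o⇒n≤o (K ℕ.⊔ L) (M ℕ.⊔ N) ≤n
        in ℚ.≤-trans
             (bound B B′ δ m n 0<B (ℚ.<⇒≤ 0<δ)
               (xB n (ℕ.m⊔n≤o⇒m≤o K L KL≤n))
               (yB m (ℕ.m⊔n≤o⇒n≤o K L KL≤m))
               (pM m n (ℕ.m⊔n≤o⇒m≤o M N MN≤m) (ℕ.m⊔n≤o⇒m≤o M N MN≤n))
               (pN m n (ℕ.m⊔n≤o⇒n≤o M N MN≤m) (ℕ.m⊔n≤o⇒n≤o M N MN≤n)))
             (ℚ.≤-reflexive δ*[B+B′]≡ε)

fromℚ : ℚ → ℝ
fromℚ q = mkℝ (λ _ → q) (const-cauchy q)

0ᵣ 1ᵣ : ℝ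
0ᵣ = fromℚ 0ℚ
1ᵣ = fromℚ 1ℚ

infixl 6 _+ᵣ_
infixl 7 _*ᵣ_

_+ᵣ_ _*ᵣ_ : ℝ → ℝ → ℝ
x +ᵣ y = mkℝ (λ n → seq x n ℚ.+ seq y n) (+-cauchy x y)
x *ᵣ y = mkℝ (λ n → seq x n ℚ.* seq y n) (*-cauchy x y)

realSemiring : RawSemiring 0ℓ 0ℓ
realSemiring = record
  { Carrier = ℝ ; _≈_ = _≈ᵣ_ ; _+_ = _+ᵣ_ ; _*_ = _*ᵣ_ ; 0# = 0ᵣ ; 1# = 1ᵣ }

open import Algebra.Definitions.RawSemiring realSemiring public
  using () renaming (sum to sumᵣ)

------------------------------------------------------------------------
-- Polytopes

Point : ℕ → Set
Point n = Vector ℝ n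

infix 4 _≈ᵥ_
_≈ᵥ_ : ∀ {n} → Point n → Point n → Set
x ≈ᵥ y = ∀ k → x k ≈ᵣ y k

0ᵥ : ∀ {n} → Point n
0ᵥ _ = 0ᵣ

⟨_,_⟩ : ∀ {n} → Vector ℝ n → Point n → ℝ
⟨ c , x ⟩ = sumᵣ λ k → c k *ᵣ x k

module _ {n m : ℕ} (v : Vector (Point n) m) where

  combination : Vector ℝ m → Point n
  combination a k = sumᵣ λ i → a i *ᵣ v i k

  InAffineHull InConvexHull : Pred (Point n) 0ℓ
  InAffineHull x = Σ[ a ∈ Vector ℝ m ]
    sumᵣ a ≈ᵣ 1ᵣ × x ≈ᵥ combination a
  InConvexHull x = Σ[ a ∈ Vector ℝ m ]
    (∀ i → 0ᵣ ≤ᵣ a i) × sumᵣ a ≈ᵣ 1ᵣ × x ≈ᵥ combination a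

  AffinelyIndependent : Pred (Subset m) 0ℓ
  AffinelyIndependent S =
    ∀ (a : Vector ℝ m) → (∀ i → i ∉ S → a i ≈ᵣ 0ᵣ) →
    sumᵣ a ≈ᵣ 0ᵣ → combination a ≈ᵥ 0ᵥ →
    ∀ i → a i ≈ᵣ 0ᵣ

  -- S is the set of all i for which v i lies on the face of conv v cut out
  -- by the valid inequality ⟨ c , x ⟩ ≤ b.
  CutsOutFace : Pred (Subset m) 0ℓ
  CutsOutFace S = Σ[ c ∈ Vector ℝ n ] Σ[ b ∈ ℝ ]
      (∀ x → InConvexHull x → ⟨ c , x ⟩ ≤ᵣ b)
    × (∀ i → i ∈ S ⇔ ⟨ c , v i ⟩ ≈ᵣ b)

-- The polytope is the convex hull of its vertices; an n-dimensional
-- polytope is taken inside its affine hull ℝⁿ.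
record Polytope (n : ℕ) : Set where
  field
    #vertices : ℕ
    vertex    : Vector (Point n) #vertices
    isVertex  : ∀ i → CutsOutFace vertex ⁅ i ⁆
    spans     : ∀ x → InAffineHull vertex x

open Polytope public

-- Faces are identified with their vertex sets; the empty face is proper.
ProperFace : ∀ {n} (P : Polytope n) → Pred (Subset (#vertices P)) 0ℓ
ProperFace P S = CutsOutFace (vertex P) S × ¬ S ≡ ⊤

Simplicial : ∀ {n} → Polytope n → Set
Simplicial P = ∀ S → ProperFace P S → AffinelyIndependent (vertex P) S

IsBoundaryComplex : ∀ {n} (P : Polytope n) → SimplicialComplex (#vertices P) → Set
IsBoundaryComplex P Δ = ∀ S → Face Δ S ⇔ ProperFace P S

{-# OPTIONS --safe #-}

-- Write α = 1 + t, β = t and r = 1 + s, and read sequences of polynomials as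
-- exponential generating functions in x.  The Eulerian series E and F solve
--   E′ = 1 + α E + β E²,    F′ = α F + β K F,    K j = (rʲ⁺¹ - sʲ⁺¹) E j,
-- with E 0 = 0 and F 0 = 1, and A⁺ = F, A⁻ = β V F for V j = sʲ E j.  Being
-- built from α and β with natural coefficients, both are γ-positive.  That
-- Ã = F + β V F follows since both sides, multiplied by 1 - t exp (r (1 - t) x),
-- give (1 - t) exp x; for Ã this comes from sorting the colored permutations by
-- their first letter.
--
-- The recursion of F is realized geometrically.  Subdividing an edge e of a
-- flag sphere adds t h(link e) to its h-polynomial.  In the suspension of a
-- sphere Y with pole N, subdivide the edges between N and the vertices of a
-- fixed facet of Y repeatedly, each new vertex replacing the end other than N:
-- the link of N stays isomorphic to Y, so every such subdivision adds
-- t h(link of a vertex of Y).  If the links of the faces of the facet of Y are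
-- joins of spheres with h-polynomials E j and F j, then a suitable order of the
-- subdivisions produces the next F and a facet with links of the same kind.
--
-- All these spheres are boundary complexes of simplicial polytopes with
-- rational vertices: the new vertex on the edge u v is κ (u + v) for κ slightly
-- larger than 1/2.  Supporting hyperplanes certify the faces, and for
-- nonadjacent u, v an expression of u + v as a nonnegative combination of the
-- vertices with coefficient sum < 2 certifies that they lie on no common facet.
module Submission where

-- The order of the subdivisions rests on an asymmetry. Subdividing the edge from N to a vertex of σ
-- turns the link of σ into the suspension of the link of σ ∪ {N}, whatever it was before, while
-- subdividing towards a vertex outside σ only adds a term. So only the events from the last one at
-- an element of σ onwards matter. `Ω` is arranged so that `n ∷ Ω n` ends with `j ∷ Ω j` for all j ≤
-- n, and `j ∷ Ω j` spells out the recursion of E. The multiplicities in K, which F needs and E does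
-- not, go in front, where only the empty face notices them.
--
-- Links are measured by f-polynomials in x = t / (1 - t): suspension multiplies by 1 + 2x, and a
-- subdivision adds x + x² times the f-polynomial of the link of the edge. For this reason the
-- recursions are set up for arbitrary α and β in any commutative ring.
--
-- Comparison of reals is not decidable, so faces of the polytope are never tested numerically:
-- whether a vertex set is a clique is decided in the graph, and either answer comes with a rational
-- certificate.

module ExponentialSeries where

  open import Algebra.Bundles using (CommutativeRing)
  open import Level using (0ℓ)
  open import Data.Nat.Base as ℕ using (ℕ; zero; suc)
  import Data.Nat.Properties as ℕ
  open import Data.Integer.Base as ℤ using (ℤ; +_; -[1+_]; 0ℤ; 1ℤ)
  import Data.Integer.Properties as ℤ
  open import Relation.Binary.PropositionalEquality as ≡ using (_≡_)

  -- Ring identities with integer coefficients, and the ring of exponential generating functions.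

  module IntegerSolver (R : CommutativeRing 0ℓ 0ℓ) where
    open CommutativeRing R
    open import Algebra.Solver.Ring.AlmostCommutativeRing
      using (AlmostCommutativeRing; fromCommutativeRing; _-Raw-AlmostCommutative⟶_)
    open import Algebra.Properties.Ring ring using (-0#≈0#; -‿distribˡ-*; -‿distribʳ-*; -‿involutive)
    open import Algebra.Properties.AbelianGroup +-abelianGroup using (⁻¹-∙-comm)
    open import Algebra.Properties.Semiring.Mult.TCOptimised semiring
      using (_×_; ×-homo-+; ×1-homo-*; 1+×)
    open import Algebra.Properties.CommutativeSemigroup +-commutativeSemigroup using (interchange)
    open import Relation.Binary.Reasoning.Setoid setoid
    open import Data.Maybe.Base using (map)
    open import Relation.Binary.Consequences using (dec⇒weaklyDec)

    -- The solver has to compare coefficients, and an arbitrary ring, such as one of series, has no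
    -- decidable equality. The integers have one and map to every ring; with the optimised multiple,
    -- `1 × 1#` reduces to `1#`.
    fromℤ : ℤ → Carrier
    fromℤ (+ n)    = n × 1#
    fromℤ -[1+ n ] = - (suc n × 1#)

    fromℤ-⊖ : ∀ m n → fromℤ (m ℤ.⊖ n) ≈ m × 1# + - (n × 1#)
    fromℤ-⊖ m zero = sym (trans (+-congˡ -0#≈0#) (+-identityʳ _))
    fromℤ-⊖ zero (suc n) = sym (+-identityˡ _)
    fromℤ-⊖ (suc m) (suc n) = begin
      fromℤ (suc m ℤ.⊖ suc n)                      ≡⟨ ≡.cong fromℤ (ℤ.[1+m]⊖[1+n]≡m⊖n m n) ⟩
      fromℤ (m ℤ.⊖ n)                              ≈⟨ fromℤ-⊖ m n ⟩
      m × 1# + - (n × 1#)                          ≈⟨ +-identityˡ _ ⟨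
      0# + (m × 1# + - (n × 1#))                   ≈⟨ +-congʳ (-‿inverseʳ 1#) ⟨
      (1# + - 1#) + (m × 1# + - (n × 1#))          ≈⟨ interchange _ _ _ _ ⟩
      (1# + m × 1#) + (- 1# + - (n × 1#))          ≈⟨ +-congˡ (⁻¹-∙-comm _ _) ⟩
      (1# + m × 1#) + - (1# + n × 1#)              ≈⟨ +-cong (1+× m 1#) (-‿cong (1+× n 1#)) ⟨
      suc m × 1# + - (suc n × 1#)                  ∎

    fromℤ-+ : ∀ i j → fromℤ (i ℤ.+ j) ≈ fromℤ i + fromℤ j
    fromℤ-+ (+ m)    (+ n)    = ×-homo-+ 1# m n
    fromℤ-+ (+ m)    -[1+ n ] = fromℤ-⊖ m (suc n)
    fromℤ-+ -[1+ m ] (+ n)    = trans (fromℤ-⊖ n (suc m)) (+-comm _ _)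
    fromℤ-+ -[1+ m ] -[1+ n ] = begin
      - (suc (suc (m ℕ.+ n)) × 1#)       ≡⟨ ≡.cong (λ k → - (k × 1#)) (ℕ.+-suc (suc m) n) ⟨
      - ((suc m ℕ.+ suc n) × 1#)         ≈⟨ -‿cong (×-homo-+ 1# (suc m) (suc n)) ⟩
      - (suc m × 1# + suc n × 1#)        ≈⟨ ⁻¹-∙-comm _ _ ⟨
      - (suc m × 1#) + - (suc n × 1#)    ∎

    fromℤ-neg : ∀ i → fromℤ (ℤ.- i) ≈ - fromℤ i
    fromℤ-neg (+ zero)  = sym -0#≈0#
    fromℤ-neg (+ suc n) = refl
    fromℤ-neg -[1+ n ]  = sym (-‿involutive _)

    fromℤ-* : ∀ i j → fromℤ (i ℤ.* j) ≈ fromℤ i * fromℤ j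
    fromℤ-* (+ m) (+ n) = trans (reflexive (≡.cong fromℤ (≡.sym (ℤ.pos-* m n)))) (×1-homo-* m n)
    fromℤ-* (+ m) -[1+ n ] = begin
      fromℤ (+ m ℤ.* -[1+ n ])         ≡⟨ ≡.cong fromℤ (ℤ.neg-distribʳ-* (+ m) (+ suc n)) ⟨
      fromℤ (ℤ.- (+ m ℤ.* + suc n))    ≈⟨ fromℤ-neg (+ m ℤ.* + suc n) ⟩
      - fromℤ (+ m ℤ.* + suc n)        ≈⟨ -‿cong (fromℤ-* (+ m) (+ suc n)) ⟩
      - (m × 1# * (suc n × 1#))        ≈⟨ -‿distribʳ-* _ _ ⟩
      m × 1# * - (suc n × 1#)          ∎
    fromℤ-* -[1+ m ] (+ n) = begin
      fromℤ (-[1+ m ] ℤ.* + n)         ≡⟨ ≡.cong fromℤ (ℤ.neg-distribˡ-* (+ suc m) (+ n)) ⟨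
      fromℤ (ℤ.- (+ suc m ℤ.* + n))    ≈⟨ fromℤ-neg (+ suc m ℤ.* + n) ⟩
      - fromℤ (+ suc m ℤ.* + n)        ≈⟨ -‿cong (fromℤ-* (+ suc m) (+ n)) ⟩
      - (suc m × 1# * (n × 1#))        ≈⟨ -‿distribˡ-* _ _ ⟩
      - (suc m × 1#) * (n × 1#)        ∎
    fromℤ-* -[1+ m ] -[1+ n ] = begin
      (suc m ℕ.* suc n) × 1#               ≈⟨ ×1-homo-* (suc m) (suc n) ⟩
      suc m × 1# * (suc n × 1#)            ≈⟨ -‿involutive _ ⟨
      - - (suc m × 1# * (suc n × 1#))      ≈⟨ -‿cong (-‿distribʳ-* _ _) ⟩
      - (suc m × 1# * - (suc n × 1#))      ≈⟨ -‿distribˡ-* _ _ ⟩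
      - (suc m × 1#) * - (suc n × 1#)      ∎

    private
      target : AlmostCommutativeRing 0ℓ 0ℓ
      target = fromCommutativeRing R

      morphism : ℤ.+-*-rawRing -Raw-AlmostCommutative⟶ target
      morphism = record
        { ⟦_⟧ = fromℤ ; +-homo = fromℤ-+ ; *-homo = fromℤ-* ; -‿homo = fromℤ-neg
        ; 0-homo = refl ; 1-homo = refl }

    open import Algebra.Solver.Ring ℤ.+-*-rawRing target morphism
      (λ i j → map (λ eq → reflexive (≡.cong fromℤ eq)) (dec⇒weaklyDec ℤ._≟_ i j))
      public using (solve; _:=_; _:+_; _:*_; :-_; _:-_; con; Polynomial)

    :0 :1 : ∀ {n} → Polynomial n
    :0 = con 0ℤ
    :1 = con 1ℤ

  -- Sequences f over R, read as exponential generating functions Σ f n xⁿ / n!.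
  -- The product is defined through the Leibniz rule.
  module Hurwitz (R : CommutativeRing 0ℓ 0ℓ) where
    open CommutativeRing R
    open import Algebra.Properties.CommutativeSemigroup +-commutativeSemigroup using (interchange)
    open import Relation.Binary.Reasoning.Setoid setoid

    Series : Set
    Series = ℕ → Carrier

    infix 4 _≋_
    _≋_ : Series → Series → Set
    f ≋ g = ∀ n → f n ≈ g n

    ∂ : Series → Series
    ∂ f n = f (suc n)

    infixl 6 _⊕_
    infixl 7 _⊛_
    _⊕_ _⊛_ : Series → Series → Series
    (f ⊕ g) n = f n + g n
    (f ⊛ g) zero    = f 0 * g 0
    (f ⊛ g) (suc n) = (∂ f ⊛ g) n + (f ⊛ ∂ g) n

    ⊖_ : Series → Series
    (⊖ f) n = - f n

    const : Carrier → Series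
    const a zero    = a
    const a (suc n) = 0#

    ⊛-cong : ∀ {f f′ g g′} → f ≋ f′ → g ≋ g′ → f ⊛ g ≋ f′ ⊛ g′
    ⊛-cong p q zero    = *-cong (p 0) (q 0)
    ⊛-cong p q (suc n) = +-cong (⊛-cong (λ k → p (suc k)) q n) (⊛-cong p (λ k → q (suc k)) n)

    ⊛-comm : ∀ f g → f ⊛ g ≋ g ⊛ f
    ⊛-comm f g zero    = *-comm _ _
    ⊛-comm f g (suc n) = trans (+-comm _ _) (+-cong (⊛-comm f (∂ g) n) (⊛-comm (∂ f) g n))

    ⊛-distribˡ : ∀ f g h → f ⊛ (g ⊕ h) ≋ f ⊛ g ⊕ f ⊛ h
    ⊛-distribˡ f g h zero    = distribˡ _ _ _
    ⊛-distribˡ f g h (suc n) =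
      trans (+-cong (⊛-distribˡ (∂ f) g h n) (⊛-distribˡ f (∂ g) (∂ h) n)) (interchange _ _ _ _)

    ⊛-distribʳ : ∀ f g h → (g ⊕ h) ⊛ f ≋ g ⊛ f ⊕ h ⊛ f
    ⊛-distribʳ f g h n = begin
      ((g ⊕ h) ⊛ f) n          ≈⟨ ⊛-comm (g ⊕ h) f n ⟩
      (f ⊛ (g ⊕ h)) n          ≈⟨ ⊛-distribˡ f g h n ⟩
      (f ⊛ g) n + (f ⊛ h) n    ≈⟨ +-cong (⊛-comm f g n) (⊛-comm f h n) ⟩
      (g ⊛ f) n + (h ⊛ f) n    ∎

    ⊛-assoc : ∀ f g h → (f ⊛ g) ⊛ h ≋ f ⊛ (g ⊛ h)
    ⊛-assoc f g h zero    = *-assoc _ _ _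
    ⊛-assoc f g h (suc n) = begin
      ((∂ f ⊛ g ⊕ f ⊛ ∂ g) ⊛ h) n + ((f ⊛ g) ⊛ ∂ h) n
        ≈⟨ +-congʳ (⊛-distribʳ h (∂ f ⊛ g) (f ⊛ ∂ g) n) ⟩
      (((∂ f ⊛ g) ⊛ h) n + ((f ⊛ ∂ g) ⊛ h) n) + ((f ⊛ g) ⊛ ∂ h) n
        ≈⟨ +-assoc _ _ _ ⟩
      ((∂ f ⊛ g) ⊛ h) n + (((f ⊛ ∂ g) ⊛ h) n + ((f ⊛ g) ⊛ ∂ h) n)
        ≈⟨ +-cong (⊛-assoc (∂ f) g h n) (+-cong (⊛-assoc f (∂ g) h n) (⊛-assoc f g (∂ h) n)) ⟩
      (∂ f ⊛ (g ⊛ h)) n + ((f ⊛ (∂ g ⊛ h)) n + (f ⊛ (g ⊛ ∂ h)) n)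
        ≈⟨ +-congˡ (⊛-distribˡ f (∂ g ⊛ h) (g ⊛ ∂ h) n) ⟨
      (∂ f ⊛ (g ⊛ h)) n + (f ⊛ ∂ (g ⊛ h)) n  ∎

    const-⊛ : ∀ a f n → (const a ⊛ f) n ≈ a * f n
    zero-⊛ : ∀ f n → ((λ _ → 0#) ⊛ f) n ≈ 0#
    zero-⊛ f zero    = zeroˡ _
    zero-⊛ f (suc n) = trans (+-cong (zero-⊛ f n) (zero-⊛ (∂ f) n)) (+-identityˡ _)
    const-⊛ a f zero    = refl
    const-⊛ a f (suc n) = trans (+-cong (zero-⊛ f n) (const-⊛ a (∂ f) n)) (+-identityˡ _)

    seriesRing : CommutativeRing 0ℓ 0ℓ
    seriesRing = record
      { Carrier = Series ; _≈_ = _≋_ ; _+_ = _⊕_ ; _*_ = _⊛_ ; -_ = ⊖_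
      ; 0# = λ _ → 0# ; 1# = const 1#
      ; isCommutativeRing = record
        { isRing = record
          { +-isAbelianGroup = record
            { isGroup = record
              { isMonoid = record
                { isSemigroup = record
                  { isMagma = record
                    { isEquivalence = record
                      { refl = λ _ → refl ; sym = λ p n → sym (p n) ; trans = λ p q n → trans (p n) (q n) }
                    ; ∙-cong = λ p q n → +-cong (p n) (q n) }
                  ; assoc = λ _ _ _ _ → +-assoc _ _ _ }
                ; identity = (λ _ _ → +-identityˡ _) , (λ _ _ → +-identityʳ _) }
              ; inverse = (λ _ _ → -‿inverseˡ _) , (λ _ _ → -‿inverseʳ _)
              ; ⁻¹-cong = λ p n → -‿cong (p n) }
            ; comm = λ _ _ _ → +-comm _ _ }
          ; *-cong = ⊛-cong
          ; *-assoc = ⊛-assoc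
          ; *-identity = (λ f n → trans (const-⊛ 1# f n) (*-identityˡ _))
                       , (λ f n → trans (⊛-comm f (const 1#) n) (trans (const-⊛ 1# f n) (*-identityˡ _)))
          ; distrib = ⊛-distribˡ , ⊛-distribʳ }
        ; *-comm = ⊛-comm } }
      where open import Data.Product.Base using (_,_)

-- The commutative ring of integer polynomials.

module Polynomials where

  open import Defs
  open import Algebra.Bundles using (CommutativeRing)
  open import Level using (0ℓ)
  open import Data.Nat.Base using (ℕ; zero; suc)
  open import Data.Integer.Base as ℤ using (ℤ; +_; 0ℤ)
  import Data.Integer.Properties as ℤ
  open import Data.List.Base as List using (List; []; _∷_)
  open import Data.Product.Base using (_,_)
  open import Relation.Binary.PropositionalEquality using (_≡_; refl; sym; trans; cong; cong₂; module ≡-Reasoning)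

  module Convolution where
    open import Data.Integer.Solver using (module +-*-Solver)
    open +-*-Solver
    open ≡-Reasoning

    infixl 7 _∗_
    -- The Cauchy product on coefficient functions. Trailing zeros are invisible here, so the ring
    -- laws are proved for `_∗_` and transferred to `_*ₚ_` by `coeff-*`.
    _∗_ : (ℕ → ℤ) → (ℕ → ℤ) → ℕ → ℤ
    (f ∗ g) zero    = f 0 ℤ.* g 0
    (f ∗ g) (suc n) = f 0 ℤ.* g (suc n) ℤ.+ ((λ k → f (suc k)) ∗ g) n

    ∗-cong : ∀ {f f′ g g′} → (∀ k → f k ≡ f′ k) → (∀ k → g k ≡ g′ k) → ∀ n → (f ∗ g) n ≡ (f′ ∗ g′) n
    ∗-cong p q zero    = cong₂ ℤ._*_ (p 0) (q 0)
    ∗-cong p q (suc n) =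
      cong₂ ℤ._+_ (cong₂ ℤ._*_ (p 0) (q (suc n))) (∗-cong (λ k → p (suc k)) q n)

    -- The definition of `_∗_` peels off `f 0`; commutativity needs this mirror image, which peels
    -- off `g 0`.
    ∗-suc : ∀ f g n → (f ∗ g) (suc n) ≡ (f ∗ (λ k → g (suc k))) n ℤ.+ f (suc n) ℤ.* g 0
    ∗-suc f g zero    = refl
    ∗-suc f g (suc n) =
      trans (cong (λ z → f 0 ℤ.* g (suc (suc n)) ℤ.+ z) (∗-suc (λ k → f (suc k)) g n)) (sym (ℤ.+-assoc (f 0 ℤ.* g (suc (suc n))) _ _))

    ∗-comm : ∀ f g n → (f ∗ g) n ≡ (g ∗ f) n
    ∗-comm f g zero    = ℤ.*-comm (f 0) (g 0)
    ∗-comm f g (suc n) = begin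
      f 0 ℤ.* g (suc n) ℤ.+ ((λ k → f (suc k)) ∗ g) n  ≡⟨ cong₂ ℤ._+_ (ℤ.*-comm (f 0) _) (∗-comm (λ k → f (suc k)) g n) ⟩
      g (suc n) ℤ.* f 0 ℤ.+ (g ∗ (λ k → f (suc k))) n  ≡⟨ ℤ.+-comm (g (suc n) ℤ.* f 0) _ ⟩
      (g ∗ (λ k → f (suc k))) n ℤ.+ g (suc n) ℤ.* f 0  ≡⟨ ∗-suc g f n ⟨
      (g ∗ f) (suc n)                                  ∎

    ∗-distribʳ : ∀ f g h n → ((λ k → g k ℤ.+ h k) ∗ f) n ≡ (g ∗ f) n ℤ.+ (h ∗ f) n
    ∗-distribʳ f g h zero    = ℤ.*-distribʳ-+ (f 0) (g 0) (h 0)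
    ∗-distribʳ f g h (suc n) rewrite ∗-distribʳ f (λ k → g (suc k)) (λ k → h (suc k)) n =
      solve 5 (λ a b c d e → (a :+ b) :* c :+ (d :+ e) := a :* c :+ d :+ (b :* c :+ e)) refl
        (g 0) (h 0) (f (suc n)) (((λ k → g (suc k)) ∗ f) n) (((λ k → h (suc k)) ∗ f) n)

    ∗-scaleˡ : ∀ c f g n → ((λ k → c ℤ.* f k) ∗ g) n ≡ c ℤ.* (f ∗ g) n
    ∗-scaleˡ c f g zero    = ℤ.*-assoc c (f 0) (g 0)
    ∗-scaleˡ c f g (suc n) rewrite ∗-scaleˡ c (λ k → f (suc k)) g n =
      solve 4 (λ a b c d → a :* b :* c :+ a :* d := a :* (b :* c :+ d)) refl
        c (f 0) (g (suc n)) (((λ k → f (suc k)) ∗ g) n)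

    ∗-assoc : ∀ f g h n → ((f ∗ g) ∗ h) n ≡ (f ∗ (g ∗ h)) n
    ∗-assoc f g h zero    = ℤ.*-assoc (f 0) (g 0) (h 0)
    ∗-assoc f g h (suc n) = begin
      f 0 ℤ.* g 0 ℤ.* h (suc n) ℤ.+ ((λ k → f 0 ℤ.* g′ k ℤ.+ (f′ ∗ g) k) ∗ h) n
        ≡⟨ cong (λ z → f 0 ℤ.* g 0 ℤ.* h (suc n) ℤ.+ z) (∗-distribʳ h (λ k → f 0 ℤ.* g′ k) (f′ ∗ g) n) ⟩
      f 0 ℤ.* g 0 ℤ.* h (suc n) ℤ.+ (((λ k → f 0 ℤ.* g′ k) ∗ h) n ℤ.+ ((f′ ∗ g) ∗ h) n)
        ≡⟨ cong₂ (λ x y → f 0 ℤ.* g 0 ℤ.* h (suc n) ℤ.+ (x ℤ.+ y)) (∗-scaleˡ (f 0) g′ h n) (∗-assoc f′ g h n) ⟩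
      f 0 ℤ.* g 0 ℤ.* h (suc n) ℤ.+ (f 0 ℤ.* (g′ ∗ h) n ℤ.+ (f′ ∗ (g ∗ h)) n)
        ≡⟨ solve 5 (λ a b c d e → a :* b :* c :+ (a :* d :+ e) := a :* (b :* c :+ d) :+ e) refl
             (f 0) (g 0) (h (suc n)) ((g′ ∗ h) n) ((f′ ∗ (g ∗ h)) n) ⟩
      f 0 ℤ.* (g ∗ h) (suc n) ℤ.+ (f′ ∗ (g ∗ h)) n ∎
      where
      f′ = λ k → f (suc k)
      g′ = λ k → g (suc k)

  open Convolution using (_∗_; ∗-cong; ∗-comm; ∗-distribʳ; ∗-assoc)

  coeff-+ : ∀ p q k → coeff (p +ₚ q) k ≡ coeff p k ℤ.+ coeff q k
  coeff-+ []      q       k       = sym (ℤ.+-identityˡ _)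
  coeff-+ (a ∷ p) []      k       = sym (ℤ.+-identityʳ _)
  coeff-+ (a ∷ p) (b ∷ q) zero    = refl
  coeff-+ (a ∷ p) (b ∷ q) (suc k) = coeff-+ p q k

  coeff-map : ∀ (f : ℤ → ℤ) → f 0ℤ ≡ 0ℤ → ∀ p k → coeff (List.map f p) k ≡ f (coeff p k)
  coeff-map f f0 []      k       = sym f0
  coeff-map f f0 (a ∷ p) zero    = refl
  coeff-map f f0 (a ∷ p) (suc k) = coeff-map f f0 p k

  coeff-- : ∀ p k → coeff (-ₚ p) k ≡ ℤ.- coeff p k
  coeff-- = coeff-map ℤ.-_ refl

  coeff-* : ∀ p q k → coeff (p *ₚ q) k ≡ (coeff p ∗ coeff q) k
  coeff-* [] q k = sym (zero-∗ k)
    where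
    zero-∗ : ∀ k → (coeff [] ∗ coeff q) k ≡ 0ℤ
    zero-∗ zero    = ℤ.*-zeroˡ (coeff q 0)
    zero-∗ (suc k) = cong₂ ℤ._+_ (ℤ.*-zeroˡ (coeff q (suc k))) (zero-∗ k)
  coeff-* (a ∷ p) q k =
    trans (coeff-+ (List.map (a ℤ.*_) q) _ k)
      (trans (cong (ℤ._+ _) (coeff-map (a ℤ.*_) (ℤ.*-zeroʳ a) q k)) (go k))
    where
    go : ∀ k → a ℤ.* coeff q k ℤ.+ coeff (0ℤ ∷ (p *ₚ q)) k ≡ (coeff (a ∷ p) ∗ coeff q) k
    go zero    = ℤ.+-identityʳ _
    go (suc k) = cong (λ z → a ℤ.* coeff q (suc k) ℤ.+ z) (coeff-* p q k)

  private
    *ₚ-comm : ∀ p q → p *ₚ q ≈ₚ q *ₚ p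
    *ₚ-comm p q k = trans (coeff-* p q k) (trans (∗-comm (coeff p) (coeff q) k) (sym (coeff-* q p k)))

    *ₚ-cong : ∀ {p p′ q q′} → p ≈ₚ p′ → q ≈ₚ q′ → p *ₚ q ≈ₚ p′ *ₚ q′
    *ₚ-cong {p} {p′} {q} {q′} e f k =
      trans (coeff-* p q k) (trans (∗-cong e f k) (sym (coeff-* p′ q′ k)))

    *ₚ-assoc : ∀ p q r → (p *ₚ q) *ₚ r ≈ₚ p *ₚ (q *ₚ r)
    *ₚ-assoc p q r k = begin
      coeff ((p *ₚ q) *ₚ r) k                ≡⟨ coeff-* (p *ₚ q) r k ⟩
      (coeff (p *ₚ q) ∗ coeff r) k           ≡⟨ ∗-cong {g = coeff r} (coeff-* p q) (λ _ → refl) k ⟩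
      ((coeff p ∗ coeff q) ∗ coeff r) k      ≡⟨ ∗-assoc (coeff p) (coeff q) (coeff r) k ⟩
      (coeff p ∗ (coeff q ∗ coeff r)) k      ≡⟨ ∗-cong {f = coeff p} (λ _ → refl) (coeff-* q r) k ⟨
      (coeff p ∗ coeff (q *ₚ r)) k           ≡⟨ coeff-* p (q *ₚ r) k ⟨
      coeff (p *ₚ (q *ₚ r)) k                ∎
      where open ≡-Reasoning

    *ₚ-distribʳ : ∀ p q r → (q +ₚ r) *ₚ p ≈ₚ q *ₚ p +ₚ r *ₚ p
    *ₚ-distribʳ p q r k = begin
      coeff ((q +ₚ r) *ₚ p) k                                   ≡⟨ coeff-* (q +ₚ r) p k ⟩
      (coeff (q +ₚ r) ∗ coeff p) k                              ≡⟨ ∗-cong {g = coeff p} (coeff-+ q r) (λ _ → refl) k ⟩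
      ((λ j → coeff q j ℤ.+ coeff r j) ∗ coeff p) k             ≡⟨ ∗-distribʳ (coeff p) (coeff q) (coeff r) k ⟩
      (coeff q ∗ coeff p) k ℤ.+ (coeff r ∗ coeff p) k           ≡⟨ cong₂ ℤ._+_ (coeff-* q p k) (coeff-* r p k) ⟨
      coeff (q *ₚ p) k ℤ.+ coeff (r *ₚ p) k                     ≡⟨ coeff-+ (q *ₚ p) (r *ₚ p) k ⟨
      coeff (q *ₚ p +ₚ r *ₚ p) k                                ∎
      where open ≡-Reasoning

    +ₚ-cong : ∀ {p p′ q q′} → p ≈ₚ p′ → q ≈ₚ q′ → p +ₚ q ≈ₚ p′ +ₚ q′
    +ₚ-cong {p} {p′} {q} {q′} e f k =
      trans (coeff-+ p q k) (trans (cong₂ ℤ._+_ (e k) (f k)) (sym (coeff-+ p′ q′ k)))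

    +ₚ-comm : ∀ p q → p +ₚ q ≈ₚ q +ₚ p
    +ₚ-comm p q k = trans (coeff-+ p q k) (trans (ℤ.+-comm (coeff p k) _) (sym (coeff-+ q p k)))

    +ₚ-assoc : ∀ p q r → (p +ₚ q) +ₚ r ≈ₚ p +ₚ (q +ₚ r)
    +ₚ-assoc p q r k
      rewrite coeff-+ (p +ₚ q) r k | coeff-+ p q k | coeff-+ p (q +ₚ r) k | coeff-+ q r k =
      ℤ.+-assoc (coeff p k) _ _

    +ₚ-identityʳ : ∀ p → p +ₚ 0ₚ ≈ₚ p
    +ₚ-identityʳ p k = trans (coeff-+ p 0ₚ k) (ℤ.+-identityʳ _)

    -ₚ-inverseˡ : ∀ p → (-ₚ p) +ₚ p ≈ₚ 0ₚ
    -ₚ-inverseˡ p k = trans (coeff-+ (-ₚ p) p k) (trans (cong (ℤ._+ coeff p k) (coeff-- p k)) (ℤ.+-inverseˡ (coeff p k)))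

    *ₚ-identityˡ : ∀ p → 1ₚ *ₚ p ≈ₚ p
    *ₚ-identityˡ p k = trans (coeff-* 1ₚ p k) (go k)
      where
      zero-∗ : ∀ k → (coeff [] ∗ coeff p) k ≡ 0ℤ
      zero-∗ k = sym (coeff-* [] p k)
      go : ∀ k → (coeff 1ₚ ∗ coeff p) k ≡ coeff p k
      go zero    = ℤ.*-identityˡ _
      go (suc k) = trans (cong₂ ℤ._+_ (ℤ.*-identityˡ (coeff p (suc k))) (zero-∗ k)) (ℤ.+-identityʳ _)

  -- _≈ₚ_ wrapped into a record, from which the two polynomials can be inferred.
  infix 4 _≐_
  record _≐_ (p q : Poly) : Set where
    constructor pointwise
    field at : p ≈ₚ q

  open _≐_ public

  polyRing : CommutativeRing 0ℓ 0ℓ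
  polyRing = record
    { Carrier = Poly ; _≈_ = _≐_ ; _+_ = _+ₚ_ ; _*_ = _*ₚ_ ; -_ = -ₚ_ ; 0# = 0ₚ ; 1# = 1ₚ
    ; isCommutativeRing = record
      { isRing = record
        { +-isAbelianGroup = record
          { isGroup = record
            { isMonoid = record
              { isSemigroup = record
                { isMagma = record
                  { isEquivalence = record
                    { refl  = pointwise λ _ → refl
                    ; sym   = λ e → pointwise λ k → sym (at e k)
                    ; trans = λ e f → pointwise λ k → trans (at e k) (at f k) }
                  ; ∙-cong = λ {p} {p′} {q} {q′} e f → pointwise (+ₚ-cong {p} {p′} {q} {q′} (at e) (at f)) }
                ; assoc = λ p q r → pointwise (+ₚ-assoc p q r) }
              ; identity = (λ _ → pointwise λ _ → refl) , (λ p → pointwise (+ₚ-identityʳ p)) }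
            ; inverse = (λ p → pointwise (-ₚ-inverseˡ p))
                      , (λ p → pointwise λ k → trans (+ₚ-comm p (-ₚ p) k) (-ₚ-inverseˡ p k))
            ; ⁻¹-cong = λ {p} {q} e → pointwise λ k → trans (coeff-- p k) (trans (cong ℤ.-_ (at e k)) (sym (coeff-- q k))) }
          ; comm = λ p q → pointwise (+ₚ-comm p q) }
        ; *-cong = λ {p} {p′} {q} {q′} e f → pointwise (*ₚ-cong {p} {p′} {q} {q′} (at e) (at f))
        ; *-assoc = λ p q r → pointwise (*ₚ-assoc p q r)
        ; *-identity = (λ p → pointwise (*ₚ-identityˡ p))
                     , (λ p → pointwise λ k → trans (*ₚ-comm p 1ₚ k) (*ₚ-identityˡ p k))
        ; distrib = (λ p q r → pointwise λ k → trans (*ₚ-comm p (q +ₚ r) k)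
                      (trans (*ₚ-distribʳ p q r k)
                        (+ₚ-cong {q *ₚ p} {p *ₚ q} {r *ₚ p} {p *ₚ r} (*ₚ-comm q p) (*ₚ-comm r p) k)))
                  , (λ p q r → pointwise (*ₚ-distribʳ p q r)) }
      ; *-comm = λ p q → pointwise (*ₚ-comm p q) } }

-- The series E, F and G: recursions indexed by lists of events, and weights in α and β.

module EulerianRecursion where

  open ExponentialSeries
  open import Algebra.Bundles using (CommutativeRing)
  open import Level using (0ℓ)
  open import Data.Nat.Base as ℕ using (ℕ; zero; suc; _∸_; _≤_; z≤n; s≤s; pred)
  import Data.Nat.Properties as ℕ
  open import Data.Nat.Induction using (<-rec)
  open import Data.List.Base as List using (List; []; _∷_; _++_; replicate)
  open import Data.List.Relation.Unary.All as All using (All; []; _∷_)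
  import Data.List.Relation.Unary.All.Properties as All
  open import Function.Base using (_∘_)
  open import Relation.Binary.PropositionalEquality as ≡ using (_≡_)

  -- As a multiset, suc i runs through Ω k once for every subset of
  -- {0, …, k} of that size other than ∅ and the full set.
  Ω : ℕ → List ℕ
  Ω zero    = []
  Ω (suc k) = 0 ∷ (List.map suc (Ω k) ++ (k ∷ Ω k))

  Ω-< : ∀ k → All (ℕ._< k) (Ω k)
  Ω-< zero    = []
  Ω-< (suc k) = s≤s z≤n ∷ All.++⁺ (All.map⁺ (All.map s≤s (Ω-< k)))
                                  (ℕ.≤-refl ∷ All.map ℕ.m≤n⇒m≤1+n (Ω-< k))

  -- difference s j = (1 + s)ʲ⁺¹ - sʲ⁺¹
  difference : ℕ → ℕ → ℕ
  difference s zero    = 1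
  difference s (suc j) = suc s ℕ.^ suc j ℕ.+ s ℕ.* difference s j

  difference-nonZero : ∀ s j → ℕ.NonZero (difference s j)
  difference-nonZero s zero    = _
  difference-nonZero s (suc j) =
    ℕ.>-nonZero (ℕ.<-≤-trans (ℕ.m^n>0 (suc s) (suc j)) (ℕ.m≤m+n _ _))

  -- As a multiset, word s k contains i exactly difference s (suc i) times for
  -- every occurrence in (k - 1) ∷ Ω (k - 1).
  word : ℕ → ℕ → List ℕ
  word s zero    = []
  word s (suc k) = List.concatMap (λ i → replicate (pred (difference s (suc i))) i) (k ∷ Ω k) ++ (k ∷ Ω k)

  word-< : ∀ s k → All (ℕ._< k) (word s k)
  word-< s zero    = []
  word-< s (suc k) = All.++⁺ (All.concat⁺ (All.map⁺ (All.map (λ {i} i<k → All.replicate⁺ _ i<k) bound))) bound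
    where
    bound : All (ℕ._< suc k) (k ∷ Ω k)
    bound = ℕ.≤-refl ∷ All.map ℕ.m≤n⇒m≤1+n (Ω-< k)

  module ListSum (R : CommutativeRing 0ℓ 0ℓ) where
    open CommutativeRing R hiding (zero)
    open import Algebra.Properties.Semiring.Mult semiring public using () renaming (_×_ to _·′_)
    open import Algebra.Properties.CommutativeSemigroup +-commutativeSemigroup using (interchange)
    open import Relation.Binary.Reasoning.Setoid setoid

    Σ[_] : List ℕ → (ℕ → Carrier) → Carrier
    Σ[ []     ] φ = 0#
    Σ[ i ∷ is ] φ = φ i + Σ[ is ] φ

    Σ-cong : ∀ {φ ψ} {is} → All (λ i → φ i ≈ ψ i) is → Σ[ is ] φ ≈ Σ[ is ] ψ
    Σ-cong []       = refl
    Σ-cong (p ∷ ps) = +-cong p (Σ-cong ps)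

    Σ-++ : ∀ is js φ → Σ[ is ++ js ] φ ≈ Σ[ is ] φ + Σ[ js ] φ
    Σ-++ []       js φ = sym (+-identityˡ _)
    Σ-++ (i ∷ is) js φ = trans (+-congˡ (Σ-++ is js φ)) (sym (+-assoc _ _ _))

    Σ-map-suc : ∀ is φ → Σ[ List.map suc is ] φ ≈ Σ[ is ] (φ ∘ suc)
    Σ-map-suc []       φ = refl
    Σ-map-suc (i ∷ is) φ = +-congˡ (Σ-map-suc is φ)

    Σ-*ˡ : ∀ is φ x → x * Σ[ is ] φ ≈ Σ[ is ] (λ i → x * φ i)
    Σ-*ˡ []       φ x = zeroʳ x
    Σ-*ˡ (i ∷ is) φ x = trans (distribˡ _ _ _) (+-congˡ (Σ-*ˡ is φ x))

    Σ-*ʳ : ∀ is φ x → Σ[ is ] φ * x ≈ Σ[ is ] (λ i → φ i * x)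
    Σ-*ʳ []       φ x = zeroˡ x
    Σ-*ʳ (i ∷ is) φ x = trans (distribʳ _ _ _) (+-congˡ (Σ-*ʳ is φ x))

    Σ-replicate : ∀ m i φ → Σ[ replicate m i ] φ ≈ m ·′ φ i
    Σ-replicate zero    i φ = refl
    Σ-replicate (suc m) i φ = +-congˡ (Σ-replicate m i φ)

    -- One of the `m i` copies of each index sits in the final `is`, the others come before. A sum
    -- does not see this split; it serves the order of the subdivisions.
    Σ-repeat : ∀ (m : ℕ → ℕ) .{{_ : ∀ {i} → ℕ.NonZero (m i)}} is φ →
               Σ[ List.concatMap (λ i → replicate (pred (m i)) i) is ++ is ] φ ≈ Σ[ is ] (λ i → m i ·′ φ i)
    Σ-repeat m is φ = trans (Σ-++ (List.concatMap (λ i → replicate (pred (m i)) i) is) is φ) (go is)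
      where
      go : ∀ is → Σ[ List.concatMap (λ i → replicate (pred (m i)) i) is ] φ + Σ[ is ] φ
                  ≈ Σ[ is ] (λ i → m i ·′ φ i)
      go []       = +-identityˡ _
      go (i ∷ is) = begin
        Σ[ replicate (pred (m i)) i ++ rest ] φ + (φ i + Σ[ is ] φ)
          ≈⟨ +-congʳ (trans (Σ-++ (replicate (pred (m i)) i) rest φ) (+-congʳ (Σ-replicate (pred (m i)) i φ))) ⟩
        (pred (m i) ·′ φ i + Σ[ rest ] φ) + (φ i + Σ[ is ] φ)
          ≈⟨ interchange _ _ _ _ ⟩
        (pred (m i) ·′ φ i + φ i) + (Σ[ rest ] φ + Σ[ is ] φ)
          ≈⟨ +-cong (+-comm _ _) (go is) ⟩
        suc (pred (m i)) ·′ φ i + Σ[ is ] (λ i → m i ·′ φ i)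
          ≡⟨ ≡.cong (λ c → c ·′ φ i + Σ[ is ] (λ i → m i ·′ φ i)) (ℕ.suc-pred (m i)) ⟩
        m i ·′ φ i + Σ[ is ] (λ i → m i ·′ φ i)  ∎
        where rest = List.concatMap (λ i → replicate (pred (m i)) i) is

  module Eulerian (R : CommutativeRing 0ℓ 0ℓ) (α β : CommutativeRing.Carrier R) (s : ℕ) where
    open CommutativeRing R hiding (zero)
    open Hurwitz R
    open ListSum R public
    open import Relation.Binary.Reasoning.Setoid setoid
    module ≋ = CommutativeRing seriesRing

    -- For f′ = Φ f this says that the term n + 1 of f depends only on its terms up to n, which
    -- makes the equation solvable and its solution unique.
    Causal : (Series → Series) → Set
    Causal Φ = ∀ {f g n} → (∀ {m} → m ≤ n → f m ≈ g m) → Φ f n ≈ Φ g n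

    private
      -- Picard iteration with `k` as fuel: the terms of index at most `k` no longer change. The
      -- value `a` returned without fuel lies beyond them and does not affect `integral`.
      approximation : Carrier → (Series → Series) → ℕ → Series
      approximation a Φ k       zero    = a
      approximation a Φ zero    (suc m) = a
      approximation a Φ (suc k) (suc m) = Φ (approximation a Φ k) m

      approximation-stable : ∀ {a Φ} → Causal Φ → ∀ {k l m} → m ≤ k → m ≤ l →
                             approximation a Φ k m ≈ approximation a Φ l m
      approximation-stable causal {m = zero}  p q = refl
      approximation-stable causal {m = suc m} (s≤s p) (s≤s q) =
        causal λ j≤m → approximation-stable causal (ℕ.≤-trans j≤m p) (ℕ.≤-trans j≤m q)

    integral : Carrier → (Series → Series) → Series
    integral a Φ n = approximation a Φ n n

    ∂-integral : ∀ a {Φ} → Causal Φ → ∂ (integral a Φ) ≋ Φ (integral a Φ)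
    ∂-integral a causal n = causal λ m≤n → approximation-stable causal m≤n ℕ.≤-refl

    ⊛-causal : ∀ {f f′ g g′ n} → (∀ {m} → m ≤ n → f m ≈ f′ m) → (∀ {m} → m ≤ n → g m ≈ g′ m) →
               (f ⊛ g) n ≈ (f′ ⊛ g′) n
    ⊛-causal {n = zero}  p q = *-cong (p z≤n) (q z≤n)
    ⊛-causal {n = suc n} p q =
      +-cong (⊛-causal (λ m≤n → p (s≤s m≤n)) (λ m≤n → q (ℕ.m≤n⇒m≤1+n m≤n)))
             (⊛-causal (λ m≤n → p (ℕ.m≤n⇒m≤1+n m≤n)) (λ m≤n → q (s≤s m≤n)))

    abstract
      -- For α = 1 + t and β = t this is the Riccati equation solved by (exp ((1 - t) x) - 1) / (1 -
      -- t exp ((1 - t) x)), so for n ≥ 1 the terms are the Eulerian polynomials 1, 1 + t, 1 + 4t +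
      -- t², and so on.
      E : Series
      E = integral 0# λ f n → const 1# n + α * f n + β * (f ⊛ f) n

      E₀ : E 0 ≈ 0#
      E₀ = refl

      ∂E : ∀ n → E (suc n) ≈ const 1# n + α * E n + β * (E ⊛ E) n
      ∂E = ∂-integral 0# λ p → +-cong (+-congˡ (*-congˡ (p ℕ.≤-refl))) (*-congˡ (⊛-causal p p))

    K : Series
    K j = difference s j ·′ E j

    abstract
      F : Series
      F = integral 1# λ f n → α * f n + β * (K ⊛ f) n

      F₀ : F 0 ≈ 1#
      F₀ = refl

      ∂F : ∀ n → F (suc n) ≈ α * F n + β * (K ⊛ F) n
      ∂F = ∂-integral 1# λ p → +-cong (*-congˡ (p ℕ.≤-refl)) (*-congˡ (⊛-causal (λ _ → refl) p))

    V G : Series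
    V j = (s ℕ.^ j) ·′ E j
    G n = β * (V ⊛ F) n

    K₀ : K 0 ≈ 0#
    K₀ = trans (+-identityʳ _) E₀

    V₀ : V 0 ≈ 0#
    V₀ = trans (+-identityʳ _) E₀

    -- Used to recognise the components of E over a product ring as the series E of the factors.
    E-unique : ∀ {f} → f 0 ≈ 0# → (∀ n → f (suc n) ≈ const 1# n + α * f n + β * (f ⊛ f) n) → f ≋ E
    E-unique {f} f₀ ∂f = <-rec (λ n → f n ≈ E n) λ where
      zero    ih → trans f₀ (sym E₀)
      (suc n) ih → trans (∂f n) (trans
        (+-cong (+-congˡ (*-congˡ (ih ℕ.≤-refl))) (*-congˡ (⊛-causal (λ p → ih (s≤s p)) (λ p → ih (s≤s p)))))
        (sym (∂E n)))

    F-unique : ∀ {f} → f 0 ≈ 1# → (∀ n → f (suc n) ≈ α * f n + β * (K ⊛ f) n) → f ≋ F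
    F-unique {f} f₀ ∂f = <-rec (λ n → f n ≈ F n) λ where
      zero    ih → trans f₀ (sym F₀)
      (suc n) ih → trans (∂f n) (trans
        (+-cong (*-congˡ (ih ℕ.≤-refl)) (*-congˡ (⊛-causal (λ _ → refl) (λ p → ih (s≤s p)))))
        (sym (∂F n)))

    -- The product is a sum over the subsets of {0, ..., n}: the empty set gives the first term, the
    -- full set the entry `n`, the others `Ω n`. Binomial coefficients are thus repeated entries of
    -- a list, as a list of events requires. In the induction ∂ f takes the subsets that contain a
    -- new element, ∂ g the others.
    ⊛-suc : ∀ f g n → (f ⊛ g) (suc n) ≈ f 0 * g (suc n) + Σ[ n ∷ Ω n ] (λ i → f (suc i) * g (n ∸ i))
    ⊛-suc f g zero    = trans (+-comm _ _) (+-congˡ (sym (+-identityʳ _)))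
    ⊛-suc f g (suc n) = begin
      (∂ f ⊛ g) (suc n) + (f ⊛ ∂ g) (suc n)
        ≈⟨ +-cong (⊛-suc (∂ f) g n) (⊛-suc f (∂ g) n) ⟩
      (f 1 * g (suc n) + (f (2 ℕ.+ n) * g (n ∸ n) + Σ[ Ω n ] φ)) + (f 0 * g (2 ℕ.+ n) + Σ[ n ∷ Ω n ] χ)
        ≈⟨ +-cong (+-congˡ (+-congʳ (*-congˡ (reflexive (≡.cong g (ℕ.n∸n≡0 n))))))
                  (+-congˡ (Σ-cong (All.map shift (ℕ.≤-refl ∷ All.map ℕ.<⇒≤ (Ω-< n))))) ⟩
      (f 1 * g (suc n) + (f (2 ℕ.+ n) * g 0 + Σ[ Ω n ] φ)) + (f 0 * g (2 ℕ.+ n) + Σ[ n ∷ Ω n ] ψ)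
        ≈⟨ solve 5 (λ a b c d e → (a :+ (b :+ c)) :+ (d :+ e) := d :+ (b :+ (a :+ (c :+ e)))) refl
             (f 1 * g (suc n)) (f (2 ℕ.+ n) * g 0) (Σ[ Ω n ] φ) (f 0 * g (2 ℕ.+ n)) (Σ[ n ∷ Ω n ] ψ) ⟩
      f 0 * g (2 ℕ.+ n) + (f (2 ℕ.+ n) * g 0 + (f 1 * g (suc n) + (Σ[ Ω n ] φ + Σ[ n ∷ Ω n ] ψ)))
        ≈⟨ +-congˡ (+-cong (*-congˡ (reflexive (≡.cong g (ℕ.n∸n≡0 n))))
             (+-congˡ (trans (Σ-++ (List.map suc (Ω n)) (n ∷ Ω n) ψ) (+-congʳ (Σ-map-suc (Ω n) ψ))))) ⟨
      f 0 * g (2 ℕ.+ n) + Σ[ suc n ∷ Ω (suc n) ] ψ ∎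
      where
      open IntegerSolver R
      φ χ ψ : ℕ → Carrier
      φ i = f (2 ℕ.+ i) * g (n ∸ i)
      χ i = f (suc i) * g (suc (n ∸ i))
      ψ i = f (suc i) * g (suc n ∸ i)
      shift : ∀ {i} → i ≤ n → χ i ≈ ψ i
      shift i≤n = *-congˡ (reflexive (≡.cong g (≡.sym (ℕ.+-∸-assoc 1 i≤n))))

    E₁ : E 1 ≈ 1#
    E₁ = begin
      E 1                                 ≈⟨ ∂E 0 ⟩
      1# + α * E 0 + β * (E 0 * E 0)     ≈⟨ +-cong (+-congˡ (*-congˡ E₀)) (*-congˡ (*-cong E₀ E₀)) ⟩
      1# + α * 0# + β * (0# * 0#)         ≈⟨ solve 2 (λ a b → :1 :+ a :* :0 :+ b :* (:0 :* :0) := :1) refl α β ⟩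
      1#                                  ∎
      where open IntegerSolver R

    -- `E 0` is zero, which kills the terms of both the empty and the full subset and leaves `Ω n`.
    E-step : ∀ n → E (2 ℕ.+ n) ≈ α * E (suc n) + β * Σ[ Ω n ] (λ i → E (suc i) * E (n ∸ i))
    E-step n = begin
      E (2 ℕ.+ n)                                      ≈⟨ ∂E (suc n) ⟩
      0# + α * E (suc n) + β * (E ⊛ E) (suc n)         ≈⟨ +-cong (+-identityˡ _) (*-congˡ (⊛-suc E E n)) ⟩
      α * E (suc n) + β * (E 0 * E (suc n) + (E (suc n) * E (n ∸ n) + S))
        ≈⟨ +-congˡ (*-congˡ (+-cong (*-congʳ E₀) (+-congʳ (*-congˡ (trans (reflexive (≡.cong E (ℕ.n∸n≡0 n))) E₀))))) ⟩
      α * E (suc n) + β * (0# * E (suc n) + (E (suc n) * 0# + S))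
        ≈⟨ solve 4 (λ a b e x → a :* e :+ b :* (:0 :* e :+ (e :* :0 :+ x)) := a :* e :+ b :* x) refl α β (E (suc n)) S ⟩
      α * E (suc n) + β * S ∎
      where
      open IntegerSolver R
      S = Σ[ Ω n ] (λ i → E (suc i) * E (n ∸ i))

    F₁ : F 1 ≈ α
    F₁ = begin
      F 1                                          ≈⟨ ∂F 0 ⟩
      α * F 0 + β * (K 0 * F 0)                    ≈⟨ +-cong (*-congˡ F₀) (*-congˡ (*-cong K₀ F₀)) ⟩
      α * 1# + β * (0# * 1#)                       ≈⟨ solve 2 (λ a b → a :* :1 :+ b :* (:0 :* :1) := a) refl α β ⟩
      α                                            ∎
      where open IntegerSolver R

    -- Here only the empty subset drops out, by `K 0 = 0`; the full one survives because `F 0 = 1`.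
    -- The multiplicities in K are absorbed into repetitions in `word`.
    F-step : ∀ n → F (2 ℕ.+ n) ≈ α * F (suc n) + β * Σ[ word s (suc n) ] (λ i → E (suc i) * F (n ∸ i))
    F-step n = begin
      F (2 ℕ.+ n)                                           ≈⟨ ∂F (suc n) ⟩
      α * F (suc n) + β * (K ⊛ F) (suc n)                   ≈⟨ +-congˡ (*-congˡ (⊛-suc K F n)) ⟩
      α * F (suc n) + β * (K 0 * F (suc n) + S)     ≈⟨ +-congˡ (*-congˡ (+-congʳ (*-congʳ K₀))) ⟩
      α * F (suc n) + β * (0# * F (suc n) + S)
        ≈⟨ solve 4 (λ a b f x → a :* f :+ b :* (:0 :* f :+ x) := a :* f :+ b :* x) refl α β (F (suc n)) S ⟩
      α * F (suc n) + β * S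
        ≈⟨ +-congˡ (*-congˡ (Σ-cong {is = n ∷ Ω n} (All.universal (λ i → ×-assoc-* (difference s (suc i)) _ _) _))) ⟩
      α * F (suc n) + β * Σ[ n ∷ Ω n ] (λ i → difference s (suc i) ·′ (E (suc i) * F (n ∸ i)))
        ≈⟨ +-congˡ (*-congˡ (Σ-repeat (λ i → difference s (suc i)) {{λ {i} → difference-nonZero s (suc i)}} (n ∷ Ω n) _)) ⟨
      α * F (suc n) + β * Σ[ word s (suc n) ] (λ i → E (suc i) * F (n ∸ i)) ∎
      where
      open IntegerSolver R
      open import Algebra.Properties.Semiring.Mult semiring using (×-assoc-*)
      S = Σ[ n ∷ Ω n ] (λ i → K (suc i) * F (n ∸ i))

    -- Natural combinations of products of α and β, homogeneous of weight n for α of weight 1 and β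
    -- of weight 2. With α = 1 + t and β = t the products are tⁱ (1 + t)ⁿ⁻²ⁱ. Derivations, unlike
    -- values, can be evaluated in several rings.
    data Γ : ℕ → Carrier → Set where
      Γ-1  : Γ 0 1#
      Γ-α  : ∀ {n x} → Γ n x → Γ (suc n) (α * x)
      Γ-β  : ∀ {n x} → Γ n x → Γ (2 ℕ.+ n) (β * x)
      Γ-0  : ∀ {n} → Γ n 0#
      Γ-+  : ∀ {n x y} → Γ n x → Γ n y → Γ n (x + y)
      Γ-≈  : ∀ {n x y} → x ≈ y → Γ n x → Γ n y

    Γ-* : ∀ {m n x y} → Γ m x → Γ n y → Γ (m ℕ.+ n) (x * y)
    Γ-* Γ-1        q = Γ-≈ (sym (*-identityˡ _)) q
    Γ-* (Γ-α p)    q = Γ-≈ (sym (*-assoc _ _ _)) (Γ-α (Γ-* p q))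
    Γ-* (Γ-β p)    q = Γ-≈ (sym (*-assoc _ _ _)) (Γ-β (Γ-* p q))
    Γ-* Γ-0        q = Γ-≈ (sym (zeroˡ _)) Γ-0
    Γ-* (Γ-+ p p′) q = Γ-≈ (sym (distribʳ _ _ _)) (Γ-+ (Γ-* p q) (Γ-* p′ q))
    Γ-* (Γ-≈ e p)  q = Γ-≈ (*-congʳ e) (Γ-* p q)

    Γ-· : ∀ m {n x} → Γ n x → Γ n (m ·′ x)
    Γ-· zero    p = Γ-0
    Γ-· (suc m) p = Γ-+ p (Γ-· m p)

    Γ-Σ : ∀ {n φ is} → All (λ i → Γ n (φ i)) is → Γ n (Σ[ is ] φ)
    Γ-Σ []       = Γ-0
    Γ-Σ (p ∷ ps) = Γ-+ p (Γ-Σ ps)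

    Γ-E : ∀ n → Γ n (E (suc n))
    Γ-E n = up-to n ℕ.≤-refl
      where
      -- The recursion reaches several earlier terms at once, so it runs on an upper bound `n` of
      -- the index.
      up-to : ∀ n {m} → m ≤ n → Γ m (E (suc m))
      up-to n       {zero}  _         = Γ-≈ (sym E₁) Γ-1
      up-to (suc n) {suc m} (s≤s m≤n) =
        Γ-≈ (sym (E-step m)) (Γ-+ (Γ-α (up-to n m≤n)) product)
        where
        term : ∀ {i} → i ℕ.< m → Γ (suc m) (β * (E (suc i) * E (m ∸ i)))
        term {i} i<m with m ∸ i in eq
        ... | zero  = contradiction i<m (ℕ.≤⇒≯ (ℕ.m∸n≡0⇒m≤n eq))
          where open import Relation.Nullary.Negation using (contradiction)
        ... | suc j = ≡.subst (λ k → Γ k (β * (E (suc i) * E (suc j)))) dims (Γ-β (Γ-* (up-to n (ℕ.≤-trans (ℕ.<⇒≤ i<m) m≤n)) (up-to n (ℕ.≤-trans j≤m m≤n))))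
          where
          j≤m : j ≤ m
          j≤m = ℕ.≤-trans (ℕ.n≤1+n j) (ℕ.≤-trans (ℕ.≤-reflexive (≡.sym eq)) (ℕ.m∸n≤m m i))
          dims : 2 ℕ.+ (i ℕ.+ j) ≡ suc m
          dims = ≡.cong suc (≡.trans (≡.sym (ℕ.+-suc i j)) (≡.trans (≡.cong (i ℕ.+_) (≡.sym eq)) (ℕ.m+[n∸m]≡n (ℕ.<⇒≤ i<m))))
        product : Γ (suc m) (β * Σ[ Ω m ] (λ i → E (suc i) * E (m ∸ i)))
        product = Γ-≈ (sym (Σ-*ˡ (Ω m) _ β)) (Γ-Σ (All.map term (Ω-< m)))

    Γ-EF : ∀ {m i} → (∀ {j} → j ≤ m → Γ j (F j)) → i ≤ m → Γ m (E (suc i) * F (m ∸ i))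
    Γ-EF {m} {i} ih i≤m = ≡.subst (λ k → Γ k (E (suc i) * F (m ∸ i))) (ℕ.m+[n∸m]≡n i≤m) (Γ-* (Γ-E i) (ih (ℕ.m∸n≤m m i)))

    Γ-F : ∀ n → Γ n (F n)
    Γ-F n = up-to n ℕ.≤-refl
      where
      up-to : ∀ n {m} → m ≤ n → Γ m (F m)
      up-to n       {zero}        _ = Γ-≈ (sym F₀) Γ-1
      up-to (suc n) {suc zero}    _ = Γ-≈ (trans (*-identityʳ α) (sym F₁)) (Γ-α Γ-1)
      up-to (suc n) {suc (suc m)} (s≤s m<n) =
        Γ-≈ (sym (F-step m))
          (Γ-+ (Γ-α (up-to n m<n))
               (Γ-β (Γ-Σ (All.map (λ { (s≤s i≤m) → Γ-EF (λ j≤m → up-to n (ℕ.≤-trans j≤m (ℕ.<⇒≤ m<n))) i≤m })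
                                  (word-< s (suc m))))))

    -- As `V 0` vanishes and `E (i + 1)` has weight i, the product of V and F at index n + 1 has
    -- weight n only; the factor β adds 2. Hence the weight is one more than the index.
    Γ-G : ∀ n → Γ (suc n) (G n)
    Γ-G zero    = Γ-≈ (sym (trans (*-congˡ (trans (*-congʳ V₀) (zeroˡ _))) (zeroʳ β))) (Γ-0 {1})
    Γ-G (suc n) = Γ-β (Γ-≈ (sym V⊛F) (Γ-Σ (term ℕ.≤-refl ∷ All.map (λ i<n → term (ℕ.<⇒≤ i<n)) (Ω-< n))))
      where
      term : ∀ {i} → i ≤ n → Γ n (V (suc i) * F (n ∸ i))
      term {i} i≤n = Γ-≈ (sym (×-assoc-* (s ℕ.^ suc i) (E (suc i)) (F (n ∸ i)))) (Γ-· (s ℕ.^ suc i) (Γ-EF (λ {j} _ → Γ-F j) i≤n))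
        where open import Algebra.Properties.Semiring.Mult semiring using (×-assoc-*)
      V⊛F : (V ⊛ F) (suc n) ≈ Σ[ n ∷ Ω n ] (λ i → V (suc i) * F (n ∸ i))
      V⊛F = trans (⊛-suc V F n)
              (trans (+-congʳ (trans (*-congʳ V₀) (zeroˡ _))) (+-identityˡ _))

-- Differential equations for E, F and F + β V F, and the closed form of the last.

module ClosedForms where

  open ExponentialSeries
  open EulerianRecursion
  open import Algebra.Bundles using (CommutativeRing)
  open import Level using (0ℓ)
  open import Data.Nat.Base as ℕ using (ℕ; zero; suc; s≤s)
  import Data.Nat.Properties as ℕ
  open import Data.Nat.Induction using (<-rec)
  open import Relation.Binary.PropositionalEquality as ≡ using (_≡_)

  module Exponential (R : CommutativeRing 0ℓ 0ℓ) where
    open CommutativeRing R hiding (zero)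
    open Hurwitz R
    open import Algebra.Properties.Semiring.Exp semiring using () renaming (_^_ to _^′_)
    open import Relation.Binary.Reasoning.Setoid setoid

    exp : Carrier → Series
    exp a n = a ^′ n

    ∂-exp : ∀ a → ∂ (exp a) ≋ const a ⊛ exp a
    ∂-exp a n = sym (const-⊛ a (exp a) n)

    const-+ : ∀ a b → const (a + b) ≋ const a ⊕ const b
    const-+ a b zero    = refl
    const-+ a b (suc n) = sym (+-identityˡ _)

    const-* : ∀ a b → const (a * b) ≋ const a ⊛ const b
    const-* a b zero    = refl
    const-* a b (suc n) = sym (trans (const-⊛ a (const b) (suc n)) (zeroʳ a))

    const-neg : ∀ a → const (- a) ≋ ⊖ const a
    const-neg a zero    = refl
    const-neg a (suc n) = sym -0#≈0#
      where open import Algebra.Properties.Ring ring using (-0#≈0#)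

    -- The substitution of a x for x in the generating function.
    scale : Carrier → Series → Series
    scale a f n = a ^′ n * f n

    ∂-scale : ∀ a f → ∂ (scale a f) ≋ const a ⊛ scale a (∂ f)
    ∂-scale a f n = trans (*-assoc _ _ _) (sym (const-⊛ a (scale a (∂ f)) n))

    scale-⊕ : ∀ a f g → scale a (f ⊕ g) ≋ scale a f ⊕ scale a g
    scale-⊕ a f g n = distribˡ _ _ _

    scale-const : ∀ a b → scale a (const b) ≋ const b
    scale-const a b zero    = *-identityˡ b
    scale-const a b (suc n) = zeroʳ _

    scale-⊛ : ∀ a f g → scale a (f ⊛ g) ≋ scale a f ⊛ scale a g
    scale-⊛ a f g zero    = trans (*-identityˡ _) (sym (*-cong (*-identityˡ _) (*-identityˡ _)))
    scale-⊛ a f g (suc n) = begin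
      a * a ^′ n * ((∂ f ⊛ g) n + (f ⊛ ∂ g) n)
        ≈⟨ trans (*-assoc _ _ _) (*-congˡ (distribˡ _ _ _)) ⟩
      a * (scale a (∂ f ⊛ g) n + scale a (f ⊛ ∂ g) n)
        ≈⟨ *-congˡ (+-cong (scale-⊛ a (∂ f) g n) (scale-⊛ a f (∂ g) n)) ⟩
      a * ((scale a (∂ f) ⊛ scale a g) n + (scale a f ⊛ scale a (∂ g)) n)
        ≈⟨ const-⊛ a (scale a (∂ f) ⊛ scale a g ⊕ scale a f ⊛ scale a (∂ g)) n ⟨
      (const a ⊛ (scale a (∂ f) ⊛ scale a g ⊕ scale a f ⊛ scale a (∂ g))) n
        ≈⟨ solve 5 (λ a f f′ g g′ → a :* (f′ :* g :+ f :* g′) := (a :* f′) :* g :+ f :* (a :* g′)) (λ _ → refl)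
             (const a) (scale a f) (scale a (∂ f)) (scale a g) (scale a (∂ g)) n ⟩
      ((const a ⊛ scale a (∂ f)) ⊛ scale a g) n + (scale a f ⊛ (const a ⊛ scale a (∂ g))) n
        ≈⟨ +-cong (⊛-cong (∂-scale a f) (λ _ → refl) n) (⊛-cong (λ _ → refl) (∂-scale a g) n) ⟨
      (∂ (scale a f) ⊛ scale a g) n + (scale a f ⊛ ∂ (scale a g)) n ∎
      where open IntegerSolver seriesRing

    ⊛-vanishing : ∀ f g n → (∀ m → m ℕ.< n → g m ≈ 0#) → (f ⊛ g) n ≈ f 0 * g n
    ⊛-vanishing f g zero    v = refl
    ⊛-vanishing f g (suc n) v = begin
      (∂ f ⊛ g) n + (f ⊛ ∂ g) n
        ≈⟨ +-cong (trans (⊛-vanishing (∂ f) g n λ m m<n → v m (ℕ.m≤n⇒m≤1+n m<n)) (*-congˡ (v n ℕ.≤-refl)))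
                  (⊛-vanishing f (∂ g) n λ m m<n → v (suc m) (s≤s m<n)) ⟩
      f 1 * 0# + f 0 * g (suc n)  ≈⟨ +-congʳ (zeroʳ _) ⟩
      0# + f 0 * g (suc n)        ≈⟨ +-identityˡ _ ⟩
      f 0 * g (suc n)             ∎

    -- If the terms of g - h before index n vanish, the term n of its product with f is `f 0` times
    -- that of g - h. Regularity of `f 0` is therefore enough, where 1 - t is not invertible over
    -- the polynomials.
    ⊛-cancelˡ : ∀ f g h → (∀ {x} → f 0 * x ≈ 0# → x ≈ 0#) → f ⊛ g ≋ f ⊛ h → g ≋ h
    ⊛-cancelˡ f g h regular eq n = begin
      g n                  ≈⟨ solve 2 (λ x y → x := (x :- y) :+ y) refl (g n) (h n) ⟩
      (g n - h n) + h n    ≈⟨ +-congʳ (<-rec (λ n → d n ≈ 0#) step n) ⟩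
      0# + h n             ≈⟨ +-identityˡ _ ⟩
      h n                  ∎
      where
      open IntegerSolver R
      module H = IntegerSolver seriesRing
      d : Series
      d = g ⊕ ⊖ h
      step : ∀ n → (∀ {m} → m ℕ.< n → d m ≈ 0#) → d n ≈ 0#
      step n ih = regular (begin
        f 0 * d n                     ≈⟨ ⊛-vanishing f d n (λ m → ih {m}) ⟨
        (f ⊛ d) n                     ≈⟨ H.solve 3 (λ f g h → f H.:* (g H.:- h) H.:= f H.:* g H.:- f H.:* h) (λ _ → refl) f g h n ⟩
        (f ⊛ g) n - (f ⊛ h) n         ≈⟨ +-congʳ (eq n) ⟩
        (f ⊛ h) n - (f ⊛ h) n         ≈⟨ -‿inverseʳ _ ⟩
        0#                            ∎)

    linear-unique : ∀ {f g y} → f 0 ≈ g 0 → ∂ f ≋ y ⊛ f → ∂ g ≋ y ⊛ g → f ≋ g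
    linear-unique {f} {g} {y} e₀ ∂f ∂g = <-rec (λ n → f n ≈ g n) λ where
      zero    ih → e₀
      -- The zeros are placeholders for α, β and s; `⊛-causal` speaks of products of series only.
      (suc n) ih → trans (∂f n) (trans (Eulerian.⊛-causal R 0# 0# 0 (λ _ → refl) (λ m≤n → ih (s≤s m≤n))) (sym (∂g n)))

  -- Throughout, e = exp (ρ (1 - t)) and D = 1 - t e with ρ = 1 + s.
  module ClosedForm (R : CommutativeRing 0ℓ 0ℓ) (t : CommutativeRing.Carrier R) (s : ℕ) where
    open CommutativeRing R hiding (zero)
    open Hurwitz R
    open Exponential R
    open Eulerian R (1# + t) t s
    open import Algebra.Properties.Semiring.Exp semiring using () renaming (_^_ to _^′_)
    open import Algebra.Properties.Semiring.Mult semiring using (×-assoc-*; ×-homo-+; ×1-homo-*; ×-congʳ)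
    open ≋ using () renaming (sym to ≋-sym; trans to ≋-trans; refl to ≋-refl)
    module ≋-Reasoning where
      open import Relation.Binary.Reasoning.Setoid ≋.setoid public

    private
      r : ℕ
      r = suc s

      sˢ rˢ tˢ 1ˢ : Series
      sˢ = const (s ·′ 1#)
      rˢ = const (r ·′ 1#)
      tˢ = const t
      1ˢ = const 1#

    rˢ≋1+sˢ : rˢ ≋ 1ˢ ⊕ sˢ
    rˢ≋1+sˢ = const-+ 1# (s ·′ 1#)

    multiple : ∀ k n x → (k ℕ.^ n) ·′ x ≈ (k ·′ 1#) ^′ n * x
    multiple k n x = begin
      (k ℕ.^ n) ·′ x           ≈⟨ ×-congʳ (k ℕ.^ n) (*-identityˡ x) ⟨
      (k ℕ.^ n) ·′ (1# * x)    ≈⟨ ×-assoc-* (k ℕ.^ n) 1# x ⟨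
      (k ℕ.^ n) ·′ 1# * x      ≈⟨ *-congʳ (power n) ⟩
      (k ·′ 1#) ^′ n * x        ∎
      where
      open import Relation.Binary.Reasoning.Setoid setoid
      power : ∀ n → (k ℕ.^ n) ·′ 1# ≈ (k ·′ 1#) ^′ n
      power zero    = +-identityʳ 1#
      power (suc n) = trans (×1-homo-* k (k ℕ.^ n)) (*-congˡ (power n))

    W : Series
    W = scale (r ·′ 1#) E

    V≋ : V ≋ scale (s ·′ 1#) E
    V≋ n = multiple s n (E n)

    -- The two powers in `difference` separate, so that K is r E(r x) - s E(s x) as a generating
    -- function.
    K≋ : K ≋ rˢ ⊛ W ⊕ ⊖ (sˢ ⊛ V)
    K≋ n = begin
      K n                                                        ≈⟨ solve 2 (λ x y → x := (x :+ y) :- y) refl (K n) (s ·′ V n) ⟩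
      (K n + s ·′ V n) - s ·′ V n                                  ≈⟨ +-cong sum (-‿cong (sV s (V n))) ⟩
      r ·′ 1# * W n - s ·′ 1# * V n                                ≈⟨ +-cong (const-⊛ (r ·′ 1#) W n) (-‿cong (const-⊛ (s ·′ 1#) V n)) ⟨
      (rˢ ⊛ W) n - (sˢ ⊛ V) n                                    ∎
      where
      open IntegerSolver R
      open import Relation.Binary.Reasoning.Setoid setoid
      open import Algebra.Properties.Semiring.Mult semiring using (×-assocˡ)
      sV : ∀ k x → k ·′ x ≈ k ·′ 1# * x
      sV k x = sym (trans (×-assoc-* k 1# x) (×-congʳ k (*-identityˡ x)))
      telescope : ∀ j → difference s j ℕ.+ s ℕ.* s ℕ.^ j ≡ r ℕ.* r ℕ.^ j
      telescope zero    = ≡.refl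
      telescope (suc j) =
        ≡.trans (ℕ.+-assoc (r ℕ.^ suc j) _ _) (≡.cong (r ℕ.^ suc j ℕ.+_)
          (≡.trans (≡.sym (ℕ.*-distribˡ-+ s (difference s j) (s ℕ.^ suc j))) (≡.cong (s ℕ.*_) (telescope j))))
      sum : K n + s ·′ V n ≈ r ·′ 1# * W n
      sum = begin
        difference s n ·′ E n + s ·′ ((s ℕ.^ n) ·′ E n)     ≈⟨ +-congˡ (×-assocˡ (E n) s (s ℕ.^ n)) ⟩
        difference s n ·′ E n + (s ℕ.* s ℕ.^ n) ·′ E n     ≈⟨ ×-homo-+ (E n) (difference s n) (s ℕ.* s ℕ.^ n) ⟨
        (difference s n ℕ.+ s ℕ.* s ℕ.^ n) ·′ E n         ≡⟨ ≡.cong (_·′ E n) (telescope n) ⟩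
        (r ℕ.* r ℕ.^ n) ·′ E n                            ≈⟨ ×-assocˡ (E n) r (r ℕ.^ n) ⟨
        r ·′ ((r ℕ.^ n) ·′ E n)                            ≈⟨ sV r _ ⟩
        r ·′ 1# * ((r ℕ.^ n) ·′ E n)                       ≈⟨ *-congˡ (multiple r n (E n)) ⟩
        r ·′ 1# * W n                                     ∎

    ∂-scaleE : ∀ a → ∂ (scale a E) ≋ const a ⊛ (1ˢ ⊕ (1ˢ ⊕ tˢ) ⊛ scale a E ⊕ tˢ ⊛ (scale a E ⊛ scale a E))
    ∂-scaleE a = ≋-trans (∂-scale a E) (⊛-cong {f = const a} ≋-refl (begin
      scale a (∂ E)
        ≈⟨ (λ n → *-congˡ (trans (∂E n) (+-cong (+-congˡ (const-⊛′ (1# + t) E n)) (const-⊛′ t (E ⊛ E) n)))) ⟩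
      scale a (1ˢ ⊕ const (1# + t) ⊛ E ⊕ tˢ ⊛ (E ⊛ E))
        ≈⟨ ≋-trans (scale-⊕ a (1ˢ ⊕ const (1# + t) ⊛ E) (tˢ ⊛ (E ⊛ E)))
             (≋.+-cong (≋-trans (scale-⊕ a 1ˢ (const (1# + t) ⊛ E)) (≋.+-cong (scale-const a 1#)
                (≋-trans (scale-⊛ a (const (1# + t)) E) (⊛-cong {g = scale a E} (≋-trans (scale-const a (1# + t)) (const-+ 1# t)) ≋-refl))))
                (≋-trans (scale-⊛ a tˢ (E ⊛ E)) (⊛-cong (scale-const a t) (scale-⊛ a E E)))) ⟩
      1ˢ ⊕ (1ˢ ⊕ tˢ) ⊛ scale a E ⊕ tˢ ⊛ (scale a E ⊛ scale a E) ∎))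
      where
      open ≋-Reasoning
      const-⊛′ : ∀ a f n → a * f n ≈ (const a ⊛ f) n
      const-⊛′ a f n = sym (const-⊛ a f n)

    ∂F≋ : ∂ F ≋ (1ˢ ⊕ tˢ) ⊛ F ⊕ tˢ ⊛ ((rˢ ⊛ W ⊕ ⊖ (sˢ ⊛ V)) ⊛ F)
    ∂F≋ n = trans (∂F n) (+-cong
      (trans (sym (const-⊛ (1# + t) F n)) (⊛-cong {g = F} (const-+ 1# t) ≋-refl n))
      (trans (sym (const-⊛ t (K ⊛ F) n)) (⊛-cong {f = tˢ} ≋-refl (⊛-cong {g = F} K≋ ≋-refl) n)))

    T : Series
    T = F ⊕ tˢ ⊛ (V ⊛ F)

    T≋F⊕G : T ≋ F ⊕ G
    T≋F⊕G n = +-congˡ (const-⊛ t (V ⊛ F) n)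

    private
      module S = IntegerSolver seriesRing
      open S using (solve; _:=_; _:+_; _:*_; _:-_; :-_; :0; :1)

    ∂-tˢ⊛ : ∀ f → ∂ (tˢ ⊛ f) ≋ tˢ ⊛ ∂ f
    ∂-tˢ⊛ f n = trans (+-congʳ (zero-⊛ f n)) (+-identityˡ _)

    -- T is F (1 + t V). Since 1 + (1 + t) V + t V² = (1 + V) (1 + t V), the logarithmic derivative
    -- of 1 + t V is s t (1 + V). Added to that of F, which is 1 + t + t (r W - s V), it cancels V.
    ∂T : ∂ T ≋ (1ˢ ⊕ rˢ ⊛ tˢ ⊕ tˢ ⊛ (rˢ ⊛ W)) ⊛ T
    ∂T = begin
      ∂ F ⊕ ∂ (tˢ ⊛ (V ⊛ F))
        ≈⟨ ≋.+-congˡ {∂ F} (∂-tˢ⊛ (V ⊛ F)) ⟩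
      ∂ F ⊕ tˢ ⊛ (∂ V ⊛ F ⊕ V ⊛ ∂ F)
        ≈⟨ ≋.+-cong ∂F≋ (⊛-cong {f = tˢ} ≋-refl (≋.+-cong (⊛-cong {g = F} ∂V≋ ≋-refl) (⊛-cong {f = V} ≋-refl ∂F≋))) ⟩
      F′ ⊕ tˢ ⊛ ((sˢ ⊛ (1ˢ ⊕ (1ˢ ⊕ tˢ) ⊛ V ⊕ tˢ ⊛ (V ⊛ V))) ⊛ F ⊕ V ⊛ F′)
        ≈⟨ ≋.+-cong F′≋ (⊛-cong {f = tˢ} ≋-refl (≋.+-congˡ {(sˢ ⊛ (1ˢ ⊕ (1ˢ ⊕ tˢ) ⊛ V ⊕ tˢ ⊛ (V ⊛ V))) ⊛ F} (⊛-cong {f = V} ≋-refl F′≋))) ⟩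
      F″ ⊕ tˢ ⊛ ((sˢ ⊛ (1ˢ ⊕ (1ˢ ⊕ tˢ) ⊛ V ⊕ tˢ ⊛ (V ⊛ V))) ⊛ F ⊕ V ⊛ F″)
        ≈⟨ solve 5 (λ t s w v f →
             let f″ = (:1 :+ t) :* f :+ t :* (((:1 :+ s) :* w :- s :* v) :* f) in
             f″ :+ t :* ((s :* (:1 :+ (:1 :+ t) :* v :+ t :* (v :* v))) :* f :+ v :* f″)
             := (:1 :+ (:1 :+ s) :* t :+ t :* ((:1 :+ s) :* w)) :* (f :+ t :* (v :* f)))
             ≋-refl tˢ sˢ W V F ⟩
      (1ˢ ⊕ (1ˢ ⊕ sˢ) ⊛ tˢ ⊕ tˢ ⊛ ((1ˢ ⊕ sˢ) ⊛ W)) ⊛ T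
        ≈⟨ ⊛-cong {g = T} (≋.+-cong (≋.+-congˡ {1ˢ} (⊛-cong {g = tˢ} rˢ≋1+sˢ ≋-refl)) (⊛-cong {f = tˢ} ≋-refl (⊛-cong {g = W} rˢ≋1+sˢ ≋-refl))) ≋-refl ⟨
      (1ˢ ⊕ rˢ ⊛ tˢ ⊕ tˢ ⊛ (rˢ ⊛ W)) ⊛ T ∎
      where
      open ≋-Reasoning
      F′ F″ : Series
      F′ = (1ˢ ⊕ tˢ) ⊛ F ⊕ tˢ ⊛ ((rˢ ⊛ W ⊕ ⊖ (sˢ ⊛ V)) ⊛ F)
      F″ = (1ˢ ⊕ tˢ) ⊛ F ⊕ tˢ ⊛ (((1ˢ ⊕ sˢ) ⊛ W ⊕ ⊖ (sˢ ⊛ V)) ⊛ F)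
      F′≋ : F′ ≋ F″
      F′≋ = ≋.+-congˡ {(1ˢ ⊕ tˢ) ⊛ F} (⊛-cong {f = tˢ} ≋-refl (⊛-cong {g = F} (≋.+-congʳ {⊖ (sˢ ⊛ V)} (⊛-cong {g = W} rˢ≋1+sˢ ≋-refl)) ≋-refl))
      ∂V≋ : ∂ V ≋ sˢ ⊛ (1ˢ ⊕ (1ˢ ⊕ tˢ) ⊛ V ⊕ tˢ ⊛ (V ⊛ V))
      ∂V≋ n = trans (V≋ (suc n)) (trans (∂-scaleE (s ·′ 1#) n)
        (⊛-cong {f = sˢ} ≋-refl (≋.+-cong (≋.+-congˡ {1ˢ} (⊛-cong {f = 1ˢ ⊕ tˢ} ≋-refl (≋-sym V≋))) (⊛-cong {f = tˢ} ≋-refl (⊛-cong (≋-sym V≋) (≋-sym V≋)))) n))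

    e D : Series
    e = exp (r ·′ 1# * (1# - t))
    D = 1ˢ ⊕ ⊖ (tˢ ⊛ e)

    ∂e : ∂ e ≋ (rˢ ⊛ (1ˢ ⊕ ⊖ tˢ)) ⊛ e
    ∂e = ≋-trans (∂-exp _) (⊛-cong {g = e}
      (≋-trans (const-* (r ·′ 1#) (1# - t)) (⊛-cong {f = rˢ} ≋-refl (≋-trans (const-+ 1# (- t)) (≋.+-congˡ {1ˢ} (const-neg t))))) ≋-refl)

    ∂D : ∂ D ≋ ⊖ (tˢ ⊛ ((rˢ ⊛ (1ˢ ⊕ ⊖ tˢ)) ⊛ e))
    ∂D n = trans (+-identityˡ _) (-‿cong (trans (∂-tˢ⊛ e n) (⊛-cong {f = tˢ} ≋-refl ∂e n)))

    -- The Riccati equation of W makes the defect of this identity a solution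
    -- of a homogeneous linear equation.
    D⊛W : D ⊛ W ≋ e ⊕ ⊖ 1ˢ
    D⊛W = ≋-trans (solve 2 (λ x y → x := (x :- y) :+ y) ≋-refl (D ⊛ W) (e ⊕ ⊖ 1ˢ))
            (≋-trans (≋.+-congʳ {e ⊕ ⊖ 1ˢ} (linear-unique {Z} {≋.0#} {rˢ ⊛ (1ˢ ⊕ tˢ ⊛ W)} Z₀ ∂Z (λ n → sym (≋.zeroʳ _ n))))
                      (≋.+-identityˡ (e ⊕ ⊖ 1ˢ)))
      where
      Z : Series
      Z = D ⊛ W ⊕ ⊖ (e ⊕ ⊖ 1ˢ)
      Z₀ : Z 0 ≈ 0#
      Z₀ = trans (+-congʳ (*-congˡ (trans (*-identityˡ _) E₀)))
             (R.solve 1 (λ t → (R.:1 R.:- t R.:* R.:1) R.:* R.:0 R.:- (R.:1 R.:- R.:1) R.:= R.:0) refl t)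
        where module R = IntegerSolver R
      ∂Z : ∂ Z ≋ (rˢ ⊛ (1ˢ ⊕ tˢ ⊛ W)) ⊛ Z
      ∂Z = begin
        (∂ D ⊛ W ⊕ D ⊛ ∂ W) ⊕ ⊖ (∂ e ⊕ ⊖ ≋.0#)
          ≈⟨ ≋.+-cong (≋.+-cong (⊛-cong {g = W} ∂D ≋-refl) (⊛-cong {f = D} ≋-refl (∂-scaleE (r ·′ 1#))))
                      (≋.-‿cong (≋.+-congʳ {⊖ ≋.0#} ∂e)) ⟩
        _ ≈⟨ solve 4 (λ t r w e → let d = :1 :- t :* e in
               ((:- (t :* ((r :* (:1 :- t)) :* e))) :* w :+ d :* (r :* (:1 :+ (:1 :+ t) :* w :+ t :* (w :* w))))
                 :- (((r :* (:1 :- t)) :* e) :- :0)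
               := (r :* (:1 :+ t :* w)) :* (d :* w :- (e :- :1)))
               ≋-refl tˢ rˢ W e ⟩
        (rˢ ⊛ (1ˢ ⊕ tˢ ⊛ W)) ⊛ Z ∎
        where open ≋-Reasoning

    -- By `D⊛W` the product of D with the factor in `∂T` becomes explicit, and the derivative of D T
    -- turns out to be D T itself; the initial value is 1 - t.
    D⊛T : D ⊛ T ≋ const (1# - t) ⊛ exp 1#
    D⊛T = linear-unique {y = 1ˢ} (*-cong (+-congˡ (-‿cong (*-identityʳ t))) T₀) ∂lhs ∂rhs
      where
      open ≋-Reasoning
      T₀ : T 0 ≈ 1#
      T₀ = trans (+-cong F₀ (trans (*-congˡ (trans (*-congʳ V₀) (zeroˡ _))) (zeroʳ t))) (+-identityʳ 1#)
      ∂rhs : ∂ (const (1# - t) ⊛ exp 1#) ≋ 1ˢ ⊛ (const (1# - t) ⊛ exp 1#)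
      ∂rhs n = trans (+-cong (zero-⊛ (exp 1#) n) (⊛-cong {f = const (1# - t)} ≋-refl (∂-exp 1#) n))
        (solve 3 (λ o a e → :0 :+ a :* (o :* e) := o :* (a :* e)) ≋-refl 1ˢ (const (1# - t)) (exp 1#) n)
      ∂lhs : ∂ (D ⊛ T) ≋ 1ˢ ⊛ (D ⊛ T)
      ∂lhs = begin
        ∂ D ⊛ T ⊕ D ⊛ ∂ T
          ≈⟨ ≋.+-cong (⊛-cong {g = T} ∂D ≋-refl) (⊛-cong {f = D} ≋-refl ∂T) ⟩
        _ ≈⟨ solve 5 (λ t r w e T → let d = :1 :- t :* e in
               (:- (t :* ((r :* (:1 :- t)) :* e))) :* T :+ d :* ((:1 :+ r :* t :+ t :* (r :* w)) :* T)
               := ((:- (t :* ((r :* (:1 :- t)) :* e))) :+ d :* (:1 :+ r :* t) :+ t :* (r :* (d :* w))) :* T)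
               ≋-refl tˢ rˢ W e T ⟩
        (⊖ (tˢ ⊛ ((rˢ ⊛ (1ˢ ⊕ ⊖ tˢ)) ⊛ e)) ⊕ D ⊛ (1ˢ ⊕ rˢ ⊛ tˢ) ⊕ tˢ ⊛ (rˢ ⊛ (D ⊛ W))) ⊛ T
          ≈⟨ ⊛-cong {g = T} (≋.+-congˡ {⊖ (tˢ ⊛ ((rˢ ⊛ (1ˢ ⊕ ⊖ tˢ)) ⊛ e)) ⊕ D ⊛ (1ˢ ⊕ rˢ ⊛ tˢ)}
               (⊛-cong {f = tˢ} ≋-refl (⊛-cong {f = rˢ} ≋-refl D⊛W))) ≋-refl ⟩
        _ ≈⟨ solve 4 (λ t r e T → let d = :1 :- t :* e in
               ((:- (t :* ((r :* (:1 :- t)) :* e))) :+ d :* (:1 :+ r :* t) :+ t :* (r :* (e :- :1))) :* T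
               := :1 :* (d :* T))
               ≋-refl tˢ rˢ e T ⟩
        1ˢ ⊛ (D ⊛ T) ∎

-- Descents of colored permutations, enumerated letter by letter.

module DescentEnumeration where

  open import Defs hiding (_^_; _·_)
  open import Algebra.Bundles using (CommutativeRing)
  open import Level using (0ℓ)
  open import Data.Bool.Base using (Bool; true; false; if_then_else_; _∨_; _∧_)
  open import Data.Fin.Base as Fin using (Fin; zero; suc; toℕ; inject₁; punchIn)
  import Data.Fin.Properties as Fin
  open import Data.Nat.Base as ℕ using (ℕ; zero; suc; _≤_; z≤n; s≤s; _<ᵇ_; _≡ᵇ_)
  import Data.Nat.Properties as ℕ
  open import Data.List.Base as List using (List; []; _∷_; _++_; allFin; length; filter; cartesianProductWith; tabulate)
  import Data.List.Properties as List
  open import Data.Product.Base using (_,_)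
  open import Data.Vec.Base as Vec using (Vec; []; _∷_; _∷ʳ_; lookup)
  import Data.Vec.Properties as Vec
  open import Data.Vec.Relation.Unary.All as VAll using (All; []; _∷_)
  import Data.Vec.Relation.Unary.All.Properties as VAll
  open import Data.Vec.Relation.Unary.Unique.Propositional using (Unique)
  open import Data.Vec.Relation.Unary.AllPairs using ([]; _∷_)
  open import Function.Base using (_∘_; id)
  open import Relation.Binary.PropositionalEquality as ≡ using (_≡_; _≢_; refl; cong; cong₂; module ≡-Reasoning)
  open import Relation.Nullary using (¬_; Dec; does; yes; no; contradiction)
  open import Relation.Unary using (Pred; Decidable)

  bit : Bool → ℕ
  bit true  = 1
  bit false = 0

  bits : ∀ {n} → (Fin n → Bool) → ℕ
  bits {zero}  b = 0
  bits {suc n} b = bit (b zero) ℕ.+ bits (b ∘ suc)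

  length-filter-tabulate : ∀ {A : Set} {P : Pred A 0ℓ} (P? : Decidable P) {n} (f : Fin n → A) →
                           length (filter P? (tabulate f)) ≡ bits (λ i → does (P? (f i)))
  length-filter-tabulate P? {zero}  f = refl
  length-filter-tabulate P? {suc n} f with does (P? (f zero))
  ... | true  = cong suc (length-filter-tabulate P? (f ∘ suc))
  ... | false = length-filter-tabulate P? (f ∘ suc)

  descent : ℕ → ℕ → ℕ → ℕ → Bool
  descent a c a′ c′ = (c′ <ᵇ c) ∨ ((c ≡ᵇ c′) ∧ (a′ <ᵇ a))

  -- The number of descents of the word (a , c) (a₁ , c₁) … (aₖ , cₖ) (z , 0).
  descents : ∀ {k} → ℕ → ℕ → Vec ℕ k → Vec ℕ k → ℕ → ℕ
  descents a c []        []        z = bit (descent a c z 0)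
  descents a c (a′ ∷ as) (c′ ∷ cs) z = bit (descent a c a′ c′) ℕ.+ descents a′ c′ as cs z

  bits-descents : ∀ {k} a c (as cs : Vec ℕ k) z →
    bits (λ i → descent (lookup ((a ∷ as) ∷ʳ z) (inject₁ i)) (lookup ((c ∷ cs) ∷ʳ 0) (inject₁ i))
                        (lookup ((a ∷ as) ∷ʳ z) (suc i)) (lookup ((c ∷ cs) ∷ʳ 0) (suc i)))
    ≡ descents a c as cs z
  bits-descents a c []        []        z = ℕ.+-identityʳ _
  bits-descents a c (a′ ∷ as) (c′ ∷ cs) z = cong (bit (descent a c a′ c′) ℕ.+_) (bits-descents a′ c′ as cs z)

  des-∷ : ∀ {n r} a (σ : Vec (Fin (suc n)) n) (c : Fin r) ε →
          des (a ∷ σ , c ∷ ε) ≡ descents (toℕ a) (toℕ c) (Vec.map toℕ σ) (Vec.map toℕ ε) (suc n)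
  des-∷ a σ c ε = ≡.trans (length-filter-tabulate (descent? (a ∷ σ , c ∷ ε)) id)
                          (bits-descents (toℕ a) (toℕ c) (Vec.map toℕ σ) (Vec.map toℕ ε) _)

  -- `punchIn` on naturals, which also applies to the letter appended at position n + 1. It is
  -- increasing, so relabelling by it preserves descents.
  punch : ℕ → ℕ → ℕ
  punch zero    x       = suc x
  punch (suc i) zero    = zero
  punch (suc i) (suc x) = suc (punch i x)

  toℕ-punchIn : ∀ {n} (i : Fin (suc n)) j → toℕ (punchIn i j) ≡ punch (toℕ i) (toℕ j)
  toℕ-punchIn zero    j       = refl
  toℕ-punchIn (suc i) zero    = refl
  toℕ-punchIn (suc i) (suc j) = cong suc (toℕ-punchIn i j)

  punch-<ᵇ : ∀ i x y → (punch i x <ᵇ punch i y) ≡ (x <ᵇ y)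
  punch-<ᵇ zero    x       y       = refl
  punch-<ᵇ (suc i) zero    zero    = refl
  punch-<ᵇ (suc i) zero    (suc y) = refl
  punch-<ᵇ (suc i) (suc x) zero    = refl
  punch-<ᵇ (suc i) (suc x) (suc y) = punch-<ᵇ i x y

  -- Allows the second letter to be compared with the first one through its rank among the remaining
  -- letters.
  punch-self-<ᵇ : ∀ a x → (punch a x <ᵇ a) ≡ (x <ᵇ a)
  punch-self-<ᵇ zero    x       = refl
  punch-self-<ᵇ (suc a) zero    = refl
  punch-self-<ᵇ (suc a) (suc x) = punch-self-<ᵇ a x

  punch-≤ : ∀ {i x} → i ≤ x → punch i x ≡ suc x
  punch-≤ z≤n     = refl
  punch-≤ (s≤s p) = cong suc (punch-≤ p)

  descents-punch : ∀ i {k} a c (as cs : Vec ℕ k) z →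
                   descents (punch i a) c (Vec.map (punch i) as) cs (punch i z) ≡ descents a c as cs z
  descents-punch i a c []        []        z rewrite punch-<ᵇ i z a = refl
  descents-punch i a c (a′ ∷ as) (c′ ∷ cs) z rewrite punch-<ᵇ i a′ a =
    cong (bit (descent a c a′ c′) ℕ.+_) (descents-punch i a′ c′ as cs z)

  descents-punchIn : ∀ {n k} (a : Fin (2 ℕ.+ n)) (b : Fin (suc n)) c (v : Vec (Fin (suc n)) k) cs →
    descents (toℕ (punchIn a b)) c (Vec.map toℕ (Vec.map (punchIn a) v)) cs (2 ℕ.+ n)
    ≡ descents (toℕ b) c (Vec.map toℕ v) cs (suc n)
  descents-punchIn {n} a b c v cs = begin
    descents (toℕ (punchIn a b)) c (Vec.map toℕ (Vec.map (punchIn a) v)) cs (2 ℕ.+ n)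
      ≡⟨ cong₂ (λ x y → descents x c y cs (2 ℕ.+ n)) (toℕ-punchIn a b) letters ⟩
    descents (punch (toℕ a) (toℕ b)) c (Vec.map (punch (toℕ a)) (Vec.map toℕ v)) cs (2 ℕ.+ n)
      -- The appended letter is relabelled along with the others: as `toℕ a` is at most n + 1, it
      -- moves from n + 1 to n + 2.
      ≡⟨ cong (descents (punch (toℕ a) (toℕ b)) c (Vec.map (punch (toℕ a)) (Vec.map toℕ v)) cs) (punch-≤ (ℕ.≤-pred (Fin.toℕ<n a))) ⟨
    descents (punch (toℕ a) (toℕ b)) c (Vec.map (punch (toℕ a)) (Vec.map toℕ v)) cs (punch (toℕ a) (suc n))
      ≡⟨ descents-punch (toℕ a) (toℕ b) c (Vec.map toℕ v) cs (suc n) ⟩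
    descents (toℕ b) c (Vec.map toℕ v) cs (suc n) ∎
    where
    open ≡-Reasoning
    letters : Vec.map toℕ (Vec.map (punchIn a) v) ≡ Vec.map (punch (toℕ a)) (Vec.map toℕ v)
    letters = ≡.trans (≡.sym (Vec.map-∘ toℕ (punchIn a) v))
                (≡.trans (Vec.map-cong (toℕ-punchIn a) v) (Vec.map-∘ (punch (toℕ a)) toℕ v))

  module Enumeration (R : CommutativeRing 0ℓ 0ℓ) (t : CommutativeRing.Carrier R) where
    open CommutativeRing R hiding (zero; refl)
    private module R = CommutativeRing R
    open import Algebra.Properties.Semiring.Sum semiring
      using (sum; sum-cong-≋; ∑-distrib-+; ∑-comm; *-distribˡ-sum; sum-remove)
    open import Algebra.Properties.Semiring.Exp semiring using (^-homo-*) renaming (_^_ to _^′_)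
    open import Relation.Binary.Reasoning.Setoid setoid

    ΣL : ∀ {A : Set} → List A → (A → Carrier) → Carrier
    ΣL xs f = List.foldr _+_ 0# (List.map f xs)

    ΣL-++ : ∀ {A : Set} (xs ys : List A) f → ΣL (xs ++ ys) f ≈ ΣL xs f + ΣL ys f
    ΣL-++ []       ys f = sym (+-identityˡ _)
    ΣL-++ (x ∷ xs) ys f = trans (+-congˡ (ΣL-++ xs ys f)) (sym (+-assoc _ _ _))

    ΣL-map : ∀ {A B : Set} (g : A → B) xs f → ΣL (List.map g xs) f ≡ ΣL xs (f ∘ g)
    ΣL-map g xs f = cong (List.foldr _+_ 0#) (≡.sym (List.map-∘ xs))

    ΣL-cong : ∀ {A : Set} (xs : List A) {f g} → (∀ x → f x ≈ g x) → ΣL xs f ≈ ΣL xs g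
    ΣL-cong []       p = R.refl
    ΣL-cong (x ∷ xs) p = +-cong (p x) (ΣL-cong xs p)

    ΣL-cartesianProductWith : ∀ {A B C : Set} (g : A → B → C) xs ys f →
      ΣL (cartesianProductWith g xs ys) f ≈ ΣL xs (λ x → ΣL ys (λ y → f (g x y)))
    ΣL-cartesianProductWith g []       ys f = R.refl
    ΣL-cartesianProductWith g (x ∷ xs) ys f =
      trans (ΣL-++ (List.map (g x) ys) (cartesianProductWith g xs ys) f)
            (+-cong (reflexive (ΣL-map (g x) ys f)) (ΣL-cartesianProductWith g xs ys f))

    guard : Bool → Carrier → Carrier
    guard b x = if b then x else 0#

    ΣL-filter : ∀ {A : Set} {P : Pred A 0ℓ} (P? : Decidable P) xs f →
                ΣL (filter P? xs) f ≈ ΣL xs (λ x → guard (does (P? x)) (f x))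
    ΣL-filter P? []       f = R.refl
    ΣL-filter P? (x ∷ xs) f with does (P? x)
    ... | true  = +-congˡ (ΣL-filter P? xs f)
    ... | false = trans (ΣL-filter P? xs f) (sym (+-identityˡ _))

    ΣL-tabulate : ∀ {A : Set} {n} (g : Fin n → A) f → ΣL (tabulate g) f ≡ sum (λ i → f (g i))
    ΣL-tabulate {n = zero}  g f = refl
    ΣL-tabulate {n = suc n} g f = cong (f (g zero) +_) (ΣL-tabulate (g ∘ suc) f)

    ΣW : ∀ m k → (Vec (Fin m) k → Carrier) → Carrier
    ΣW m zero    f = f []
    ΣW m (suc k) f = sum λ a → ΣW m k (λ w → f (a ∷ w))

    ΣL-words : ∀ m k f → ΣL (words (allFin m) k) f ≈ ΣW m k f
    ΣL-words m zero    f = +-identityʳ _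
    ΣL-words m (suc k) f = begin
      ΣL (words (allFin m) (suc k)) f                                  ≈⟨ ΣL-cartesianProductWith _∷_ (allFin m) _ f ⟩
      ΣL (allFin m) (λ a → ΣL (words (allFin m) k) (λ w → f (a ∷ w)))  ≡⟨ ΣL-tabulate {n = m} id (λ a → ΣL (words (allFin m) k) (λ w → f (a ∷ w))) ⟩
      sum (λ a → ΣL (words (allFin m) k) (λ w → f (a ∷ w)))            ≈⟨ sum-cong-≋ {n = m} (λ a → ΣL-words m k (λ w → f (a ∷ w))) ⟩
      ΣW m (suc k) f                                                   ∎

    ΣW-cong : ∀ m k {f g} → (∀ w → f w ≈ g w) → ΣW m k f ≈ ΣW m k g
    ΣW-cong m zero    p = p []
    ΣW-cong m (suc k) p = sum-cong-≋ {n = m} λ a → ΣW-cong m k (λ w → p (a ∷ w))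

    sum-0 : ∀ n {f : Fin n → Carrier} → (∀ i → f i ≈ 0#) → sum f ≈ 0#
    sum-0 zero    p = R.refl
    sum-0 (suc n) p = trans (+-cong (p zero) (sum-0 n (p ∘ suc))) (+-identityˡ _)

    ΣW-0 : ∀ m k {f} → (∀ w → f w ≈ 0#) → ΣW m k f ≈ 0#
    ΣW-0 m zero    p = p []
    ΣW-0 m (suc k) p = sum-0 m λ a → ΣW-0 m k (λ w → p (a ∷ w))

    ΣW-sum : ∀ m k n (f : Vec (Fin m) k → Fin n → Carrier) →
             ΣW m k (λ w → sum (f w)) ≈ sum (λ c → ΣW m k (λ w → f w c))
    ΣW-sum m zero    n f = R.refl
    ΣW-sum m (suc k) n f = trans (sum-cong-≋ {n = m} λ a → ΣW-sum m k n (λ w → f (a ∷ w))) (∑-comm {m} {n} λ a c → ΣW m k (λ w → f (a ∷ w) c))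

    ΣW-* : ∀ m k x f → ΣW m k (λ w → x * f w) ≈ x * ΣW m k f
    ΣW-* m zero    x f = R.refl
    ΣW-* m (suc k) x f = trans (sum-cong-≋ {n = m} λ a → ΣW-* m k x (λ w → f (a ∷ w))) (sym (*-distribˡ-sum {m} x λ a → ΣW m k (λ w → f (a ∷ w))))

    ΣW-avoiding : ∀ {m} (a : Fin (suc m)) k f → (∀ w → ¬ All (a ≢_) w → f w ≈ 0#) →
                  ΣW (suc m) k f ≈ ΣW m k (λ v → f (Vec.map (punchIn a) v))
    ΣW-avoiding a zero    f v = R.refl
    ΣW-avoiding {m} a (suc k) f v = begin
      sum (λ b → ΣW (suc m) k (λ w → f (b ∷ w)))
        ≈⟨ sum-remove {i = a} (λ b → ΣW (suc m) k (λ w → f (b ∷ w))) ⟩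
      ΣW (suc m) k (λ w → f (a ∷ w)) + sum (λ b → ΣW (suc m) k (λ w → f (punchIn a b ∷ w)))
        ≈⟨ +-cong (ΣW-0 (suc m) k (λ w → v (a ∷ w) λ { (a≢a ∷ _) → a≢a refl }))
                  (sum-cong-≋ {n = m} λ b → ΣW-avoiding a k (λ w → f (punchIn a b ∷ w)) (λ w ¬all → v _ λ { (_ ∷ all) → ¬all all })) ⟩
      0# + sum (λ b → ΣW m k (λ w → f (punchIn a b ∷ Vec.map (punchIn a) w)))
        ≈⟨ +-identityˡ _ ⟩
      sum (λ b → ΣW m k (λ w → f (punchIn a b ∷ Vec.map (punchIn a) w))) ∎

    ΣU : ∀ m k → (Vec (Fin m) k → Carrier) → Carrier
    ΣU m k f = ΣW m k (λ w → guard (does (unique? w)) (f w))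

    guard-cong : ∀ b {x y} → x ≈ y → guard b x ≈ guard b y
    guard-cong true  p = p
    guard-cong false p = R.refl

    guard-no : ∀ {P : Set} (P? : Dec P) {x} → ¬ P → guard (does P?) x ≈ 0#
    guard-no (yes p) ¬p = contradiction p ¬p
    guard-no (no _)  ¬p = R.refl

    does-⇔ : ∀ {P Q : Set} → (P → Q) → (Q → P) → (P? : Dec P) (Q? : Dec Q) → does P? ≡ does Q?
    does-⇔ f g (yes p) (yes q) = refl
    does-⇔ f g (yes p) (no ¬q) = contradiction (f p) ¬q
    does-⇔ f g (no ¬p) (yes q) = contradiction (g q) ¬p
    does-⇔ f g (no ¬p) (no ¬q) = refl

    unique-punchIn : ∀ {m k} (a : Fin (suc m)) (v : Vec (Fin m) k) → Unique v → Unique (a ∷ Vec.map (punchIn a) v)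
    unique-punchIn a v u = avoid v ∷ injective v u
      where
      avoid : ∀ {k} (v : Vec _ k) → All (a ≢_) (Vec.map (punchIn a) v)
      avoid []      = []
      avoid (b ∷ v) = (λ eq → Fin.punchInᵢ≢i a b (≡.sym eq)) ∷ avoid v
      injective : ∀ {k} (v : Vec _ k) → Unique v → Unique (Vec.map (punchIn a) v)
      injective []      []       = []
      injective (b ∷ v) (p ∷ ps) = VAll.map⁺ (VAll.map (λ ne eq → ne (Fin.punchIn-injective a _ _ eq)) p) ∷ injective v ps

    unique-punchIn⁻ : ∀ {m k} (a : Fin (suc m)) (v : Vec (Fin m) k) → Unique (a ∷ Vec.map (punchIn a) v) → Unique v
    unique-punchIn⁻ a v (_ ∷ u) = go v u
      where
      go : ∀ {k} (v : Vec _ k) → Unique (Vec.map (punchIn a) v) → Unique v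
      go []      []       = []
      go (b ∷ v) (p ∷ ps) = VAll.map (λ ne eq → ne (cong (punchIn a) eq)) (VAll.map⁻ p) ∷ go v ps

    -- The letters after the first letter `a` avoid it; closing the gap at `a` makes them an
    -- arbitrary word without repetitions over one letter less.
    ΣU-suc : ∀ m k f → ΣU (suc m) (suc k) f ≈ sum (λ a → ΣU m k (λ v → f (a ∷ Vec.map (punchIn a) v)))
    ΣU-suc m k f = sum-cong-≋ {n = suc m} λ a → trans
      (ΣW-avoiding a k _ λ w ¬all → guard-no (unique? (a ∷ w)) {f (a ∷ w)} λ { (all ∷ _) → ¬all all })
      (ΣW-cong m k λ v → reflexive (cong (λ b → guard b (f (a ∷ Vec.map (punchIn a) v)))
        (does-⇔ (unique-punchIn⁻ a v) (unique-punchIn a v) (unique? _) (unique? v))))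

    ΣU-cong : ∀ m k {f g} → (∀ w → f w ≈ g w) → ΣU m k f ≈ ΣU m k g
    ΣU-cong m k p = ΣW-cong m k λ w → guard-cong (does (unique? w)) (p w)

    ΣU-* : ∀ m k x f → ΣU m k (λ w → x * f w) ≈ x * ΣU m k f
    ΣU-* m k x f = trans (ΣW-cong m k λ w → go (does (unique? w))) (ΣW-* m k x _)
      where
      go : ∀ b {y} → guard b (x * y) ≈ x * guard b y
      go true  = R.refl
      go false = sym (zeroʳ x)

    ΣU-sum : ∀ m k n (f : Vec (Fin m) k → Fin n → Carrier) →
             ΣU m k (λ w → sum (f w)) ≈ sum (λ c → ΣU m k (λ w → f w c))
    ΣU-sum m k n f = trans (ΣW-cong m k λ w → go (does (unique? w))) (ΣW-sum m k n _)
      where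
      go : ∀ b {g : Fin n → Carrier} → guard b (sum g) ≈ sum (λ c → guard b (g c))
      go true  = R.refl
      go false = sym (sum-0 n λ _ → R.refl)

    module _ (r : ℕ) where

      -- The sum of t^des over the words of n + 1 letters that start with the
      -- letter a of color c.
      first : ℕ → ℕ → ℕ → Carrier
      first zero    a c = t ^′ bit (0 <ᵇ c)
      first (suc n) a c = sum {suc n} λ a′ → sum {r} λ c′ →
        t ^′ bit (descent a c (toℕ a′) (toℕ c′)) * first n (toℕ a′) (toℕ c′)

      ΣU-first : ∀ n (a : Fin (suc n)) (c : Fin r) →
        ΣU n n (λ v → ΣW r n λ ε → t ^′ descents (toℕ a) (toℕ c) (Vec.map toℕ (Vec.map (punchIn a) v)) (Vec.map toℕ ε) (suc n))
        ≈ first n (toℕ a) (toℕ c)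
      ΣU-first zero    zero c = reflexive (cong (λ b → t ^′ bit b) (last (toℕ c)))
        where
        last : ∀ c → descent 0 c 1 0 ≡ (0 <ᵇ c)
        last zero    = refl
        last (suc c) = refl
      ΣU-first (suc n) a c = begin
        ΣU (suc n) (suc n) (λ v → sum λ c′ → ΣW r n λ ε → g v c′ ε)
          ≈⟨ ΣU-suc n n (λ v → sum λ c′ → ΣW r n λ ε → g v c′ ε) ⟩
        (sum {suc n} λ a′ → ΣU n n λ v → sum λ c′ → ΣW r n λ ε → g (a′ ∷ Vec.map (punchIn a′) v) c′ ε)
          ≈⟨ (sum-cong-≋ {n = suc n} λ a′ → ΣU-sum n n r λ v c′ → ΣW r n λ ε → g (a′ ∷ Vec.map (punchIn a′) v) c′ ε) ⟩
        (sum {suc n} λ a′ → sum λ c′ → ΣU n n λ v → ΣW r n λ ε → g (a′ ∷ Vec.map (punchIn a′) v) c′ ε)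
          ≈⟨ (sum-cong-≋ {n = suc n} λ a′ → sum-cong-≋ {n = r} λ c′ → step a′ c′) ⟩
        first (suc n) (toℕ a) (toℕ c) ∎
        where
        g : Vec (Fin (suc n)) (suc n) → Fin r → Vec (Fin r) n → Carrier
        g v c′ ε = t ^′ descents (toℕ a) (toℕ c) (Vec.map toℕ (Vec.map (punchIn a) v)) (toℕ c′ ∷ Vec.map toℕ ε) (2 ℕ.+ n)
        split : ∀ a′ c′ v ε → g (a′ ∷ Vec.map (punchIn a′) v) c′ ε
                ≈ t ^′ bit (descent (toℕ a) (toℕ c) (toℕ a′) (toℕ c′))
                  * t ^′ descents (toℕ a′) (toℕ c′) (Vec.map toℕ (Vec.map (punchIn a′) v)) (Vec.map toℕ ε) (suc n)
        split a′ c′ v ε = trans (^-homo-* t (bit (descent (toℕ a) (toℕ c) (toℕ (punchIn a a′)) (toℕ c′))) _)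
          (*-cong (reflexive (cong (λ b → t ^′ bit ((toℕ c′ <ᵇ toℕ c) ∨ ((toℕ c ≡ᵇ toℕ c′) ∧ b)))
                    (≡.trans (cong (_<ᵇ toℕ a) (toℕ-punchIn a a′)) (punch-self-<ᵇ (toℕ a) (toℕ a′)))))
                  (reflexive (cong (t ^′_) (descents-punchIn a a′ (toℕ c′) (Vec.map (punchIn a′) v) (Vec.map toℕ ε)))))
        step : ∀ a′ c′ → ΣU n n (λ v → ΣW r n λ ε → g (a′ ∷ Vec.map (punchIn a′) v) c′ ε)
                         ≈ t ^′ bit (descent (toℕ a) (toℕ c) (toℕ a′) (toℕ c′)) * first n (toℕ a′) (toℕ c′)
        step a′ c′ = trans (ΣU-cong n n λ v → trans (ΣW-cong r n (split a′ c′ v)) (ΣW-* r n _ _))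
                      (trans (ΣU-* n n _ _) (*-congˡ (ΣU-first n a′ c′)))

      ΣL-coloredPermutations : ∀ n → ΣL (coloredPermutations (suc n) r) (λ w → t ^′ des w)
                                     ≈ sum {suc n} λ a → sum {r} λ c → first n (toℕ a) (toℕ c)
      ΣL-coloredPermutations n = begin
        ΣL (coloredPermutations (suc n) r) (λ w → t ^′ des w)
          ≈⟨ ΣL-cartesianProductWith _,_ (permutations (suc n)) (words (allFin r) (suc n)) (λ w → t ^′ des w) ⟩
        ΣL (permutations (suc n)) (λ σ → ΣL (words (allFin r) (suc n)) λ ε → t ^′ des (σ , ε))
          ≈⟨ ΣL-filter unique? (words (allFin (suc n)) (suc n)) (λ σ → ΣL (words (allFin r) (suc n)) λ ε → t ^′ des (σ , ε)) ⟩
        ΣL (words (allFin (suc n)) (suc n)) (λ σ → guard (does (unique? σ)) (ΣL (words (allFin r) (suc n)) λ ε → t ^′ des (σ , ε)))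
          ≈⟨ ΣL-words (suc n) (suc n) (λ σ → guard (does (unique? σ)) (ΣL (words (allFin r) (suc n)) λ ε → t ^′ des (σ , ε))) ⟩
        ΣU (suc n) (suc n) (λ σ → ΣL (words (allFin r) (suc n)) λ ε → t ^′ des (σ , ε))
          ≈⟨ ΣU-cong (suc n) (suc n) (λ σ → ΣL-words r (suc n) λ ε → t ^′ des (σ , ε)) ⟩
        ΣU (suc n) (suc n) (λ σ → sum λ c → ΣW r n λ ε → t ^′ des (σ , c ∷ ε))
          ≈⟨ ΣU-suc n n (λ σ → sum λ c → ΣW r n λ ε → t ^′ des (σ , c ∷ ε)) ⟩
        (sum {suc n} λ a → ΣU n n λ v → sum λ c → ΣW r n λ ε → t ^′ des (a ∷ Vec.map (punchIn a) v , c ∷ ε))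
          ≈⟨ (sum-cong-≋ {n = suc n} λ a → ΣU-sum n n r λ v c → ΣW r n λ ε → t ^′ des (a ∷ Vec.map (punchIn a) v , c ∷ ε)) ⟩
        (sum {suc n} λ a → sum {r} λ c → ΣU n n λ v → ΣW r n λ ε → t ^′ des (a ∷ Vec.map (punchIn a) v , c ∷ ε))
          ≈⟨ (sum-cong-≋ {n = suc n} λ a → sum-cong-≋ {n = r} λ c → trans
               (ΣU-cong n n λ v → ΣW-cong r n λ ε → reflexive (cong (t ^′_) (des-∷ a (Vec.map (punchIn a) v) c ε)))
               (ΣU-first n a c)) ⟩
        (sum {suc n} λ a → sum {r} λ c → first n (toℕ a) (toℕ c)) ∎

-- The functional equation of the descent series, obtained by moving the first letter.

module DescentSeriesEquation where

  open ExponentialSeries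
  open ClosedForms
  open DescentEnumeration
  open import Algebra.Bundles using (CommutativeRing)
  open import Level using (0ℓ)
  open import Data.Bool.Base using (Bool; true; false; _∨_; _∧_)
  import Data.Bool.Properties as Bool
  open import Data.Fin.Base as Fin using (Fin; zero; suc; toℕ)
  import Data.Fin.Properties as Fin
  open import Data.Nat.Base as ℕ using (ℕ; zero; suc; _∸_; z≤n; s≤s; _<ᵇ_; _≡ᵇ_)
  import Data.Nat.Properties as ℕ
  open import Data.Nat.Combinatorics using (_C_; nCk+nC[k+1]≡[n+1]C[k+1]; k>n⇒nCk≡0)
  open import Function.Base using (_∘_)
  open import Relation.Binary.PropositionalEquality as ≡ using (_≡_; refl; cong; module ≡-Reasoning)

  <ᵇ-suc : ∀ a b → (a <ᵇ suc b) ≡ (a <ᵇ b) ∨ (b ≡ᵇ a)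
  <ᵇ-suc zero    zero    = refl
  <ᵇ-suc zero    (suc b) = refl
  <ᵇ-suc (suc a) zero    = refl
  <ᵇ-suc (suc a) (suc b) = <ᵇ-suc a b

  <⇒<ᵇ≡ : ∀ {a b} → a ℕ.< b → (a <ᵇ b) ≡ true
  <⇒<ᵇ≡ {zero}  (s≤s p)       = refl
  <⇒<ᵇ≡ {suc a} (s≤s p@(s≤s _)) = <⇒<ᵇ≡ p

  exclusive : ∀ a b → (b <ᵇ a) ∧ (a ≡ᵇ b) ≡ false
  exclusive zero    b       = refl
  exclusive (suc a) zero    = refl
  exclusive (suc a) (suc b) = exclusive a b

  module DescentSeries (R : CommutativeRing 0ℓ 0ℓ) (t : CommutativeRing.Carrier R) (s : ℕ) where
    open CommutativeRing R hiding (zero; refl)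
    private
      module R = CommutativeRing R
      module Rˢ = IntegerSolver R
      r = suc s
    open Hurwitz R
    open Exponential R
    open Enumeration R t
    open ClosedForm R t s using (e; D)
    open import Algebra.Properties.Semiring.Sum semiring
      using (sum; sum-cong-≋; ∑-distrib-+; *-distribˡ-sum)
    open import Algebra.Properties.Semiring.Exp semiring using (^-congˡ) renaming (_^_ to _^′_)
    open import Algebra.Properties.Semiring.Mult semiring renaming (_×_ to _·′_) using ()
    module ≋ = CommutativeRing seriesRing

    private
      q : Carrier
      q = 1# - t
      tˢ 1ˢ : Series
      tˢ = const t
      1ˢ = const 1#

    guard-sum : ∀ b n (g : Fin n → Carrier) → guard b (sum g) ≈ sum (λ c → guard b (g c))
    guard-sum true  n g = R.refl
    guard-sum false n g = sym (sum-0 n λ _ → R.refl)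

    sum-guard : ∀ N j (g : ℕ → Carrier) → j ℕ.< N → sum {N} (λ i → guard (j ≡ᵇ toℕ i) (g (toℕ i))) ≈ g j
    sum-guard (suc N) zero    g p       = trans (+-congˡ (sum-0 N λ _ → R.refl)) (+-identityʳ _)
    sum-guard (suc N) (suc j) g (s≤s p) = trans (+-identityˡ _) (sum-guard N j (g ∘ suc) p)

    private
      guard-0 : ∀ b → guard b 0# ≈ 0#
      guard-0 true  = R.refl
      guard-0 false = R.refl

      -- Raising the first letter from a to a + 1 creates a descent for just one continuation, that
      -- of the same color and of rank a among the remaining letters. There t⁰ becomes t¹, and the
      -- difference is q = 1 - t. The bits stand for c′ < c, c = c′, a′ < a and a = a′.
      crossing : ∀ b₁ b₂ b₃ b₅ → b₁ ∧ b₂ ≡ false → b₃ ∧ b₅ ≡ false → ∀ y →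
                 t ^′ bit (b₁ ∨ (b₂ ∧ b₃)) * y
                 ≈ t ^′ bit (b₁ ∨ (b₂ ∧ (b₃ ∨ b₅))) * y + guard b₅ (guard b₂ (q * y))
      crossing true  false b₃    b₅    _ _ y = sym (trans (+-congˡ (guard-0 b₅)) (+-identityʳ _))
      crossing false false b₃    b₅    _ _ y = sym (trans (+-congˡ (guard-0 b₅)) (+-identityʳ _))
      crossing false true  true  false _ _ y = sym (+-identityʳ _)
      crossing false true  false true  _ _ y =
        Rˢ.solve 2 (λ t y → Rˢ.:1 Rˢ.:* y Rˢ.:= (t Rˢ.:* Rˢ.:1) Rˢ.:* y Rˢ.:+ (Rˢ.:1 Rˢ.:- t) Rˢ.:* y) R.refl t y
      crossing false true  false false _ _ y = sym (+-identityʳ _)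

    Σ² : ∀ n → (ℕ → ℕ → Carrier) → Carrier
    Σ² n f = sum {suc n} λ a → sum {r} λ c → f (toℕ a) (toℕ c)

    Σ²-cong : ∀ n {f g : ℕ → ℕ → Carrier} → (∀ {a c} → a ℕ.< suc n → c ℕ.< r → f a c ≈ g a c) → Σ² n f ≈ Σ² n g
    Σ²-cong n p = sum-cong-≋ {n = suc n} λ a → sum-cong-≋ {n = r} λ c → p (Fin.toℕ<n a) (Fin.toℕ<n c)

    Σ²-+ : ∀ n f g → Σ² n (λ a c → f a c + g a c) ≈ Σ² n f + Σ² n g
    Σ²-+ n f g = trans
      (sum-cong-≋ {n = suc n} λ a → ∑-distrib-+ {r} (λ c → f (toℕ a) (toℕ c)) (λ c → g (toℕ a) (toℕ c)))
      (∑-distrib-+ {suc n} (λ a → sum {r} λ c → f (toℕ a) (toℕ c)) (λ a → sum {r} λ c → g (toℕ a) (toℕ c)))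

    Σ²-* : ∀ n x f → Σ² n (λ a c → x * f a c) ≈ x * Σ² n f
    Σ²-* n x f = sym (trans (*-distribˡ-sum {suc n} x (λ a → sum {r} λ c → f (toℕ a) (toℕ c)))
      (sum-cong-≋ {n = suc n} λ a → *-distribˡ-sum {r} x (λ c → f (toℕ a) (toℕ c))))

    first-letter : ∀ n {a c} → a ℕ.< suc n → c ℕ.< r →
                   first r (suc n) a c ≈ first r (suc n) (suc a) c + q * first r n a c
    first-letter n {a} {c} a<n c<r = begin
      Σ² n (λ a′ c′ → t ^′ bit (descent a c a′ c′) * first r n a′ c′)
        ≈⟨ Σ²-cong n {λ a′ c′ → t ^′ bit (descent a c a′ c′) * first r n a′ c′}
                     {λ a′ c′ → t ^′ bit (descent (suc a) c a′ c′) * first r n a′ c′ + δ a′ c′} (λ {a′} {c′} _ _ →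
             trans (crossing (c′ <ᵇ c) (c ≡ᵇ c′) (a′ <ᵇ a) (a ≡ᵇ a′) (exclusive c c′) (exclusive a a′) (first r n a′ c′))
                   (+-congʳ (reflexive (cong (λ b → t ^′ bit ((c′ <ᵇ c) ∨ ((c ≡ᵇ c′) ∧ b)) * first r n a′ c′)
                     (≡.sym (<ᵇ-suc a′ a)))))) ⟩
      Σ² n (λ a′ c′ → t ^′ bit (descent (suc a) c a′ c′) * first r n a′ c′ + δ a′ c′)
        ≈⟨ Σ²-+ n (λ a′ c′ → t ^′ bit (descent (suc a) c a′ c′) * first r n a′ c′) δ ⟩
      first r (suc n) (suc a) c + Σ² n δ
        ≈⟨ +-congˡ collapse ⟩
      first r (suc n) (suc a) c + q * first r n a c ∎
      where
      open import Relation.Binary.Reasoning.Setoid setoid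
      δ : ℕ → ℕ → Carrier
      δ a′ c′ = guard (a ≡ᵇ a′) (guard (c ≡ᵇ c′) (q * first r n a′ c′))
      collapse : Σ² n δ ≈ q * first r n a c
      collapse = trans
        (sum-cong-≋ {n = suc n} λ a′ → trans
          (sym (guard-sum (a ≡ᵇ toℕ a′) r λ c′ → guard (c ≡ᵇ toℕ c′) (q * first r n (toℕ a′) (toℕ c′))))
          (guard-cong (a ≡ᵇ toℕ a′) (sum-guard r c (λ c′ → q * first r n (toℕ a′) c′) c<r)))
        (sum-guard (suc n) a (λ a′ → q * first r n a′ c) a<n)

    total : Series
    total zero    = 1#
    total (suc n) = Σ² n (first r n)

    -- The largest letter of color c is followed by a descent exactly if the next color is at most
    -- c; so is the smallest letter of color c + 1.
    first-last : ∀ n c → first r (suc n) (suc n) c ≈ first r (suc n) 0 (suc c)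
    first-last n c = Σ²-cong n {λ a′ c′ → t ^′ bit (descent (suc n) c a′ c′) * first r n a′ c′}
                               {λ a′ c′ → t ^′ bit (descent 0 (suc c) a′ c′) * first r n a′ c′} λ {a′} {c′} a′<n _ →
      *-congʳ (reflexive (cong (λ b → t ^′ bit b) (begin
        (c′ <ᵇ c) ∨ ((c ≡ᵇ c′) ∧ (a′ <ᵇ suc n))   ≡⟨ cong (λ b → (c′ <ᵇ c) ∨ ((c ≡ᵇ c′) ∧ b)) (<⇒<ᵇ≡ a′<n) ⟩
        (c′ <ᵇ c) ∨ ((c ≡ᵇ c′) ∧ true)            ≡⟨ cong ((c′ <ᵇ c) ∨_) (Bool.∧-identityʳ _) ⟩
        (c′ <ᵇ c) ∨ (c ≡ᵇ c′)                     ≡⟨ <ᵇ-suc c′ c ⟨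
        (c′ <ᵇ suc c)                             ≡⟨ Bool.∨-identityʳ _ ⟨
        (c′ <ᵇ suc c) ∨ false                     ≡⟨ cong ((c′ <ᵇ suc c) ∨_) (Bool.∧-zeroʳ (suc c ≡ᵇ c′)) ⟨
        (c′ <ᵇ suc c) ∨ ((suc c ≡ᵇ c′) ∧ false)   ∎)))
      where open ≡-Reasoning

    private
      -- Words beginning with the smallest and with the largest letter, in color c. `taylor`
      -- expresses Π c by Λ c, and `first-last` almost identifies Λ c with Π (c + 1), so all colors
      -- get chained.
      Π Λ : ℕ → Series
      Π c n = first r n 0 c
      Λ c n = first r n n c

    Π-0 : total ≋ Π 0
    Π-0 zero    = R.refl
    Π-0 (suc n) = Σ²-cong n {first r n} {λ a′ c′ → t ^′ bit (descent 0 0 a′ c′) * first r n a′ c′} λ {a′} {c′} _ _ →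
      sym (trans (*-congʳ (reflexive (cong (λ b → t ^′ bit b) (Bool.∧-zeroʳ (0 ≡ᵇ c′))))) (*-identityˡ _))

    -- The color r does not occur among the letters. A first letter of this fictitious color always
    -- precedes a descent, which costs a factor t.
    Π-r : Π r ≋ tˢ ⊛ total
    Π-r zero    = R.refl
    Π-r (suc n) = trans
      (Σ²-cong n {λ a′ c′ → t ^′ bit (descent 0 r a′ c′) * first r n a′ c′} {λ a′ c′ → t * first r n a′ c′} λ {a′} {c′} _ c′<r →
        *-congʳ (trans (reflexive (cong (λ b → t ^′ bit (b ∨ ((r ≡ᵇ c′) ∧ (a′ <ᵇ 0)))) (<⇒<ᵇ≡ c′<r))) (*-identityʳ t)))
      (trans (Σ²-* n t (first r n)) (sym (const-⊛ t total (suc n))))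

    -- Only the one-letter word escapes `first-last`: it has no descent in color 0 but one in color
    -- 1, and the correction is 1 - t.
    Λ-0 : Λ 0 ≋ Π 1 ⊕ const q
    Λ-0 zero    = Rˢ.solve 1 (λ t → Rˢ.:1 Rˢ.:= t Rˢ.:* Rˢ.:1 Rˢ.:+ (Rˢ.:1 Rˢ.:- t)) R.refl t
    Λ-0 (suc n) = trans (first-last n 0) (sym (+-identityʳ _))

    Λ-suc : ∀ c → Λ (suc c) ≋ Π (2 ℕ.+ c)
    Λ-suc c zero    = R.refl
    Λ-suc c (suc n) = first-last n (suc c)

    open ≋ using () renaming (sym to ≋-sym; trans to ≋-trans; refl to ≋-refl)

    -- For P a n = first r (a + n) a c, first-letter says that
    -- P a (n + 1) = P (a + 1) n + q P a n, and this is iterated here.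
    taylor : ∀ {c} → c ℕ.< r → ∀ n a → first r (a ℕ.+ n) a c ≈ (exp q ⊛ (λ m → first r (a ℕ.+ m) (a ℕ.+ m) c)) n
    taylor {c} c<r zero    a =
      trans (reflexive (cong (λ k → first r (a ℕ.+ 0) k c) (≡.sym (ℕ.+-identityʳ a)))) (sym (*-identityˡ _))
    taylor {c} c<r (suc n) a = begin
      first r (a ℕ.+ suc n) a c
        ≡⟨ cong (λ k → first r k a c) (ℕ.+-suc a n) ⟩
      first r (suc (a ℕ.+ n)) a c
        ≈⟨ first-letter (a ℕ.+ n) (s≤s (ℕ.m≤m+n a n)) c<r ⟩
      first r (suc (a ℕ.+ n)) (suc a) c + q * first r (a ℕ.+ n) a c
        ≈⟨ +-cong (taylor c<r n (suc a)) (*-congˡ (taylor c<r n a)) ⟩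
      (exp q ⊛ (λ m → first r (suc a ℕ.+ m) (suc a ℕ.+ m) c)) n + q * (exp q ⊛ h) n
        ≈⟨ +-comm _ _ ⟩
      q * (exp q ⊛ h) n + (exp q ⊛ (λ m → first r (suc a ℕ.+ m) (suc a ℕ.+ m) c)) n
        ≈⟨ +-cong (trans (sym (const-⊛ q (exp q ⊛ h) n))
                    (trans (sym (⊛-assoc (const q) (exp q) h n)) (⊛-cong {g = h} (≋-sym (∂-exp q)) ≋-refl n)))
                  (⊛-cong {f = exp q} ≋-refl (λ m → reflexive (cong (λ k → first r k k c) (≡.sym (ℕ.+-suc a m)))) n) ⟩
      (∂ (exp q) ⊛ h) n + (exp q ⊛ ∂ h) n ∎
      where
      open import Relation.Binary.Reasoning.Setoid setoid
      h : Series
      h m = first r (a ℕ.+ m) (a ℕ.+ m) c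

    exp-+ : ∀ a b → exp a ⊛ exp b ≋ exp (a + b)
    exp-+ a b = linear-unique {y = const (a + b)} (*-identityˡ 1#) lhs (∂-exp (a + b))
      where
      module S = IntegerSolver seriesRing
      lhs : ∂ (exp a ⊛ exp b) ≋ const (a + b) ⊛ (exp a ⊛ exp b)
      lhs = ≋-trans (≋.+-cong (⊛-cong {g = exp b} (∂-exp a) ≋-refl) (⊛-cong {f = exp a} ≋-refl (∂-exp b)))
        (≋-trans (S.solve 4 (λ a b x y → (a S.:* x) S.:* y S.:+ x S.:* (b S.:* y) S.:= (a S.:+ b) S.:* (x S.:* y)) ≋-refl
                   (const a) (const b) (exp a) (exp b))
          (⊛-cong {g = exp a ⊛ exp b} (≋-sym (const-+ a b)) ≋-refl))

    exp-cong : ∀ {a b} → a ≈ b → exp a ≋ exp b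
    exp-cong p n = ^-congˡ n p

    exp-0 : exp 0# ≋ 1ˢ
    exp-0 = linear-unique {y = const 0#} R.refl (∂-exp 0#) (λ n → sym (trans (const-⊛ 0# 1ˢ n) (zeroˡ _)))

    -- Each of the j steps from color c + 1 up to color r passes through `taylor` once and
    -- contributes a factor exp q.
    Π-suc : ∀ j c → suc c ℕ.+ j ≡ r → Π (suc c) ≋ exp ((j ·′ 1#) * q) ⊛ Π r
    Π-suc zero    c eq = ≋-trans (λ n → reflexive (cong (λ c → first r n 0 c) (≡.trans (≡.sym (ℕ.+-identityʳ _)) eq)))
      (≋-trans (≋-sym (≋.*-identityˡ (Π r))) (⊛-cong {g = Π r} (≋-sym (≋-trans (exp-cong (zeroˡ q)) exp-0)) ≋-refl))
    Π-suc (suc j) c eq = ≋-trans (λ n → taylor (ℕ.≤-trans (s≤s (ℕ.≤-trans (ℕ.m≤m+n (suc c) j) (ℕ.≤-reflexive (≡.sym (ℕ.+-suc c j))))) (ℕ.≤-reflexive eq)) n 0)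
      (≋-trans (⊛-cong {f = exp q} ≋-refl (≋-trans (Λ-suc c) (Π-suc j (suc c) (≡.trans (cong suc (≡.sym (ℕ.+-suc c j))) eq))))
        (≋-trans (≋-sym (⊛-assoc (exp q) (exp ((j ·′ 1#) * q)) (Π r)))
          (⊛-cong {g = Π r} (≋-trans (exp-+ q ((j ·′ 1#) * q)) (exp-cong
            (Rˢ.solve 2 (λ j q → q Rˢ.:+ j Rˢ.:* q Rˢ.:= (Rˢ.:1 Rˢ.:+ j) Rˢ.:* q) R.refl (j ·′ 1#) q))) ≋-refl)))

    -- The chain of colors leads from Π 0, which is the series itself, to Π r, which is t times the
    -- series. This gives a linear equation with r factors exp q collected in `e` and an
    -- inhomogeneous term from `Λ-0`.
    D⊛total : D ⊛ total ≋ const q ⊛ exp q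
    D⊛total = begin
      (1ˢ ⊕ ⊖ (tˢ ⊛ e)) ⊛ total
        ≈⟨ S.solve 3 (λ t e a → (S.:1 S.:- t S.:* e) S.:* a S.:= a S.:- e S.:* (t S.:* a)) ≋-refl tˢ e total ⟩
      total ⊕ ⊖ (e ⊛ (tˢ ⊛ total))
        ≈⟨ ≋.+-congʳ {⊖ (e ⊛ (tˢ ⊛ total))} functional ⟩
      (e ⊛ (tˢ ⊛ total) ⊕ const q ⊛ exp q) ⊕ ⊖ (e ⊛ (tˢ ⊛ total))
        ≈⟨ S.solve 2 (λ x y → (x S.:+ y) S.:- x S.:= y) ≋-refl (e ⊛ (tˢ ⊛ total)) (const q ⊛ exp q) ⟩
      const q ⊛ exp q ∎
      where
      open import Relation.Binary.Reasoning.Setoid ≋.setoid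
      module S = IntegerSolver seriesRing
      functional : total ≋ e ⊛ (tˢ ⊛ total) ⊕ const q ⊛ exp q
      functional = begin
        total                                  ≈⟨ Π-0 ⟩
        Π 0                                    ≈⟨ (λ n → taylor (s≤s z≤n) n 0) ⟩
        exp q ⊛ Λ 0                            ≈⟨ ⊛-cong {f = exp q} ≋-refl (≋-trans Λ-0 (≋.+-congʳ {const q} (Π-suc s 0 refl))) ⟩
        exp q ⊛ (exp ((s ·′ 1#) * q) ⊛ Π r ⊕ const q)
          ≈⟨ S.solve 4 (λ x y p q → x S.:* (y S.:* p S.:+ q) S.:= (x S.:* y) S.:* p S.:+ q S.:* x) ≋-refl
               (exp q) (exp ((s ·′ 1#) * q)) (Π r) (const q) ⟩
        (exp q ⊛ exp ((s ·′ 1#) * q)) ⊛ Π r ⊕ const q ⊛ exp q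
          ≈⟨ ≋.+-congʳ {const q ⊛ exp q} (⊛-cong (≋-trans (exp-+ q ((s ·′ 1#) * q)) (exp-cong
               (Rˢ.solve 2 (λ j q → q Rˢ.:+ j Rˢ.:* q Rˢ.:= (Rˢ.:1 Rˢ.:+ j) Rˢ.:* q) R.refl (s ·′ 1#) q))) Π-r) ⟩
        e ⊛ (tˢ ⊛ total) ⊕ const q ⊛ exp q ∎

    -- The sum defining Ã is multiplication by exp t, and t + q = 1.
    D⊛binomial : D ⊛ (exp t ⊛ total) ≋ const q ⊛ exp 1#
    D⊛binomial = begin
      D ⊛ (exp t ⊛ total)          ≈⟨ S.solve 3 (λ d x a → d S.:* (x S.:* a) S.:= x S.:* (d S.:* a)) ≋-refl D (exp t) total ⟩
      exp t ⊛ (D ⊛ total)          ≈⟨ ⊛-cong {f = exp t} ≋-refl D⊛total ⟩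
      exp t ⊛ (const q ⊛ exp q)    ≈⟨ S.solve 3 (λ x q y → x S.:* (q S.:* y) S.:= q S.:* (x S.:* y)) ≋-refl (exp t) (const q) (exp q) ⟩
      const q ⊛ (exp t ⊛ exp q)    ≈⟨ ⊛-cong {f = const q} ≋-refl (≋-trans (exp-+ t q) (exp-cong
                                        (Rˢ.solve 1 (λ t → t Rˢ.:+ (Rˢ.:1 Rˢ.:- t) Rˢ.:= Rˢ.:1) R.refl t))) ⟩
      const q ⊛ exp 1#             ∎
      where
      open import Relation.Binary.Reasoning.Setoid ≋.setoid
      module S = IntegerSolver seriesRing

  module Binomial (R : CommutativeRing 0ℓ 0ℓ) where
    open CommutativeRing R hiding (zero; refl)
    private module R = CommutativeRing R
    open Hurwitz R
    open import Algebra.Properties.Semiring.Sum semiring using (sum; sum-cong-≋; ∑-distrib-+)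
    open import Algebra.Properties.Semiring.Mult semiring renaming (_×_ to _·′_) using (×-homo-+)
    open import Relation.Binary.Reasoning.Setoid setoid

    sum-last : ∀ n (f : ℕ → Carrier) → sum {suc n} (f ∘ toℕ) ≈ sum {n} (f ∘ toℕ) + f n
    sum-last zero    f = +-comm _ _
    sum-last (suc n) f = trans (+-congˡ (sum-last n (f ∘ suc))) (sym (+-assoc _ _ _))

    ⊛-binomial : ∀ n f g → (f ⊛ g) n ≈ sum {suc n} (λ m → (n C toℕ m) ·′ (f (n ∸ toℕ m) * g (toℕ m)))
    ⊛-binomial zero    f g = sym (trans (+-identityʳ _) (+-identityʳ _))
    ⊛-binomial (suc n) f g = begin
      (∂ f ⊛ g) n + (f ⊛ ∂ g) n
        ≈⟨ +-cong (⊛-binomial n (∂ f) g) (⊛-binomial n f (∂ g)) ⟩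
      sum {suc n} (λ m → (n C toℕ m) ·′ (f (suc (n ∸ toℕ m)) * g (toℕ m))) + sum {suc n} (λ m → (n C toℕ m) ·′ h (suc (toℕ m)))
        ≈⟨ +-congʳ (sum-cong-≋ {n = suc n} λ m → reflexive (cong (λ k → (n C toℕ m) ·′ (f k * g (toℕ m)))
             (≡.sym (ℕ.+-∸-assoc 1 (ℕ.≤-pred (Fin.toℕ<n m)))))) ⟩
      sum {suc n} (λ m → (n C toℕ m) ·′ h (toℕ m)) + sum {suc n} (λ m → (n C toℕ m) ·′ h (suc (toℕ m)))
        ≈⟨ +-congʳ (trans (sym (+-identityʳ _)) (+-congˡ {sum {suc n} λ m → (n C toℕ m) ·′ h (toℕ m)}
             (sym (reflexive (cong (_·′ h (suc n)) (k>n⇒nCk≡0 (ℕ.n<1+n n))))))) ⟩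
      (sum {suc n} (λ m → (n C toℕ m) ·′ h (toℕ m)) + (n C suc n) ·′ h (suc n)) + sum {suc n} (λ m → (n C toℕ m) ·′ h (suc (toℕ m)))
        ≈⟨ +-congʳ (sum-last (suc n) (λ m → (n C m) ·′ h m)) ⟨
      ((n C 0) ·′ h 0 + sum {suc n} (λ m → (n C suc (toℕ m)) ·′ h (suc (toℕ m)))) + sum {suc n} (λ m → (n C toℕ m) ·′ h (suc (toℕ m)))
        ≈⟨ trans (+-assoc _ _ _) (+-congˡ (+-comm _ _)) ⟩
      (n C 0) ·′ h 0 + (sum {suc n} (λ m → (n C toℕ m) ·′ h (suc (toℕ m))) + sum {suc n} (λ m → (n C suc (toℕ m)) ·′ h (suc (toℕ m))))
        ≈⟨ +-congˡ (∑-distrib-+ {suc n} (λ m → (n C toℕ m) ·′ h (suc (toℕ m))) (λ m → (n C suc (toℕ m)) ·′ h (suc (toℕ m)))) ⟨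
      (n C 0) ·′ h 0 + sum {suc n} (λ m → (n C toℕ m) ·′ h (suc (toℕ m)) + (n C suc (toℕ m)) ·′ h (suc (toℕ m)))
        ≈⟨ +-congˡ {(n C 0) ·′ h 0} (sum-cong-≋ {n = suc n} λ m → trans
             (sym (×-homo-+ (h (suc (toℕ m))) (n C toℕ m) (n C suc (toℕ m))))
             (reflexive (cong (_·′ h (suc (toℕ m))) (nCk+nC[k+1]≡[n+1]C[k+1] n (toℕ m))))) ⟩
      (suc n C 0) ·′ h 0 + sum {suc n} (λ m → (suc n C suc (toℕ m)) ·′ h (suc (toℕ m))) ∎
      where
      h : ℕ → Carrier
      h m = f (suc n ∸ m) * g m

-- The decomposition of Ã into F and G.

module BinomialEulerian where

  open import Defs
  open ExponentialSeries
  open Polynomials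
  open EulerianRecursion
  open ClosedForms
  open DescentEnumeration
  open DescentSeriesEquation
  open import Algebra.Bundles using (CommutativeRing)
  open import Data.Fin.Base using (zero; suc; toℕ)
  open import Data.Nat.Base using (ℕ; zero; suc; _∸_)
  open import Data.Nat.Combinatorics using (_C_)
  open import Data.Integer.Base as ℤ using (ℤ; 0ℤ; 1ℤ)
  import Data.Integer.Properties as ℤ
  open import Relation.Binary.PropositionalEquality as ≡ using (_≡_; refl; cong; module ≡-Reasoning)

  module P = CommutativeRing polyRing

  coeff-1-X : ∀ p k → coeff ((1ₚ +ₚ (-ₚ X)) *ₚ p) (suc k) ≡ coeff p (suc k) ℤ.- coeff p k
  coeff-1-X p k = begin
    coeff ((1ₚ +ₚ (-ₚ X)) *ₚ p) (suc k)                                 ≡⟨ coeff-* (1ₚ +ₚ (-ₚ X)) p (suc k) ⟩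
    1ℤ ℤ.* coeff p (suc k) ℤ.+ ((λ j → coeff (1ₚ +ₚ (-ₚ X)) (suc j)) ∗ coeff p) k
      ≡⟨ ≡.cong₂ ℤ._+_ (ℤ.*-identityˡ (coeff p (suc k))) (tail k) ⟩
    coeff p (suc k) ℤ.- coeff p k ∎
    where
    open ≡-Reasoning
    open Convolution using (_∗_)
    tail : ∀ k → ((λ j → coeff (1ₚ +ₚ (-ₚ X)) (suc j)) ∗ coeff p) k ≡ ℤ.- coeff p k
    tail zero    = ℤ.-1*i≡-i (coeff p 0)
    tail (suc k) = ≡.trans (≡.cong₂ ℤ._+_ (ℤ.-1*i≡-i (coeff p (suc k))) (≡.sym (coeff-* [] p k))) (ℤ.+-identityʳ _)
      where open import Data.List.Base using ([])

  -- The coefficients of (1 - X) p are the differences of consecutive coefficients of p, so these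
  -- vanish one after the other.
  1-X-regular : ∀ {p} → (1ₚ +ₚ (-ₚ X)) *ₚ p ≐ 0ₚ → p ≐ 0ₚ
  1-X-regular {p} e = pointwise vanishes
    where
    vanishes : ∀ k → coeff p k ≡ 0ℤ
    vanishes zero    = ≡.trans (≡.sym (ℤ.*-identityˡ (coeff p 0))) (≡.trans (≡.sym (coeff-* (1ₚ +ₚ (-ₚ X)) p 0)) (at e 0))
    vanishes (suc k) = ≡.trans (ℤ.i-j≡0⇒i≡j _ _ (≡.trans (≡.sym (coeff-1-X p k)) (at e (suc k)))) (vanishes k)

  -- The operations that Defs derives from polySemiring and those derived from
  -- polyRing only differ in the equality of the underlying raw structure.
  module Coherence where
    import Algebra.Properties.Semiring.Sum P.semiring as Sum
    import Algebra.Properties.Semiring.Mult P.semiring as Mult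
    import Algebra.Properties.Semiring.Exp P.semiring as Exp
    open import Data.Vec.Functional using (Vector)

    sum≡ : ∀ {n} (f : Vector Poly n) → sumₚ f ≡ Sum.sum f
    sum≡ {zero}  f = refl
    sum≡ {suc n} f = cong (f zero +ₚ_) (sum≡ (λ i → f (suc i)))

    ·≡ : ∀ n p → n · p ≡ n Mult.× p
    ·≡ zero    p = refl
    ·≡ (suc n) p = cong (p +ₚ_) (·≡ n p)

    ^≡ : ∀ p n → p ^ n ≡ p Exp.^ n
    ^≡ p zero    = refl
    ^≡ p (suc n) = cong (p *ₚ_) (^≡ p n)

  open Coherence

  module EulerianPoly (s : ℕ) where
    open Hurwitz polyRing using (_⊛_)
    open Exponential polyRing using (exp; ⊛-cancelˡ)
    open DescentSeries polyRing X s using (total; D⊛binomial)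
    open ClosedForm polyRing X s using (D; D⊛T; T; T≋F⊕G)
    open Eulerian polyRing (1ₚ +ₚ X) X s using (F; G)
    open import Algebra.Properties.Semiring.Sum P.semiring using (sum-cong-≋)
    open import Algebra.Properties.Semiring.Mult P.semiring using (×-congʳ)

    A≐total : ∀ n → A n (suc s) ≐ total n
    A≐total zero    = P.refl
    A≐total (suc n) = P.trans
      (Enumeration.ΣL-cong polyRing X (coloredPermutations (suc n) (suc s)) (λ w → P.reflexive (^≡ X (des w))))
      (Enumeration.ΣL-coloredPermutations polyRing X (suc s) n)

    Ã≐binomial : ∀ n → Ã n (suc s) ≐ (exp X ⊛ total) n
    Ã≐binomial n = P.trans
      (P.trans (P.reflexive (sum≡ {suc n} λ m → (n C toℕ m) · ((X ^ (n ∸ toℕ m)) *ₚ A (toℕ m) (suc s))))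
        (sum-cong-≋ {n = suc n} λ m → P.trans
          (P.reflexive (·≡ (n C toℕ m) ((X ^ (n ∸ toℕ m)) *ₚ A (toℕ m) (suc s))))
          (×-congʳ (n C toℕ m) (P.*-cong (P.reflexive (^≡ X (n ∸ toℕ m))) (A≐total (toℕ m))))))
      (P.sym (Binomial.⊛-binomial polyRing n (exp X) total))

    -- Both series have the same product with D, whose constant term 1 - X can be cancelled.
    Ã≐F+G : ∀ n → Ã n (suc s) ≐ F n +ₚ G n
    Ã≐F+G n = P.trans (Ã≐binomial n) (P.trans
      (⊛-cancelˡ D (exp X ⊛ total) T (λ e → 1-X-regular (P.trans (P.*-congʳ (P.+-congˡ {1ₚ} (P.-‿cong (P.sym (P.*-identityʳ X))))) e))
        (λ k → P.trans (D⊛binomial k) (P.sym (D⊛T k))) n)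
      (T≋F⊕G n))

-- Graphs of flag complexes and rational certificates of their realizations.

module RationalGeometry where

  open import Defs using (quotient)
  open import Algebra.Bundles using (CommutativeRing)
  open import Data.Bool.Base using (Bool; true; false; _∨_; _∧_; not)
  import Data.Bool.Properties as Bool
  open import Data.Fin.Base as Fin using (Fin; zero; suc)
  import Data.Fin.Properties as Fin
  open import Data.Fin.Subset using (Subset)
  open import Data.Nat.Base as ℕ using (ℕ; zero; suc)
  open import Data.Product.Base using (_×_; _,_; proj₁; proj₂; ∃-syntax)
  open import Data.Rational.Base as ℚ using (ℚ; 0ℚ; 1ℚ; _+_; _*_; -_; _-_; _<_; _≤_; ∣_∣)
  import Data.Rational.Properties as ℚ
  open import Data.Rational.Solver using (module +-*-Solver)
  open import Data.Sum.Base using (inj₁; inj₂)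
  open import Data.Vec.Base using ([]; _∷_; lookup)
  open import Function.Base using (_∘_)
  open import Relation.Binary.PropositionalEquality using (_≡_; _≢_; refl; sym; trans; cong; cong₂; subst)
  open import Relation.Nullary using (Dec; does; yes; no; contradiction)
  open import Relation.Nullary.Decidable using (_→-dec_; ¬?)

  2ℚ : ℚ
  2ℚ = 1ℚ + 1ℚ

  module Graphs where

    -- A flag complex is determined by its graph, with the cliques as faces. Boolean adjacency keeps
    -- membership of faces decidable.
    record Graph (m : ℕ) : Set where
      field
        adj        : Fin m → Fin m → Bool
        adj-sym    : ∀ i j → adj i j ≡ adj j i
        adj-irrefl : ∀ i → adj i i ≡ false

      Clique : Subset m → Set
      Clique S = ∀ i j → lookup S i ≡ true → lookup S j ≡ true → i ≢ j → adj i j ≡ true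

      clique? : ∀ S → Dec (Clique S)
      clique? S = Fin.all? λ i → Fin.all? λ j →
        (lookup S i Bool.≟ true) →-dec ((lookup S j Bool.≟ true) →-dec (¬? (i Fin.≟ j) →-dec (adj i j Bool.≟ true)))

    open Graph public

    infix 5 _==_
    _==_ : ∀ {m} → Fin m → Fin m → Bool
    i == j = does (i Fin.≟ j)

    ==-refl : ∀ {m} (i : Fin m) → (i == i) ≡ true
    ==-refl i with i Fin.≟ i
    ... | yes _  = refl
    ... | no i≢i = contradiction refl i≢i

    ==-≢ : ∀ {m} {i j : Fin m} → i ≢ j → (i == j) ≡ false
    ==-≢ {i = i} {j} i≢j with i Fin.≟ j
    ... | yes i≡j = contradiction i≡j i≢j
    ... | no _    = refl

    suspend : ∀ {m} → Graph m → Graph (2 ℕ.+ m)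
    suspend {m} G = record { adj = adj′ ; adj-sym = sym′ ; adj-irrefl = irrefl′ }
      where
      adj′ : Fin (2 ℕ.+ m) → Fin (2 ℕ.+ m) → Bool
      adj′ (suc (suc i)) (suc (suc j)) = adj G i j
      adj′ (suc (suc i)) _             = true
      adj′ _             (suc (suc j)) = true
      adj′ _             _             = false
      sym′ : ∀ i j → adj′ i j ≡ adj′ j i
      sym′ (suc (suc i)) (suc (suc j)) = adj-sym G i j
      sym′ (suc (suc i)) zero          = refl
      sym′ (suc (suc i)) (suc zero)    = refl
      sym′ zero          (suc (suc j)) = refl
      sym′ (suc zero)    (suc (suc j)) = refl
      sym′ zero          zero          = refl
      sym′ zero          (suc zero)    = refl
      sym′ (suc zero)    zero          = refl
      sym′ (suc zero)    (suc zero)    = refl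
      irrefl′ : ∀ i → adj′ i i ≡ false
      irrefl′ zero          = refl
      irrefl′ (suc zero)    = refl
      irrefl′ (suc (suc i)) = adj-irrefl G i

    module _ {m} (G : Graph m) (u v : Fin m) where

      -- The vertices of the closed star of the edge u v, to which the new vertex is joined.
      star : Fin m → Bool
      star i = (i == u) ∨ ((i == v) ∨ (adj G u i ∧ adj G v i))

      isEdge : Fin m → Fin m → Bool
      isEdge i j = ((i == u) ∧ (j == v)) ∨ ((i == v) ∧ (j == u))

      delete-edge : Graph m
      delete-edge = record
        { adj        = λ i j → adj G i j ∧ not (isEdge i j)
        ; adj-sym    = λ i j → cong₂ (λ a b → a ∧ not b) (adj-sym G i j)
                         (trans (Bool.∨-comm ((i == u) ∧ (j == v)) _) (cong₂ _∨_ (Bool.∧-comm (i == v) (j == u)) (Bool.∧-comm (i == u) (j == v))))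
        ; adj-irrefl = λ i → cong (_∧ not (isEdge i i)) (adj-irrefl G i) }

      -- The new vertex has index 0.
      subdivide : Graph (suc m)
      subdivide = record { adj = adj′ ; adj-sym = sym′ ; adj-irrefl = irrefl′ }
        where
        adj′ : Fin (suc m) → Fin (suc m) → Bool
        adj′ zero    zero    = false
        adj′ zero    (suc j) = star j
        adj′ (suc i) zero    = star i
        adj′ (suc i) (suc j) = adj delete-edge i j
        sym′ : ∀ i j → adj′ i j ≡ adj′ j i
        sym′ zero    zero    = refl
        sym′ zero    (suc j) = refl
        sym′ (suc i) zero    = refl
        sym′ (suc i) (suc j) = adj-sym delete-edge i j
        irrefl′ : ∀ i → adj′ i i ≡ false
        irrefl′ zero    = refl
        irrefl′ (suc i) = adj-irrefl delete-edge i

  open Graphs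

  module Vectors where
    open import Algebra.Properties.Semiring.Sum (CommutativeRing.semiring ℚ.+-*-commutativeRing) public
      using (sum; sum-cong-≗; ∑-distrib-+; ∑-comm; *-distribˡ-sum)

    Vecℚ : ℕ → Set
    Vecℚ n = Fin n → ℚ

    dot : ∀ {n} → Vecℚ n → Vecℚ n → ℚ
    dot {n} c p = sum {n} λ k → c k * p k

    sum-cong : ∀ {n} {f g : Vecℚ n} → (∀ i → f i ≡ g i) → sum f ≡ sum g
    sum-cong {n} = sum-cong-≗ {n}

    sum-linear : ∀ {n} a b (f g : Vecℚ n) → sum (λ i → a * f i + b * g i) ≡ a * sum f + b * sum g
    sum-linear {n} a b f g = trans (∑-distrib-+ {n} (λ i → a * f i) (λ i → b * g i))
      (sym (cong₂ _+_ (*-distribˡ-sum {n} a f) (*-distribˡ-sum {n} b g)))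

    dot-linearˡ : ∀ {n} a b (c d p : Vecℚ n) → dot (λ k → a * c k + b * d k) p ≡ a * dot c p + b * dot d p
    dot-linearˡ {n} a b c d p = trans
      (sum-cong {n} λ k → solve 5 (λ a b c d p → (a :* c :+ b :* d) :* p := a :* (c :* p) :+ b :* (d :* p)) refl a b (c k) (d k) (p k))
      (sum-linear {n} a b (λ k → c k * p k) (λ k → d k * p k))
      where open +-*-Solver

    dot-linearʳ : ∀ {n} a b (c p q : Vecℚ n) → dot c (λ k → a * p k + b * q k) ≡ a * dot c p + b * dot c q
    dot-linearʳ {n} a b c p q = trans
      (sum-cong {n} λ k → solve 5 (λ a b c p q → c :* (a :* p :+ b :* q) := a :* (c :* p) :+ b :* (c :* q)) refl a b (c k) (p k) (q k))
      (sum-linear {n} a b (λ k → c k * p k) (λ k → c k * q k))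
      where open +-*-Solver

    sum-zero : ∀ n {f : Vecℚ n} → (∀ i → f i ≡ 0ℚ) → sum f ≡ 0ℚ
    sum-zero zero    p = refl
    sum-zero (suc n) p = trans (cong₂ _+_ (p zero) (sum-zero n (p ∘ suc))) refl

    unit : ∀ {n} → Fin n → Vecℚ n
    unit zero    zero    = 1ℚ
    unit zero    (suc k) = 0ℚ
    unit (suc i) zero    = 0ℚ
    unit (suc i) (suc k) = unit i k

    sum-unit : ∀ {n} (i : Fin n) (f : Vecℚ n) → sum (λ k → unit i k * f k) ≡ f i
    sum-unit {suc n} zero    f = trans (cong₂ _+_ (ℚ.*-identityˡ (f zero)) (sum-zero n λ k → ℚ.*-zeroˡ (f (suc k)))) (ℚ.+-identityʳ _)
    sum-unit {suc n} (suc i) f = trans (cong₂ _+_ (ℚ.*-zeroˡ (f zero)) (sum-unit i (f ∘ suc))) (ℚ.+-identityˡ _)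

    total-unit : ∀ {n} (i : Fin n) → sum (unit i) ≡ 1ℚ
    total-unit {suc n} zero    = trans (cong (1ℚ +_) (sum-zero n {λ _ → 0ℚ} λ _ → refl)) refl
    total-unit {suc n} (suc i) = trans (ℚ.+-identityˡ _) (total-unit i)

    unit-nonNeg : ∀ {n} (i k : Fin n) → 0ℚ ≤ unit i k
    unit-nonNeg zero    zero    = ℚ.nonNegative⁻¹ 1ℚ
    unit-nonNeg zero    (suc k) = ℚ.≤-refl
    unit-nonNeg (suc i) zero    = ℚ.≤-refl
    unit-nonNeg (suc i) (suc k) = unit-nonNeg i k

  open Vectors

  module Realizations where

    module _ {n m} (pt : Fin m → Vecℚ n) where

      -- A supporting hyperplane that misses the origin, normalised to the value 1. The dual vectors
      -- witness that the points of S are linearly independent, and tilting the hyperplane is done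
      -- along them.
      record Support (S : Subset m) : Set where
        field
          functional : Vecℚ n
          on         : ∀ i → lookup S i ≡ true → dot functional (pt i) ≡ 1ℚ
          off        : ∀ i → lookup S i ≡ false → dot functional (pt i) < 1ℚ
          dual       : Fin m → Vecℚ n
          dual-self  : ∀ i → lookup S i ≡ true → dot (dual i) (pt i) ≡ 1ℚ
          dual-other : ∀ i j → lookup S i ≡ true → lookup S j ≡ true → i ≢ j → dot (dual i) (pt j) ≡ 0ℚ

      -- By such a relation a hyperplane supporting the polytope cannot contain
      -- both points, unless it passes through the origin.
      record Separation (i j : Fin m) : Set where
        field
          weight    : Vecℚ m
          nonNeg    : ∀ k → 0ℚ ≤ weight k
          total<2   : sum weight < 2ℚ
          relation  : ∀ k → pt i k + pt j k ≡ sum λ l → weight l * pt l k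

    -- The points ± e_k are kept among the vertices throughout. They span the space affinely, and
    -- they force a valid inequality with bound at most 0 to be trivial.
    record Realization (n : ℕ) {m} (G : Graph m) : Set where
      field
        pt       : Fin m → Vecℚ n
        supports : ∀ S → Clique G S → Support pt S
        separate : ∀ i j → i ≢ j → adj G i j ≡ false → Separation pt i j
        axis⁺    : ∀ k → ∃[ i ] ∀ l → pt i l ≡ unit k l
        axis⁻    : ∀ k → ∃[ i ] ∀ l → pt i l ≡ - unit k l


  module SmallNumbers where

    -- A property of all sufficiently small ε > 0. The finitely many conditions on a new vertex each
    -- come with a threshold, and the least threshold serves them all.
    Small : (ℚ → Set) → Set
    Small P = ∃[ ε₀ ] 0ℚ < ε₀ × (∀ ε → 0ℚ < ε → ε ≤ ε₀ → P ε)

    small-always : ∀ {P : ℚ → Set} → (∀ ε → 0ℚ < ε → P ε) → Small P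
    small-always p = 1ℚ , ℚ.positive⁻¹ 1ℚ , λ ε 0<ε _ → p ε 0<ε

    small-× : ∀ {P Q : ℚ → Set} → Small P → Small Q → Small λ ε → P ε × Q ε
    small-× (x , 0<x , p) (y , 0<y , q) with ℚ.≤-total x y
    ... | inj₁ x≤y = x , 0<x , λ ε 0<ε ε≤ → p ε 0<ε ε≤ , q ε 0<ε (ℚ.≤-trans ε≤ x≤y)
    ... | inj₂ y≤x = y , 0<y , λ ε 0<ε ε≤ → p ε 0<ε (ℚ.≤-trans ε≤ y≤x) , q ε 0<ε ε≤

    small-map : ∀ {P Q : ℚ → Set} → (∀ ε → 0ℚ < ε → P ε → Q ε) → Small P → Small Q
    small-map f (x , 0<x , p) = x , 0<x , λ ε 0<ε ε≤ → f ε 0<ε (p ε 0<ε ε≤)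

    small-Fin : ∀ {m} {P : Fin m → ℚ → Set} → (∀ i → Small (P i)) → Small λ ε → ∀ i → P i ε
    small-Fin {zero}  p = small-always λ _ _ ()
    small-Fin {suc m} p = small-map (λ { _ _ (p₀ , ps) zero → p₀ ; _ _ (p₀ , ps) (suc i) → ps i })
                            (small-× (p zero) (small-Fin (p ∘ suc)))

    small-Subset : ∀ {m} {P : Subset m → ℚ → Set} → (∀ S → Small (P S)) → Small λ ε → ∀ S → P S ε
    small-Subset {zero}  p = small-map (λ { _ _ p₀ [] → p₀ }) (p [])
    small-Subset {suc m} p = small-map (λ { _ _ (ps , qs) (true ∷ S) → ps S ; _ _ (ps , qs) (false ∷ S) → qs S })
                               (small-× (small-Subset (p ∘ (true ∷_))) (small-Subset (p ∘ (false ∷_))))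

    small-dec : ∀ {A : Set} {P : ℚ → Set} → Dec A → (A → Small P) → Small λ ε → A → P ε
    small-dec (yes a) p = small-map (λ _ _ q _ → q) (p a)
    small-dec (no ¬a) p = small-always λ _ _ a → contradiction a ¬a

    p≤∣p∣ : ∀ p → p ≤ ∣ p ∣
    p≤∣p∣ p with ℚ.≤-total 0ℚ p
    ... | inj₁ 0≤p = ℚ.≤-reflexive (sym (ℚ.0≤p⇒∣p∣≡p 0≤p))
    ... | inj₂ p≤0 = ℚ.≤-trans p≤0 (ℚ.0≤∣p∣ p)

    -- The threshold is (c - a) / (1 + |b|); the summand 1 keeps the divisor positive.
    small-affine : ∀ {a c} b → a < c → Small λ ε → a + ε * b < c
    small-affine {a} {c} b a<c = ε₀ , 0<ε₀ , λ ε 0<ε ε≤ε₀ → begin-strict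
      a + ε * b                  ≤⟨ ℚ.+-monoʳ-≤ a (ℚ.*-monoˡ-≤-nonNeg ε {{ℚ.nonNegative (ℚ.<⇒≤ 0<ε)}} (p≤∣p∣ b)) ⟩
      a + ε * ∣ b ∣              ≤⟨ ℚ.+-monoʳ-≤ a (ℚ.*-monoʳ-≤-nonNeg ∣ b ∣ {{ℚ.nonNegative (ℚ.0≤∣p∣ b)}} ε≤ε₀) ⟩
      a + ε₀ * ∣ b ∣             <⟨ ℚ.+-monoʳ-< a (ℚ.*-monoʳ-<-pos ε₀ {{ℚ.positive 0<ε₀}} ∣b∣<d) ⟩
      a + ε₀ * (1ℚ + ∣ b ∣)      ≡⟨ cong (a +_) eq ⟩
      a + (c - a)                ≡⟨ solve 2 (λ a c → a :+ (c :- a) := c) refl a c ⟩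
      c                          ∎
      where
      open ℚ.≤-Reasoning
      open +-*-Solver
      ∣b∣<d : ∣ b ∣ < 1ℚ + ∣ b ∣
      ∣b∣<d = ℚ.≤-<-trans (ℚ.≤-reflexive (sym (ℚ.+-identityˡ ∣ b ∣))) (ℚ.+-monoˡ-< ∣ b ∣ (ℚ.positive⁻¹ 1ℚ))
      0<c-a : 0ℚ < c - a
      0<c-a = subst (_< c - a) (ℚ.+-inverseʳ a) (ℚ.+-monoˡ-< (- a) a<c)
      ratio = quotient (c - a) (1ℚ + ∣ b ∣) 0<c-a (ℚ.≤-<-trans (ℚ.0≤∣p∣ b) ∣b∣<d)
      ε₀ = proj₁ ratio
      0<ε₀ = proj₁ (proj₂ ratio)
      eq = proj₂ (proj₂ ratio)

-- Realizing the subdivision of an edge.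

module EdgeSubdivision where

  open import Defs using (quotient)
  open RationalGeometry
  open Graphs
  open Vectors
  open Realizations
  open SmallNumbers
  open import Data.Bool.Base using (Bool; true; false; _∨_; _∧_; not; T)
  import Data.Bool.Properties as Bool
  open import Data.Fin.Base as Fin using (Fin; zero; suc)
  import Data.Fin.Properties as Fin
  open import Data.Fin.Subset using (Subset)
  open import Data.Nat.Base using (zero; suc)
  open import Data.Product.Base using (_×_; _,_; proj₁; proj₂; ∃-syntax)
  open import Data.Rational.Base as ℚ using (ℚ; 0ℚ; 1ℚ; ½; _+_; _*_; -_; _-_; _<_; _≤_)
  import Data.Rational.Properties as ℚ
  open import Data.Rational.Solver using (module +-*-Solver)
  open import Data.Sum.Base using (_⊎_; inj₁; inj₂)
  open import Data.Vec.Base as Vec using (Vec; _∷_; lookup; _[_]≔_)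
  import Data.Vec.Properties as Vec
  open import Function.Base using (_∘_)
  open import Relation.Binary.PropositionalEquality using (_≡_; _≢_; refl; sym; trans; cong; cong₂; subst; module ≡-Reasoning)
  open import Relation.Nullary using (¬_; yes; no; contradiction)
  open import Relation.Nullary.Decidable using (_×-dec_; ¬?)

  ∧-true : ∀ {a b} → a ∧ b ≡ true → a ≡ true × b ≡ true
  ∧-true {true} {true} _ = refl , refl

  true≢false : ∀ {b} → b ≡ true → b ≡ false → ∀ {A : Set} → A
  true≢false refl ()

  separation-sym : ∀ {n m} {pt : Fin m → Vecℚ n} {i j} → Separation pt i j → Separation pt j i
  separation-sym {pt = pt} {i} {j} s = record
    { weight = weight ; nonNeg = nonNeg ; total<2 = total<2
    ; relation = λ k → trans (ℚ.+-comm (pt j k) (pt i k)) (relation k) }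
    where open Separation s

  0<2 : 0ℚ < 2ℚ
  0<2 = ℚ.positive⁻¹ 2ℚ

  module Subdivision {n m} (G : Graph m) (u v : Fin m) (uv : adj G u v ≡ true) (R : Realization n G) where
    open Realization R
    open +-*-Solver using (solve; _:=_; _:+_; _:*_; :-_; _:-_; con)

    u≢v : u ≢ v
    u≢v refl = true≢false uv (adj-irrefl G u)

    G′ : Graph (suc m)
    G′ = subdivide G u v

    -- The new vertex is κ (u + v), where κ (2 - 2 ε) = 1 for a small ε > 0.
    record Parameter (ε κ : ℚ) : Set where
      field
        0<ε   : 0ℚ < ε
        ε≤½   : ε ≤ ½
        κ-inv : κ * (2ℚ - ε * 2ℚ) ≡ 1ℚ
        0<κ   : 0ℚ < κ

      κ*-<1 : ∀ {x} → x + ε * 2ℚ < 2ℚ → κ * x < 1ℚ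
      κ*-<1 {x} x<2-2ε = ℚ.<-respʳ-≡ κ-inv (ℚ.*-monoʳ-<-pos κ {{ℚ.positive 0<κ}}
        (ℚ.<-respˡ-≡ (solve 2 (λ x y → (x :+ y) :- y := x) refl x (ε * 2ℚ)) (ℚ.+-monoˡ-< (- (ε * 2ℚ)) x<2-2ε)))

      κ≤1 : κ ≤ 1ℚ
      κ≤1 = begin
        κ                    ≡⟨ ℚ.*-identityʳ κ ⟨
        κ * 1ℚ               ≤⟨ ℚ.*-monoˡ-≤-nonNeg κ {{ℚ.nonNegative (ℚ.<⇒≤ 0<κ)}} 1≤2-2ε ⟩
        κ * (2ℚ - ε * 2ℚ)    ≡⟨ κ-inv ⟩
        1ℚ                   ∎
        where
        open ℚ.≤-Reasoning
        1≤2-2ε : 1ℚ ≤ 2ℚ - ε * 2ℚ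
        1≤2-2ε = ℚ.+-monoʳ-≤ 2ℚ (ℚ.neg-antimono-≤ (ℚ.*-monoʳ-≤-nonNeg 2ℚ ε≤½))

    pt′ : ℚ → Fin (suc m) → Vecℚ n
    pt′ κ zero    k = κ * pt u k + κ * pt v k
    pt′ κ (suc i) k = pt i k

    dot-new : ∀ κ c → dot c (pt′ κ zero) ≡ κ * (dot c (pt u) + dot c (pt v))
    dot-new κ c = trans (dot-linearʳ κ κ c (pt u) (pt v)) (sym (ℚ.*-distribˡ-+ κ _ _))

    ≤1 : ∀ {S} (s : Support pt S) i → dot (Support.functional s) (pt i) ≤ 1ℚ
    ≤1 {S} s i with lookup S i in eq
    ... | true  = ℚ.≤-reflexive (Support.on s i eq)
    ... | false = ℚ.<⇒≤ (Support.off s i eq)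

    -- The functional has value less than 2 at u + v because one endpoint lies off the hyperplane.
    -- For small ε the new vertex then stays strictly below 1, and the same hyperplane still works.
    support-old : ∀ S → Support pt S → ¬ (lookup S u ≡ true × lookup S v ≡ true) →
                  Small λ ε → ∀ κ → Parameter ε κ → Support (pt′ κ) (false ∷ S)
    support-old S s not-both = small-map (λ ε _ small κ p → let open Parameter p in record
        { functional = functional
        ; on         = λ { zero () ; (suc i) → on i }
        ; off        = λ { zero _ → ℚ.≤-<-trans (ℚ.≤-reflexive (dot-new κ functional)) (κ*-<1 small) ; (suc i) → off i }
        ; dual       = λ { zero → λ _ → 0ℚ ; (suc i) → dual i }
        ; dual-self  = λ { zero () ; (suc i) → dual-self i }
        ; dual-other = λ { zero _ () ; (suc i) zero _ () ; (suc i) (suc j) p q i≢j → dual-other i j p q (i≢j ∘ cong suc) } })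
      (small-affine 2ℚ <2)
      where
      open Support s
      <2 : dot functional (pt u) + dot functional (pt v) < 2ℚ
      <2 with lookup S u in eqᵤ | lookup S v in eqᵥ
      ... | true  | true  = contradiction (refl , refl) not-both
      ... | false | _     = ℚ.+-mono-<-≤ (off u eqᵤ) (≤1 s v)
      ... | true  | false = ℚ.+-mono-≤-< (≤1 s u) (off v eqᵥ)

    -- g tilts a supporting hyperplane at S off the vertices in S ∖ T.
    support-new : ∀ S T (s : Support pt S) (g : Vecℚ n) →
      (∀ i → lookup T i ≡ true → lookup S i ≡ true) → lookup S u ≡ true → lookup S v ≡ true →
      dot g (pt u) + dot g (pt v) ≡ 2ℚ →
      (∀ i → lookup T i ≡ true → dot g (pt i) ≡ 0ℚ) →
      (∀ i → lookup S i ≡ true → lookup T i ≡ false → 0ℚ < dot g (pt i)) →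
      Small λ ε → ∀ κ → Parameter ε κ → Support (pt′ κ) (true ∷ T)
    support-new S T s g T⊆S Su Sv g-uv g-T g-S∖T = small-map (λ ε _ small κ p → let open Parameter p in record
        { functional = c ε
        ; on  = λ where
            zero    _  → trans (dot-new κ (c ε)) (trans (cong (κ *_) (begin
                dot (c ε) (pt u) + dot (c ε) (pt v)
                  ≡⟨ cong₂ _+_ (c-dot ε u) (c-dot ε v) ⟩
                (dot functional (pt u) + ε * - dot g (pt u)) + (dot functional (pt v) + ε * - dot g (pt v))
                  ≡⟨ cong₂ (λ x y → (x + ε * - dot g (pt u)) + (y + ε * - dot g (pt v))) (on u Su) (on v Sv) ⟩
                (1ℚ + ε * - dot g (pt u)) + (1ℚ + ε * - dot g (pt v))
                  ≡⟨ solve 3 (λ e a b → (con 1ℚ :+ e :* (:- a)) :+ (con 1ℚ :+ e :* (:- b)) := con 2ℚ :- e :* (a :+ b)) refl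
                       ε (dot g (pt u)) (dot g (pt v)) ⟩
                2ℚ - ε * (dot g (pt u) + dot g (pt v))
                  ≡⟨ cong (λ x → 2ℚ - ε * x) g-uv ⟩
                2ℚ - ε * 2ℚ ∎)) κ-inv)
            (suc i) Ti → trans (c-dot ε i) (trans (cong₂ (λ x y → x + ε * - y) (on i (T⊆S i Ti)) (g-T i Ti))
                           (solve 1 (λ e → con 1ℚ :+ e :* (:- con 0ℚ) := con 1ℚ) refl ε))
        ; off = λ { zero () ; (suc i) Ti → ℚ.≤-<-trans (ℚ.≤-reflexive (c-dot ε i)) (small i Ti) }
        ; dual = dual′ ε
        ; dual-self = λ where
            zero    _  → trans (dot-linearˡ 1ℚ (- ε) g g (pt′ κ zero)) (trans
                (cong (λ x → 1ℚ * x + - ε * x) (trans (dot-new κ g) (cong (κ *_) g-uv)))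
                (trans (solve 2 (λ k e → con 1ℚ :* (k :* con 2ℚ) :+ (:- e) :* (k :* con 2ℚ) := k :* (con 2ℚ :- e :* con 2ℚ)) refl κ ε) κ-inv))
            (suc i) Ti → trans (dual′-dot ε i i) (trans (cong₂ (λ x y → x + shift i * y) (dual-self i (T⊆S i Ti)) (g-T i Ti))
                           (solve 1 (λ e → con 1ℚ :+ e :* con 0ℚ := con 1ℚ) refl (shift i)))
        ; dual-other = λ where
            zero    zero    _  _  ne → contradiction refl ne
            zero    (suc j) _  Tj _  → trans (dot-linearˡ 1ℚ (- ε) g g (pt j)) (trans
                (cong (λ x → 1ℚ * x + - ε * x) (g-T j Tj)) (solve 1 (λ e → con 1ℚ :* con 0ℚ :+ (:- e) :* con 0ℚ := con 0ℚ) refl ε))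
            (suc i) zero    Ti _  _  → trans (dot-new κ (dual′ ε (suc i))) (trans
                (cong (κ *_) (trans (cong₂ _+_ (dual′-dot ε i u) (dual′-dot ε i v)) (begin
                  (a i + shift i * dot g (pt u)) + (b i + shift i * dot g (pt v))
                    ≡⟨ solve 5 (λ a b s x y → (a :+ s :* x) :+ (b :+ s :* y) := (a :+ b) :+ s :* (x :+ y)) refl
                         (a i) (b i) (shift i) (dot g (pt u)) (dot g (pt v)) ⟩
                  (a i + b i) + shift i * (dot g (pt u) + dot g (pt v))
                    ≡⟨ cong (λ x → (a i + b i) + shift i * x) g-uv ⟩
                  (a i + b i) + shift i * 2ℚ
                    ≡⟨ solve 1 (λ s → s :+ (:- (con ½ :* s)) :* con 2ℚ := con 0ℚ) refl (a i + b i) ⟩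
                  0ℚ ∎))) (ℚ.*-zeroʳ κ))
            (suc i) (suc j) Ti Tj ne → trans (dual′-dot ε i j) (trans
                (cong₂ (λ x y → x + shift i * y) (dual-other i j (T⊆S i Ti) (T⊆S j Tj) (ne ∘ cong suc)) (g-T j Tj))
                (solve 1 (λ e → con 0ℚ :+ e :* con 0ℚ := con 0ℚ) refl (shift i))) })
      (small-Fin λ i → small-dec (lookup T i Bool.≟ false) (λ Ti → tilted i Ti))
      where
      open Support s
      open ≡-Reasoning
      c : ℚ → Vecℚ n
      c ε k = 1ℚ * functional k + - ε * g k
      c-dot : ∀ ε i → dot (c ε) (pt i) ≡ dot functional (pt i) + ε * - dot g (pt i)
      c-dot ε i = trans (dot-linearˡ 1ℚ (- ε) functional g (pt i))
        (solve 3 (λ x e y → con 1ℚ :* x :+ (:- e) :* y := x :+ e :* (:- y)) refl (dot functional (pt i)) ε (dot g (pt i)))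
      a b shift : Fin m → ℚ
      a i = dot (dual i) (pt u)
      b i = dot (dual i) (pt v)
      shift i = - (½ * (a i + b i))
      -- At the new vertex (1 - ε) g has value κ (2 - 2 ε) = 1, and g vanishes on T. Adding a
      -- multiple of g to an old dual vector keeps its values on T; `shift` is the multiple that
      -- makes it vanish at u + v.
      dual′ : ℚ → Fin (suc m) → Vecℚ n
      dual′ ε zero    k = 1ℚ * g k + - ε * g k
      dual′ ε (suc i) k = 1ℚ * dual i k + shift i * g k
      dual′-dot : ∀ ε i j → dot (dual′ ε (suc i)) (pt j) ≡ dot (dual i) (pt j) + shift i * dot g (pt j)
      dual′-dot ε i j = trans (dot-linearˡ 1ℚ (shift i) (dual i) g (pt j))
        (cong (_+ shift i * dot g (pt j)) (ℚ.*-identityˡ (dot (dual i) (pt j))))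
      tilted : ∀ i → lookup T i ≡ false → Small λ ε → dot functional (pt i) + ε * - dot g (pt i) < 1ℚ
      tilted i Ti with lookup S i in eq
      ... | false = small-affine (- dot g (pt i)) (off i eq)
      ... | true  = small-always λ ε 0<ε →
        ℚ.≤-<-trans (ℚ.≤-reflexive (cong (_+ ε * - dot g (pt i)) (on i eq)))
          (ℚ.<-≤-trans (ℚ.+-monoʳ-< 1ℚ (ℚ.*-monoʳ-<-pos ε {{ℚ.positive 0<ε}} (ℚ.neg-antimono-< (g-S∖T i eq Ti))))
            (ℚ.≤-reflexive (solve 1 (λ e → con 1ℚ :+ e :* (:- con 0ℚ) := con 1ℚ) refl ε)))

    -- A clique without the new vertex misses u or v, whose edge is gone, and keeps its hyperplane.
    -- A clique with it is the new vertex plus some T containing at most one of u and v; then T ∪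
    -- {u, v} is a clique of G, whose hyperplane is tilted off those of u and v that are not in T.
    support′ : ∀ S → Small λ ε → Clique G′ S → ∀ κ → Parameter ε κ → Support (pt′ κ) S
    support′ (false ∷ S) = small-dec (clique? G′ (false ∷ S)) λ cl →
      support-old S (supports S λ i j p q i≢j → proj₁ (∧-true (cl (suc i) (suc j) p q (i≢j ∘ Fin.suc-injective))))
        λ (p , q) → true≢false (proj₂ (∧-true {adj G u v} (cl (suc u) (suc v) p q (u≢v ∘ Fin.suc-injective))))
          (cong not (cong₂ (λ a b → (a ∧ b) ∨ ((u == v) ∧ (v == u))) (==-refl u) (==-refl v)))
    support′ (true ∷ T) = small-dec (clique? G′ (true ∷ T)) go
      where
      S : Subset m
      S = (T [ u ]≔ true) [ v ]≔ true
      Sv : lookup S v ≡ true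
      Sv = Vec.lookup∘update v (T [ u ]≔ true) true
      Su : lookup S u ≡ true
      Su = trans (Vec.lookup∘update′ u≢v (T [ u ]≔ true) true) (Vec.lookup∘update u T true)
      S-other : ∀ {i} → i ≢ u → i ≢ v → lookup S i ≡ lookup T i
      S-other i≢u i≢v = trans (Vec.lookup∘update′ i≢v (T [ u ]≔ true) true) (Vec.lookup∘update′ i≢u T true)
      T⊆S : ∀ i → lookup T i ≡ true → lookup S i ≡ true
      T⊆S i Ti with i Fin.≟ u | i Fin.≟ v
      ... | yes refl | _        = Su
      ... | no _     | yes refl = Sv
      ... | no i≢u   | no i≢v   = trans (S-other i≢u i≢v) Ti
      S∖T : ∀ i → lookup S i ≡ true → lookup T i ≡ false → i ≡ u ⊎ i ≡ v
      S∖T i Si Ti with i Fin.≟ u | i Fin.≟ v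
      ... | yes i≡u | _       = inj₁ i≡u
      ... | no _    | yes i≡v = inj₂ i≡v
      ... | no i≢u  | no i≢v  = true≢false (trans (sym (S-other i≢u i≢v)) Si) Ti
      go : Clique G′ (true ∷ T) → Small λ ε → ∀ κ → Parameter ε κ → Support (pt′ κ) (true ∷ T)
      go cl = by-cases (lookup T u) refl (lookup T v) refl
        where
        link : ∀ {i} → lookup S i ≡ true → i ≢ u → i ≢ v → adj G u i ≡ true × adj G v i ≡ true
        link {i} Si i≢u i≢v = ∧-true (subst (_≡ true)
          (cong₂ (λ x y → x ∨ (y ∨ (adj G u i ∧ adj G v i))) (==-≢ i≢u) (==-≢ i≢v))
          (cl zero (suc i) refl (trans (sym (S-other i≢u i≢v)) Si) λ ()))
        S-clique : Clique G S
        S-clique i j Si Sj i≢j with i Fin.≟ u | i Fin.≟ v | j Fin.≟ u | j Fin.≟ v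
        ... | yes refl | _        | yes refl | _        = contradiction refl i≢j
        ... | yes refl | _        | no _     | yes refl = uv
        ... | yes refl | _        | no j≢u   | no j≢v   = proj₁ (link Sj j≢u j≢v)
        ... | no _     | yes refl | yes refl | _        = trans (adj-sym G v u) uv
        ... | no _     | yes refl | no _     | yes refl = contradiction refl i≢j
        ... | no _     | yes refl | no j≢u   | no j≢v   = proj₂ (link Sj j≢u j≢v)
        ... | no i≢u   | no i≢v   | yes refl | _        = trans (adj-sym G i u) (proj₁ (link Si i≢u i≢v))
        ... | no i≢u   | no i≢v   | no _     | yes refl = trans (adj-sym G i v) (proj₂ (link Si i≢u i≢v))
        ... | no i≢u   | no i≢v   | no j≢u   | no j≢v   = proj₁ (∧-true (cl (suc i) (suc j)
                (trans (sym (S-other i≢u i≢v)) Si) (trans (sym (S-other j≢u j≢v)) Sj) (i≢j ∘ Fin.suc-injective)))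
        s : Support pt S
        s = supports S S-clique
        open Support s
        d : Fin m → Fin m → ℚ
        d i j = dot (dual i) (pt j)
        v≢u : v ≢ u
        v≢u = u≢v ∘ sym
        combine : ∀ a b i → dot (λ k → a * dual u k + b * dual v k) (pt i) ≡ a * d u i + b * d v i
        combine a b i = dot-linearˡ a b (dual u) (dual v) (pt i)
        tilt : (a b : ℚ) → a + b ≡ 2ℚ →
               (lookup T u ≡ true → a ≡ 0ℚ) → (lookup T v ≡ true → b ≡ 0ℚ) →
               (lookup T u ≡ false → 0ℚ < a) → (lookup T v ≡ false → 0ℚ < b) →
               Small λ ε → ∀ κ → Parameter ε κ → Support (pt′ κ) (true ∷ T)
        tilt a b a+b a₀ b₀ a₊ b₊ = support-new S T s (λ k → a * dual u k + b * dual v k) T⊆S Su Sv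
          (trans (cong₂ _+_ at-u at-v) a+b)
          (λ i Ti → zeros i Ti)
          λ i Si Ti → positives i Ti (S∖T i Si Ti)
          where
          at-u : dot (λ k → a * dual u k + b * dual v k) (pt u) ≡ a
          at-u = trans (combine a b u) (trans (cong₂ (λ x y → a * x + b * y) (dual-self u Su) (dual-other v u Sv Su v≢u))
            (solve 2 (λ a b → a :* con 1ℚ :+ b :* con 0ℚ := a) refl a b))
          at-v : dot (λ k → a * dual u k + b * dual v k) (pt v) ≡ b
          at-v = trans (combine a b v) (trans (cong₂ (λ x y → a * x + b * y) (dual-other u v Su Sv u≢v) (dual-self v Sv))
            (solve 2 (λ a b → a :* con 0ℚ :+ b :* con 1ℚ := b) refl a b))
          zeros : ∀ i → lookup T i ≡ true → dot (λ k → a * dual u k + b * dual v k) (pt i) ≡ 0ℚ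
          zeros i Ti with i Fin.≟ u | i Fin.≟ v
          ... | yes refl | _        = trans at-u (a₀ Ti)
          ... | no _     | yes refl = trans at-v (b₀ Ti)
          ... | no i≢u   | no i≢v   = trans (combine a b i)
            (trans (cong₂ (λ x y → a * x + b * y) (dual-other u i Su (T⊆S i Ti) (i≢u ∘ sym)) (dual-other v i Sv (T⊆S i Ti) (i≢v ∘ sym)))
              (solve 2 (λ a b → a :* con 0ℚ :+ b :* con 0ℚ := con 0ℚ) refl a b))
          positives : ∀ i → lookup T i ≡ false → i ≡ u ⊎ i ≡ v → 0ℚ < dot (λ k → a * dual u k + b * dual v k) (pt i)
          positives i Ti (inj₁ refl) = ℚ.<-respʳ-≡ (sym at-u) (a₊ Ti)
          positives i Ti (inj₂ refl) = ℚ.<-respʳ-≡ (sym at-v) (b₊ Ti)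
        by-cases : ∀ x → lookup T u ≡ x → ∀ y → lookup T v ≡ y →
                   Small λ ε → ∀ κ → Parameter ε κ → Support (pt′ κ) (true ∷ T)
        by-cases true  Tu true  Tv = true≢false (proj₂ (∧-true {adj G u v} (cl (suc u) (suc v) Tu Tv (u≢v ∘ Fin.suc-injective))))
          (cong not (cong₂ (λ a b → (a ∧ b) ∨ ((u == v) ∧ (v == u))) (==-refl u) (==-refl v)))
        -- The tilt needs value 0 at an endpoint that stays in the face, a positive value at one
        -- that leaves, and sum 2.
        by-cases true  Tu false Tv = tilt 0ℚ 2ℚ refl (λ _ → refl) (λ q → true≢false q Tv) (λ q → true≢false Tu q) (λ _ → 0<2)
        by-cases false Tu true  Tv = tilt 2ℚ 0ℚ refl (λ q → true≢false q Tu) (λ _ → refl) (λ _ → 0<2) (λ q → true≢false Tv q)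
        by-cases false Tu false Tv = tilt 1ℚ 1ℚ refl (λ q → true≢false q Tu) (λ q → true≢false q Tv) (λ _ → ℚ.positive⁻¹ 1ℚ) (λ _ → ℚ.positive⁻¹ 1ℚ)

    record Slack (ε : ℚ) (i j : Fin m) : Set where
      field
        separation : Separation pt i j
        slack      : sum (Separation.weight separation) + ε * 2ℚ < 2ℚ

    slack′ : ∀ i j → Small λ ε → i ≢ j × adj G i j ≡ false → Slack ε i j
    slack′ i j = small-dec (¬? (i Fin.≟ j) ×-dec (adj G i j Bool.≟ false)) λ (i≢j , nij) →
      small-map (λ ε _ s → record { separation = separate i j i≢j nij ; slack = s })
        (small-affine 2ℚ (Separation.total<2 (separate i j i≢j nij)))

    module _ {ε κ} (p : Parameter ε κ) (slacks : ∀ i j → i ≢ j × adj G i j ≡ false → Slack ε i j) where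
      open Parameter p

      _▸_ : ℚ → Vecℚ m → Vecℚ (suc m)
      (x ▸ f) zero    = x
      (x ▸ f) (suc i) = f i

      -- With {x, y} = {u, v} and z not adjacent to x, the sum κ (x + y) + z equals κ (z + x) + κ y
      -- + (1 - κ) z. Replacing z + x by its relation gives total weight κ w + 1, and the slack
      -- makes κ w < 1.
      separate-new : ∀ x y z → (∀ k → pt x k + pt y k ≡ pt u k + pt v k) → Slack ε z x → Separation (pt′ κ) zero (suc z)
      separate-new x y z xy sl = record
        { weight   = W
        ; nonNeg   = λ where
            zero    → ℚ.≤-refl
            (suc l) → +≥0 (*≥0 (ℚ.<⇒≤ 0<κ) (nonNeg l)) (*≥0 (ℚ.nonNegative⁻¹ 1ℚ)
                        (+≥0 (*≥0 (ℚ.<⇒≤ 0<κ) (unit-nonNeg y l)) (*≥0 0≤1-κ (unit-nonNeg z l))))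
        ; total<2  = total<2′
        ; relation = λ k → sym (relation′ k) }
        where
        open Separation (Slack.separation sl)
        W : Vecℚ (suc m)
        W = 0ℚ ▸ λ l → κ * weight l + 1ℚ * (κ * unit y l + (1ℚ - κ) * unit z l)
        total<2′ : sum W < 2ℚ
        total<2′ = begin-strict
            0ℚ + sum (λ l → κ * weight l + 1ℚ * (κ * unit y l + (1ℚ - κ) * unit z l))
              ≡⟨ cong (0ℚ +_) (trans (sum-linear κ 1ℚ weight (λ l → κ * unit y l + (1ℚ - κ) * unit z l))
                   (cong (λ s → κ * sum weight + 1ℚ * s) (trans (sum-linear κ (1ℚ - κ) (unit y) (unit z))
                     (cong₂ (λ a b → κ * a + (1ℚ - κ) * b) (total-unit y) (total-unit z))))) ⟩
            0ℚ + (κ * sum weight + 1ℚ * (κ * 1ℚ + (1ℚ - κ) * 1ℚ))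
              ≡⟨ solve 2 (λ k s → con 0ℚ :+ (k :* s :+ con 1ℚ :* (k :* con 1ℚ :+ (con 1ℚ :- k) :* con 1ℚ)) := k :* s :+ con 1ℚ)
                   refl κ (sum weight) ⟩
            κ * sum weight + 1ℚ
              <⟨ ℚ.+-monoˡ-< 1ℚ (κ*-<1 (Slack.slack sl)) ⟩
            2ℚ ∎
          where open ℚ.≤-Reasoning
        relation′ : ∀ k → sum (λ l → W l * pt′ κ l k) ≡ pt′ κ zero k + pt z k
        relation′ k = begin
            0ℚ * (κ * pt u k + κ * pt v k) + sum (λ l → (κ * weight l + 1ℚ * (κ * unit y l + (1ℚ - κ) * unit z l)) * pt l k)
              ≡⟨ cong (0ℚ * (κ * pt u k + κ * pt v k) +_) (trans
                   (dot-linearˡ κ 1ℚ weight (λ l → κ * unit y l + (1ℚ - κ) * unit z l) (λ l → pt l k))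
                   (cong₂ (λ a b → κ * a + 1ℚ * b) (sym (relation k)) (trans
                     (dot-linearˡ κ (1ℚ - κ) (unit y) (unit z) (λ l → pt l k))
                     (cong₂ (λ a b → κ * a + (1ℚ - κ) * b) (sum-unit y (λ l → pt l k)) (sum-unit z (λ l → pt l k)))))) ⟩
            0ℚ * (κ * pt u k + κ * pt v k) + (κ * (pt z k + pt x k) + 1ℚ * (κ * pt y k + (1ℚ - κ) * pt z k))
              ≡⟨ solve 5 (λ c w x y z → con 0ℚ :* w :+ (c :* (z :+ x) :+ con 1ℚ :* (c :* y :+ (con 1ℚ :- c) :* z)) := c :* (x :+ y) :+ z)
                   refl κ (κ * pt u k + κ * pt v k) (pt x k) (pt y k) (pt z k) ⟩
            κ * (pt x k + pt y k) + pt z k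
              ≡⟨ cong (λ s → κ * s + pt z k) (xy k) ⟩
            κ * (pt u k + pt v k) + pt z k
              ≡⟨ cong (_+ pt z k) (ℚ.*-distribˡ-+ κ (pt u k) (pt v k)) ⟩
            κ * pt u k + κ * pt v k + pt z k ∎
          where open ≡-Reasoning
        +≥0 : ∀ {a b} → 0ℚ ≤ a → 0ℚ ≤ b → 0ℚ ≤ a + b
        +≥0 = ℚ.+-mono-≤
        *≥0 : ∀ {a b} → 0ℚ ≤ a → 0ℚ ≤ b → 0ℚ ≤ a * b
        *≥0 {a} {b} 0≤a 0≤b = ℚ.≤-trans (ℚ.≤-reflexive (sym (ℚ.*-zeroʳ a))) (ℚ.*-monoˡ-≤-nonNeg a {{ℚ.nonNegative 0≤a}} 0≤b)
        0≤1-κ : 0ℚ ≤ 1ℚ - κ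
        0≤1-κ = ℚ.≤-trans (ℚ.≤-reflexive (sym (ℚ.+-inverseʳ κ))) (ℚ.+-monoˡ-≤ (- κ) κ≤1)

      separate-star : ∀ z → star G u v z ≡ false → Separation (pt′ κ) zero (suc z)
      separate-star z eq with z Fin.≟ u | z Fin.≟ v | adj G u z in uz | adj G v z in vz
      ... | no z≢u | no z≢v | false | _     = separate-new u v z (λ _ → refl) (slacks z u (z≢u , trans (adj-sym G z u) uz))
      ... | no z≢u | no z≢v | true  | false = separate-new v u z (λ k → ℚ.+-comm (pt v k) (pt u k)) (slacks z v (z≢v , trans (adj-sym G z v) vz))

      -- The sum u + v is 2 - 2 ε times the new vertex.
      separate-edge : Separation (pt′ κ) (suc u) (suc v)
      separate-edge = record
        { weight   = W
        ; nonNeg   = λ { zero → ℚ.≤-trans (ℚ.nonNegative⁻¹ 1ℚ) (ℚ.+-monoʳ-≤ 2ℚ (ℚ.neg-antimono-≤ (ℚ.*-monoʳ-≤-nonNeg 2ℚ ε≤½))) ; (suc l) → ℚ.≤-refl }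
        ; total<2  = total<2′
        ; relation = λ k → sym (relation′ k) }
        where
        W : Vecℚ (suc m)
        W = (2ℚ - ε * 2ℚ) ▸ λ _ → 0ℚ
        total<2′ : sum W < 2ℚ
        total<2′ = begin-strict
            (2ℚ - ε * 2ℚ) + sum {m} (λ _ → 0ℚ)  ≡⟨ cong ((2ℚ - ε * 2ℚ) +_) (sum-zero m {λ _ → 0ℚ} λ _ → refl) ⟩
            (2ℚ - ε * 2ℚ) + 0ℚ                  ≡⟨ ℚ.+-identityʳ _ ⟩
            2ℚ - ε * 2ℚ                         <⟨ ℚ.+-monoʳ-< 2ℚ (ℚ.neg-antimono-< (ℚ.*-monoˡ-<-pos 2ℚ 0<ε)) ⟩
            2ℚ - 0ℚ * 2ℚ                        ≡⟨ refl ⟩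
            2ℚ                                  ∎
          where open ℚ.≤-Reasoning
        relation′ : ∀ k → sum (λ l → W l * pt′ κ l k) ≡ pt u k + pt v k
        relation′ k = begin
            (2ℚ - ε * 2ℚ) * (κ * pt u k + κ * pt v k) + sum (λ l → 0ℚ * pt l k)
              ≡⟨ cong ((2ℚ - ε * 2ℚ) * (κ * pt u k + κ * pt v k) +_) (sum-zero m λ l → ℚ.*-zeroˡ (pt l k)) ⟩
            (2ℚ - ε * 2ℚ) * (κ * pt u k + κ * pt v k) + 0ℚ
              ≡⟨ solve 4 (λ c e u v → c :* (e :* u :+ e :* v) :+ con 0ℚ := (e :* c) :* (u :+ v)) refl (2ℚ - ε * 2ℚ) κ (pt u k) (pt v k) ⟩
            κ * (2ℚ - ε * 2ℚ) * (pt u k + pt v k)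
              ≡⟨ cong (_* (pt u k + pt v k)) κ-inv ⟩
            1ℚ * (pt u k + pt v k)
              ≡⟨ ℚ.*-identityˡ _ ⟩
            pt u k + pt v k ∎
          where open ≡-Reasoning

      separate′ : ∀ i j → i ≢ j → adj G′ i j ≡ false → Separation (pt′ κ) i j
      separate′ zero    zero    i≢j _  = contradiction refl i≢j
      separate′ zero    (suc j) _   eq = separate-star j eq
      separate′ (suc i) zero    _   eq = separation-sym (separate-star i eq)
      separate′ (suc i) (suc j) i≢j eq with adj G i j in ij
      ... | false = record
        { weight   = 0ℚ ▸ weight
        ; nonNeg   = λ { zero → ℚ.≤-refl ; (suc l) → nonNeg l }
        ; total<2  = ℚ.<-respˡ-≡ (sym (ℚ.+-identityˡ _)) total<2
        ; relation = λ k → trans (relation k) (sym (trans (cong (_+ sum (λ l → weight l * pt l k)) (ℚ.*-zeroˡ (pt′ κ zero k))) (ℚ.+-identityˡ _))) }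
        where open Separation (Slack.separation (slacks i j (i≢j ∘ cong suc , ij)))
      ... | true with i Fin.≟ u | i Fin.≟ v | j Fin.≟ u | j Fin.≟ v
      ...   | yes refl | _        | _        | yes refl = separate-edge
      ...   | yes refl | yes u≡v  | _        | _        = contradiction u≡v u≢v
      ...   | no _     | yes refl | yes refl | _        = separation-sym separate-edge

    private
      parameter : ∀ ε₀ → 0ℚ < ε₀ → ∃[ ε ] ∃[ κ ] Parameter ε κ × ε ≤ ε₀
      parameter ε₀ 0<ε₀ = ε , proj₁ inverse
        , record { 0<ε = 0<ε ; ε≤½ = ε≤½ ; κ-inv = proj₂ (proj₂ inverse) ; 0<κ = proj₁ (proj₂ inverse) }
        , ℚ.p⊓q≤p ε₀ ½
        where
        ε : ℚ
        -- For ε at most ½ the factor 2 - 2 ε is at least 1, so κ exists and 1 - κ, a weight in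
        -- `separate-new`, is nonnegative.
        ε = ε₀ ℚ.⊓ ½
        ε≤½ : ε ≤ ½
        ε≤½ = ℚ.p⊓q≤q ε₀ ½
        0<ε : 0ℚ < ε
        0<ε with ℚ.⊓-sel ε₀ ½
        ... | inj₁ eq = ℚ.<-respʳ-≡ (sym eq) 0<ε₀
        ... | inj₂ eq = ℚ.<-respʳ-≡ (sym eq) (ℚ.positive⁻¹ ½)
        1≤2-2ε : 1ℚ ≤ 2ℚ - ε * 2ℚ
        1≤2-2ε = ℚ.+-monoʳ-≤ 2ℚ (ℚ.neg-antimono-≤ (ℚ.*-monoʳ-≤-nonNeg 2ℚ ε≤½))
        inverse : ∃[ κ ] 0ℚ < κ × κ * (2ℚ - ε * 2ℚ) ≡ 1ℚ
        inverse = quotient 1ℚ (2ℚ - ε * 2ℚ) (ℚ.positive⁻¹ 1ℚ) (ℚ.<-≤-trans (ℚ.positive⁻¹ 1ℚ) 1≤2-2ε)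

      assemble : ∀ {ε κ} → Parameter ε κ →
                 (∀ S → Clique G′ S → ∀ κ → Parameter ε κ → Support (pt′ κ) S) ×
                 (∀ i j → i ≢ j × adj G i j ≡ false → Slack ε i j) → Realization n G′
      assemble {κ = κ} p (supports′ , slacks) = record
        { pt       = pt′ κ
        ; supports = λ S cl → supports′ S cl κ p
        ; separate = separate′ p slacks
        ; axis⁺    = λ k → suc (proj₁ (axis⁺ k)) , proj₂ (axis⁺ k)
        ; axis⁻    = λ k → suc (proj₁ (axis⁻ k)) , proj₂ (axis⁻ k) }

      small-parameter : ∀ {P : ℚ → Set} → Small P → ∃[ ε ] ∃[ κ ] Parameter ε κ × P ε
      small-parameter (ε₀ , 0<ε₀ , good) =
        let ε , κ , p , ε≤ε₀ = parameter ε₀ 0<ε₀ in ε , κ , p , good ε (Parameter.0<ε p) ε≤ε₀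

    abstract
      realization : Realization n G′
      realization =
        let ε , κ , p , conditions = small-parameter (small-× (small-Subset support′) (small-Fin λ i → small-Fin (slack′ i)))
        in assemble p conditions

-- Realizing suspensions as bipyramids.

module Suspensions where

  open RationalGeometry
  open EdgeSubdivision
  open Graphs
  open Vectors
  open Realizations
  open import Data.Bool.Base using (Bool; true; false)
  open import Data.Fin.Base as Fin using (Fin; zero; suc)
  import Data.Fin.Properties as Fin
  open import Data.Nat.Base as ℕ using (ℕ; zero; suc)
  open import Data.Product.Base using (_×_; _,_; proj₁; proj₂)
  open import Data.Rational.Base as ℚ using (ℚ; 0ℚ; 1ℚ; _+_; _*_; -_; _-_; _<_)
  import Data.Rational.Properties as ℚ
  open import Data.Vec.Base using (_∷_)
  open import Function.Base using (_∘_)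
  open import Relation.Binary.PropositionalEquality using (_≡_; _≢_; refl; sym; trans; cong; cong₂)
  open import Relation.Nullary using (¬_; contradiction)

  module Suspension {n m} (G : Graph m) (R : Realization n G) where
    open Realization R

    G′ : Graph (2 ℕ.+ m)
    G′ = suspend G

    _▹_ : ℚ → Vecℚ n → Vecℚ (suc n)
    (x ▹ p) zero    = x
    (x ▹ p) (suc k) = p k

    0ⱽ : ∀ {n} → Vecℚ n
    0ⱽ _ = 0ℚ

    pt′ : Fin (2 ℕ.+ m) → Vecℚ (suc n)
    pt′ zero          = 1ℚ ▹ 0ⱽ
    pt′ (suc zero)    = (- 1ℚ) ▹ 0ⱽ
    pt′ (suc (suc i)) = 0ℚ ▹ pt i

    dot-pole : ∀ x c y → dot (x ▹ c) (y ▹ 0ⱽ) ≡ x * y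
    dot-pole x c y = trans (cong (x * y +_) (sum-zero n λ k → ℚ.*-zeroʳ (c k))) (ℚ.+-identityʳ _)

    dot-equator : ∀ x c p → dot (x ▹ c) (0ℚ ▹ p) ≡ dot c p
    dot-equator x c p = trans (cong (_+ dot c p) (ℚ.*-zeroʳ x)) (ℚ.+-identityˡ _)

    dot-unit : ∀ x p → dot (x ▹ 0ⱽ) (0ℚ ▹ p) ≡ 0ℚ
    dot-unit x p = trans (dot-equator x 0ⱽ p) (sum-zero n λ k → ℚ.*-zeroˡ (p k))

    -1<0 : - 1ℚ < 0ℚ
    -1<0 = ℚ.negative⁻¹ (- 1ℚ)

    0<1 : 0ℚ < 1ℚ
    0<1 = ℚ.positive⁻¹ 1ℚ

    support′ : ∀ S → Clique G′ S → Support pt′ S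
    support′ (a ∷ b ∷ S) cl = record
      { functional = height a b ▹ functional
      ; on = λ where
          zero          p → trans (dot-pole (height a b) functional 1ℚ) (north p)
          (suc zero)    p → trans (dot-pole (height a b) functional (- 1ℚ)) (south (not-both a b refl refl) p)
          (suc (suc i)) p → trans (dot-equator (height a b) functional (pt i)) (on i p)
      ; off = λ where
          zero          p → ℚ.≤-<-trans (ℚ.≤-reflexive (dot-pole (height a b) functional 1ℚ)) (north< b p)
          (suc zero)    p → ℚ.≤-<-trans (ℚ.≤-reflexive (dot-pole (height a b) functional (- 1ℚ))) (south< a p)
          (suc (suc i)) p → ℚ.≤-<-trans (ℚ.≤-reflexive (dot-equator (height a b) functional (pt i))) (off i p)
      ; dual = λ where
          zero          → 1ℚ ▹ 0ⱽ
          (suc zero)    → (- 1ℚ) ▹ 0ⱽ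
          (suc (suc i)) → 0ℚ ▹ dual i
      ; dual-self = λ where
          zero          p → dot-pole 1ℚ 0ⱽ 1ℚ
          (suc zero)    p → dot-pole (- 1ℚ) 0ⱽ (- 1ℚ)
          (suc (suc i)) p → trans (dot-equator 0ℚ (dual i) (pt i)) (dual-self i p)
      ; dual-other = λ where
          zero          zero          p q ne → contradiction refl ne
          zero          (suc zero)    p q ne → contradiction (p , q) (not-both a b refl refl)
          zero          (suc (suc j)) p q ne → dot-unit 1ℚ (pt j)
          (suc zero)    zero          p q ne → contradiction (q , p) (not-both a b refl refl)
          (suc zero)    (suc zero)    p q ne → contradiction refl ne
          (suc zero)    (suc (suc j)) p q ne → dot-unit (- 1ℚ) (pt j)
          (suc (suc i)) zero          p q ne → dot-pole 0ℚ (dual i) 1ℚ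
          (suc (suc i)) (suc zero)    p q ne → dot-pole 0ℚ (dual i) (- 1ℚ)
          (suc (suc i)) (suc (suc j)) p q ne → trans (dot-equator 0ℚ (dual i) (pt j)) (dual-other i j p q (ne ∘ cong (λ k → Fin.suc (Fin.suc k)))) }
      where
      open Support (supports S λ i j p q i≢j → cl (suc (suc i)) (suc (suc j)) p q (i≢j ∘ Fin.suc-injective ∘ Fin.suc-injective))
      -- The coordinate of the functional along the new axis: 1 or - 1 puts the corresponding pole
      -- on the hyperplane, and 0 keeps both strictly below it.
      height : Bool → Bool → ℚ
      height true  _     = 1ℚ
      height false true  = - 1ℚ
      height false false = 0ℚ
      not-both : ∀ a′ b′ → a ≡ a′ → b ≡ b′ → ¬ (a′ ≡ true × b′ ≡ true)
      not-both _ _ refl refl (p , q) = true≢false (cl zero (suc zero) p q λ ()) refl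
      north : ∀ {a b} → a ≡ true → height a b * 1ℚ ≡ 1ℚ
      north refl = refl
      south : ∀ {a b} → ¬ (a ≡ true × b ≡ true) → b ≡ true → height a b * - 1ℚ ≡ 1ℚ
      south {true}  ¬both refl = contradiction (refl , refl) ¬both
      south {false} ¬both refl = refl
      north< : ∀ {a} b → a ≡ false → height a b * 1ℚ < 1ℚ
      north< true  refl = ℚ.<-trans -1<0 0<1
      north< false refl = 0<1
      south< : ∀ a {b} → b ≡ false → height a b * - 1ℚ < 1ℚ
      south< true  refl = ℚ.<-trans -1<0 0<1
      south< false refl = 0<1

    -- The poles are opposite, so their sum is the combination with all weights zero.
    separate-poles : Separation pt′ zero (suc zero)
    separate-poles = record
      { weight   = 0ⱽ
      ; nonNeg   = λ _ → ℚ.≤-refl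
      ; total<2  = ℚ.≤-<-trans (ℚ.≤-reflexive (sum-zero (2 ℕ.+ m) {0ⱽ} λ _ → refl)) 0<2
      ; relation = λ k → trans (opposite k) (sym (sum-zero (2 ℕ.+ m) λ l → ℚ.*-zeroˡ (pt′ l k))) }
      where
      opposite : ∀ k → pt′ zero k + pt′ (suc zero) k ≡ 0ℚ
      opposite zero    = refl
      opposite (suc k) = refl

    separate′ : ∀ i j → i ≢ j → adj G′ i j ≡ false → Separation pt′ i j
    separate′ zero          zero          ne _  = contradiction refl ne
    separate′ zero          (suc zero)    _  _  = separate-poles
    separate′ (suc zero)    zero          _  _  = separation-sym separate-poles
    separate′ (suc zero)    (suc zero)    ne _  = contradiction refl ne
    separate′ (suc (suc i)) (suc (suc j)) ne eq = record
      { weight   = W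
      ; nonNeg   = λ { zero → ℚ.≤-refl ; (suc zero) → ℚ.≤-refl ; (suc (suc l)) → nonNeg l }
      ; total<2  = ℚ.≤-<-trans (ℚ.≤-reflexive (trans (ℚ.+-identityˡ _) (ℚ.+-identityˡ _))) total<2
      ; relation = relation′ }
      where
      open Separation (separate i j (ne ∘ cong (λ k → Fin.suc (Fin.suc k))) eq)
      W : Vecℚ (2 ℕ.+ m)
      W zero          = 0ℚ
      W (suc zero)    = 0ℚ
      W (suc (suc l)) = weight l
      drop : ∀ k → sum (λ l → W l * pt′ l k) ≡ sum (λ l → weight l * pt′ (suc (suc l)) k)
      drop k = trans (cong₂ (λ x y → x + (y + rest)) (ℚ.*-zeroˡ (pt′ zero k)) (ℚ.*-zeroˡ (pt′ (suc zero) k)))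
        (trans (ℚ.+-identityˡ (0ℚ + rest)) (ℚ.+-identityˡ rest))
        where
        rest : ℚ
        rest = sum λ l → weight l * pt′ (suc (suc l)) k
      relation′ : ∀ k → pt′ (suc (suc i)) k + pt′ (suc (suc j)) k ≡ sum λ l → W l * pt′ l k
      relation′ zero    = sym (trans (drop zero) (sum-zero m λ l → ℚ.*-zeroʳ (weight l)))
      relation′ (suc k) = trans (relation k) (sym (drop (suc k)))

    realization : Realization (suc n) G′
    realization = record
      { pt       = pt′
      ; supports = support′
      ; separate = separate′
      ; axis⁺    = λ where
          zero    → zero , λ { zero → refl ; (suc l) → refl }
          (suc k) → suc (suc (proj₁ (axis⁺ k))) , λ { zero → refl ; (suc l) → proj₂ (axis⁺ k) l }
      ; axis⁻    = λ where
          zero    → suc zero , λ { zero → refl ; (suc l) → refl }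
          (suc k) → suc (suc (proj₁ (axis⁻ k))) , λ { zero → refl ; (suc l) → proj₂ (axis⁻ k) l } }

  -- The sphere of dimension -1, whose only face is empty. The construction of all spheres starts
  -- here.
  emptyGraph : Graph 0
  emptyGraph = record { adj = λ () ; adj-sym = λ () ; adj-irrefl = λ () }

  pointRealization : Realization 0 emptyGraph
  pointRealization = record
    { pt       = λ ()
    ; supports = λ _ _ → record { functional = λ () ; on = λ () ; off = λ () ; dual = λ () ; dual-self = λ () ; dual-other = λ () }
    ; separate = λ ()
    ; axis⁺    = λ ()
    ; axis⁻    = λ () }

-- Clique polynomials under suspension and edge subdivision.

module CliquePolynomials where

  open ExponentialSeries
  open RationalGeometry
  open EdgeSubdivision
  open Graphs
  open import Algebra.Bundles using (CommutativeRing)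
  open import Level using (0ℓ)
  open import Data.Bool.Base using (Bool; true; false; if_then_else_; _∨_; _∧_; _xor_; not)
  import Data.Bool.Properties as Bool
  open import Data.Fin.Base as Fin using (Fin; zero; suc)
  import Data.Fin.Properties as Fin
  open import Data.Nat.Base as ℕ using (ℕ; zero; suc)
  open import Data.Product.Base using (_×_; _,_; proj₁; proj₂)
  open import Function.Base using (_∘_)
  open import Relation.Binary.PropositionalEquality as ≡ using (_≡_; _≢_; refl; cong; cong₂)
  open import Relation.Nullary using (¬_; Dec; yes; no; contradiction)

  infixl 6 _∖_
  _∖_ : ∀ {m} → (Fin m → Bool) → Fin m → Fin m → Bool
  (B ∖ u) i = B i ∧ not (i == u)

  -- Boolean identities in p = adj u i, q = adj v i and c, proved by truth
  -- tables; bᵤ and bᵥ tell whether i is u or v, and then p or q is false.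
  module TruthTable where

    ∀ᵇ : (Bool → Bool) → Bool
    ∀ᵇ f = f true ∧ f false

    ∀ᵇ-elim : ∀ f → ∀ᵇ f ≡ true → ∀ b → f b ≡ true
    ∀ᵇ-elim f p true  = proj₁ (∧-true p)
    ∀ᵇ-elim f p false = proj₂ (∧-true p)

    consistent : Bool → Bool → Bool → Bool → Bool
    consistent bᵤ bᵥ p q = not (bᵤ ∧ p) ∧ not (bᵥ ∧ q)

    Formula : Set
    Formula = Bool → Bool → Bool → Bool → Bool → Bool

    agree : Formula → Formula → Formula
    agree l r bᵤ bᵥ p q c = not (consistent bᵤ bᵥ p q) ∨ not (l bᵤ bᵥ p q c xor r bᵤ bᵥ p q c)

    table : (l r : Formula) →
            (∀ᵇ λ bᵤ → ∀ᵇ λ bᵥ → ∀ᵇ λ p → ∀ᵇ λ q → ∀ᵇ λ c → agree l r bᵤ bᵥ p q c) ≡ true →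
            ∀ bᵤ bᵥ p q c → consistent bᵤ bᵥ p q ≡ true → l bᵤ bᵥ p q c ≡ r bᵤ bᵥ p q c
    table l r t bᵤ bᵥ p q c = extract
      (∀ᵇ-elim (λ c → agree l r bᵤ bᵥ p q c)
        (∀ᵇ-elim (λ q → ∀ᵇ λ c → agree l r bᵤ bᵥ p q c)
          (∀ᵇ-elim (λ p → ∀ᵇ λ q → ∀ᵇ λ c → agree l r bᵤ bᵥ p q c)
            (∀ᵇ-elim (λ bᵥ → ∀ᵇ λ p → ∀ᵇ λ q → ∀ᵇ λ c → agree l r bᵤ bᵥ p q c)
              (∀ᵇ-elim (λ bᵤ → ∀ᵇ λ bᵥ → ∀ᵇ λ p → ∀ᵇ λ q → ∀ᵇ λ c → agree l r bᵤ bᵥ p q c) t bᵤ) bᵥ) p) q) c)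
      where
      extract : ∀ {h a b} → not h ∨ not (a xor b) ≡ true → h ≡ true → a ≡ b
      extract {true} {true}  {true}  _ _ = refl
      extract {true} {false} {false} _ _ = refl

  open TruthTable

  module CliquePolynomial (R : CommutativeRing 0ℓ 0ℓ) (x : CommutativeRing.Carrier R) where
    open CommutativeRing R hiding (zero; refl)
    private module R = CommutativeRing R
    open IntegerSolver R
    open import Relation.Binary.Reasoning.Setoid setoid

    Adj : ℕ → Set
    Adj m = Fin m → Fin m → Bool

    -- Every clique S contained in B contributes x ^ |S|.
    cl : ∀ {m} → Adj m → (Fin m → Bool) → Carrier
    cl {zero}  a B = 1#
    cl {suc m} a B =
      cl (λ i j → a (suc i) (suc j)) (B ∘ suc) +
      (if B zero then x * cl (λ i j → a (suc i) (suc j)) (λ i → B (suc i) ∧ a zero (suc i)) else 0#)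

    cl-cong : ∀ {m} {a a′ : Adj m} {B B′} → (∀ i → B i ≡ B′ i) →
              (∀ i j → B i ≡ true → B j ≡ true → a i j ≡ a′ i j) → cl a B ≡ cl a′ B′
    cl-cong {zero}  p q = refl
    cl-cong {suc m} {a} {a′} {B} {B′} p q = cong₂ _+_ (cl-cong (p ∘ suc) (λ i j → q (suc i) (suc j))) (go (B zero) refl)
      where
      go : ∀ b → B zero ≡ b →
           (if B zero then x * cl (λ i j → a (suc i) (suc j)) (λ i → B (suc i) ∧ a zero (suc i)) else 0#)
           ≡ (if B′ zero then x * cl (λ i j → a′ (suc i) (suc j)) (λ i → B′ (suc i) ∧ a′ zero (suc i)) else 0#)
      go false eq rewrite ≡.sym (p zero) | eq = refl
      go true  eq rewrite ≡.sym (p zero) | eq = cong (x *_) (cl-cong meet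
        (λ i j s t → q (suc i) (suc j) (proj₁ (∧-true s)) (proj₁ (∧-true t))))
        where
        meet : ∀ i → B (suc i) ∧ a zero (suc i) ≡ B′ (suc i) ∧ a′ zero (suc i)
        meet i with B (suc i) in e
        ... | false = cong (_∧ a′ zero (suc i)) (≡.trans (≡.sym e) (p (suc i)))
        ... | true  = ≡.trans (q zero (suc i) eq e) (cong (_∧ a′ zero (suc i)) (≡.trans (≡.sym e) (p (suc i))))

    cl-set : ∀ {m} {a : Adj m} {B B′} → (∀ i → B i ≡ B′ i) → cl a B ≈ cl a B′
    cl-set p = reflexive (cl-cong p λ _ _ _ _ → refl)

    -- The recursion defining `cl` sorts cliques by whether they contain the vertex 0; the same
    -- holds for any vertex u of B. Irreflexivity keeps u out of its own neighbourhood.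
    cl-delete : ∀ {m} (a : Adj m) → (∀ i j → a i j ≡ a j i) → (∀ i → a i i ≡ false) →
                ∀ B u → B u ≡ true → cl a B ≈ cl a (B ∖ u) + x * cl a (λ i → B i ∧ a u i)
    cl-delete {suc m} a sy ir B zero Bu = begin
      cl t (B ∘ suc) + (if B zero then x * N else 0#)
        ≡⟨ cong (λ b → cl t (B ∘ suc) + (if b then x * N else 0#)) Bu ⟩
      cl t (B ∘ suc) + x * N
        ≈⟨ solve 3 (λ x c n → c :+ x :* n := (c :+ :0) :+ x :* (n :+ :0)) R.refl x (cl t (B ∘ suc)) N ⟩
      (cl t (B ∘ suc) + 0#) + x * (N + 0#)
        ≈⟨ +-cong (+-cong (cl-set λ i → ≡.sym (Bool.∧-identityʳ (B (suc i))))
                     (reflexive (≡.sym (cong (λ b → if b then x * cl t (λ i → (B ∖ zero) (suc i) ∧ a zero (suc i)) else 0#) (Bool.∧-zeroʳ (B zero))))))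
                  (*-congˡ (+-congˡ (reflexive (≡.sym (cong (λ b → if b then x * cl t (λ i → (B (suc i) ∧ a zero (suc i)) ∧ a zero (suc i)) else 0#)
                     (≡.trans (cong (B zero ∧_) (ir zero)) (Bool.∧-zeroʳ (B zero)))))))) ⟩
      cl a (B ∖ zero) + x * cl a (λ i → B i ∧ a zero i) ∎
      where
      t : Adj m
      t i j = a (suc i) (suc j)
      N : Carrier
      N = cl t (λ i → B (suc i) ∧ a zero (suc i))
    cl-delete {suc m} a sy ir B (suc u) Bu = go (B zero) refl (a zero (suc u)) refl
      where
      t : Adj m
      t i j = a (suc i) (suc j)
      Bs B₀ Bᵤ : Fin m → Bool
      Bs = B ∘ suc
      B₀ i = Bs i ∧ a zero (suc i)
      Bᵤ i = Bs i ∧ t u i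
      IH : ∀ C → C u ≡ true → cl t C ≈ cl t (C ∖ u) + x * cl t (λ i → C i ∧ t u i)
      IH C = cl-delete t (λ i j → sy (suc i) (suc j)) (λ i → ir (suc i)) C u
      suc-== : ∀ i → (suc i == suc u) ≡ (i == u)
      suc-== i with i Fin.≟ u
      ... | yes _ = refl
      ... | no _  = refl
      drop : cl t ((B ∖ suc u) ∘ suc) ≈ cl t (Bs ∖ u)
      drop = cl-set λ i → cong (λ b → Bs i ∧ not b) (suc-== i)
      drop₀ : cl t (λ i → (B ∖ suc u) (suc i) ∧ a zero (suc i)) ≈ cl t (B₀ ∖ u)
      drop₀ = cl-set λ i → ≡.trans (cong (λ b → (Bs i ∧ not b) ∧ a zero (suc i)) (suc-== i))
        (≡.trans (Bool.∧-assoc (Bs i) _ _) (≡.trans (cong (Bs i ∧_) (Bool.∧-comm (not (i == u)) _)) (≡.sym (Bool.∧-assoc (Bs i) _ _))))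
      go : ∀ b → B zero ≡ b → ∀ e → a zero (suc u) ≡ e →
           cl t Bs + (if B zero then x * cl t B₀ else 0#)
           ≈ (cl t ((B ∖ suc u) ∘ suc) + (if B zero ∧ true then x * cl t (λ i → (B ∖ suc u) (suc i) ∧ a zero (suc i)) else 0#))
             + x * (cl t Bᵤ + (if B zero ∧ a (suc u) zero then x * cl t (λ i → Bᵤ i ∧ a zero (suc i)) else 0#))
      go false B0 e au rewrite B0 = begin
        cl t Bs + 0#                                       ≈⟨ +-congʳ (IH Bs Bu) ⟩
        (cl t (Bs ∖ u) + x * cl t Bᵤ) + 0#
          ≈⟨ solve 3 (λ x c n → (c :+ x :* n) :+ :0 := (c :+ :0) :+ x :* (n :+ :0)) R.refl x (cl t (Bs ∖ u)) (cl t Bᵤ) ⟩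
        (cl t (Bs ∖ u) + 0#) + x * (cl t Bᵤ + 0#)          ≈⟨ +-congʳ (+-congʳ drop) ⟨
        _ ∎
      go true B0 false au rewrite B0 | sy (suc u) zero | au = begin
        cl t Bs + x * cl t B₀                                    ≈⟨ +-cong (IH Bs Bu) (*-congˡ (cl-set absent)) ⟩
        (cl t (Bs ∖ u) + x * cl t Bᵤ) + x * cl t (B₀ ∖ u)
          ≈⟨ solve 4 (λ x c n k → (c :+ x :* n) :+ x :* k := (c :+ x :* k) :+ x :* (n :+ :0)) R.refl x (cl t (Bs ∖ u)) (cl t Bᵤ) (cl t (B₀ ∖ u)) ⟩
        (cl t (Bs ∖ u) + x * cl t (B₀ ∖ u)) + x * (cl t Bᵤ + 0#) ≈⟨ +-congʳ (+-cong drop (*-congˡ drop₀)) ⟨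
        _ ∎
        where
        absent : ∀ i → B₀ i ≡ (B₀ ∖ u) i
        absent i with i Fin.≟ u
        ... | yes refl = ≡.trans (cong (Bs u ∧_) au) (≡.trans (Bool.∧-zeroʳ (Bs u)) (≡.sym (Bool.∧-zeroʳ _)))
        ... | no _     = ≡.sym (Bool.∧-identityʳ _)
      go true B0 true au rewrite B0 | sy (suc u) zero | au = begin
        cl t Bs + x * cl t B₀
          ≈⟨ +-cong (IH Bs Bu) (*-congˡ (trans (IH B₀ (cong₂ _∧_ Bu au)) (+-congˡ (*-congˡ (cl-set swap))))) ⟩
        (cl t (Bs ∖ u) + x * cl t Bᵤ) + x * (cl t (B₀ ∖ u) + x * cl t (λ i → Bᵤ i ∧ a zero (suc i)))
          ≈⟨ solve 5 (λ x c n k l → (c :+ x :* n) :+ x :* (k :+ x :* l) := (c :+ x :* k) :+ x :* (n :+ x :* l)) R.refl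
               x (cl t (Bs ∖ u)) (cl t Bᵤ) (cl t (B₀ ∖ u)) (cl t (λ i → Bᵤ i ∧ a zero (suc i))) ⟩
        (cl t (Bs ∖ u) + x * cl t (B₀ ∖ u)) + x * (cl t Bᵤ + x * cl t (λ i → Bᵤ i ∧ a zero (suc i)))
          ≈⟨ +-congʳ (+-cong drop (*-congˡ drop₀)) ⟨
        _ ∎
        where
        swap : ∀ i → B₀ i ∧ t u i ≡ Bᵤ i ∧ a zero (suc i)
        swap i = ≡.trans (Bool.∧-assoc (Bs i) _ _) (≡.trans (cong (Bs i ∧_) (Bool.∧-comm (a zero (suc i)) _)) (≡.sym (Bool.∧-assoc (Bs i) _ _)))

    -- For t = x / (1 + x) these are (1 + x) (1 + t) and (1 + x)² t, the f-polynomial counterparts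
    -- of 1 + t and t.
    α β : Carrier
    α = 1# + (x + x)
    β = x + x * x

    module Suspended {m} (G : Graph m) where

      cl-link : ∀ (B′ : Fin (2 ℕ.+ m) → Bool) → B′ zero ≡ false → B′ (suc zero) ≡ false →
                cl (adj (suspend G)) B′ ≈ cl (adj G) (λ i → B′ (suc (suc i)))
      cl-link B′ p q rewrite p | q = trans (+-identityʳ _) (+-identityʳ _)

      cl-whole : ∀ (B′ : Fin (2 ℕ.+ m) → Bool) → B′ zero ≡ true → B′ (suc zero) ≡ true →
                 cl (adj (suspend G)) B′ ≈ α * cl (adj G) (λ i → B′ (suc (suc i)))
      cl-whole B′ p q rewrite p | q = begin
        (c + x * cl (adj G) (λ i → B i ∧ true)) + x * (cl (adj G) (λ i → B i ∧ true) + 0#)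
          ≈⟨ +-cong (+-congˡ (*-congˡ (cl-set λ i → Bool.∧-identityʳ (B i)))) (*-congˡ (+-congʳ (cl-set λ i → Bool.∧-identityʳ (B i)))) ⟩
        (c + x * c) + x * (c + 0#)
          ≈⟨ solve 2 (λ x c → (c :+ x :* c) :+ x :* (c :+ :0) := (:1 :+ (x :+ x)) :* c) R.refl x c ⟩
        α * c ∎
        where
        B : Fin m → Bool
        B i = B′ (suc (suc i))
        c : Carrier
        c = cl (adj G) B

    module Subdivided {m} (G : Graph m) (u v : Fin m) (uv : adj G u v ≡ true) where
      private
        a D : Adj m
        a = adj G
        D = adj (delete-edge G u v)

        cl-deleteᵃ : ∀ B w → B w ≡ true → cl a B ≈ cl a (B ∖ w) + x * cl a (λ i → B i ∧ a w i)
        cl-deleteᵃ = cl-delete a (adj-sym G) (adj-irrefl G)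

        cl-deleteᴰ : ∀ B w → B w ≡ true → cl D B ≈ cl D (B ∖ w) + x * cl D (λ i → B i ∧ D w i)
        cl-deleteᴰ = cl-delete D (adj-sym (delete-edge G u v)) (adj-irrefl (delete-edge G u v))

        aᵤᵤ : a u u ≡ false
        aᵤᵤ = adj-irrefl G u
        aᵥᵥ : a v v ≡ false
        aᵥᵥ = adj-irrefl G v

      u≢v : u ≢ v
      u≢v refl = true≢false uv aᵤᵤ

      D-old : ∀ i j → ¬ (i ≡ u × j ≡ v) → ¬ (i ≡ v × j ≡ u) → D i j ≡ a i j
      D-old i j p q with i Fin.≟ u | j Fin.≟ v | i Fin.≟ v | j Fin.≟ u
      ... | yes iu | yes jv | _      | _      = contradiction (iu , jv) p
      ... | _      | _      | yes iv | yes ju = contradiction (iv , ju) q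
      ... | yes _  | no _   | yes _  | no _   = Bool.∧-identityʳ (a i j)
      ... | yes _  | no _   | no _   | _      = Bool.∧-identityʳ (a i j)
      ... | no _   | _      | yes _  | no _   = Bool.∧-identityʳ (a i j)
      ... | no _   | _      | no _   | _      = Bool.∧-identityʳ (a i j)

      D-edge : D u v ≡ false
      D-edge = ≡.trans (cong₂ (λ p q → a u v ∧ not ((p ∧ q) ∨ ((u == v) ∧ (v == u)))) (==-refl u) (==-refl v)) (Bool.∧-zeroʳ (a u v))

      D-row : ∀ {w} → w ≢ u → w ≢ v → ∀ i → D w i ≡ a w i
      D-row w≢u w≢v i = D-old _ i (λ (p , _) → w≢u p) (λ (p , _) → w≢v p)

      D-u : ∀ i → D u i ≡ a u i ∧ not (i == v)
      D-u i = go (i Fin.≟ v)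
        where
        go : Dec (i ≡ v) → D u i ≡ a u i ∧ not (i == v)
        go (yes refl) = ≡.trans D-edge (≡.sym (≡.trans (cong (λ b → a u v ∧ not b) (==-refl v)) (Bool.∧-zeroʳ _)))
        go (no i≢v)   = ≡.trans (D-old u i (λ (_ , p) → i≢v p) (λ (p , _) → u≢v p))
                          (≡.sym (≡.trans (cong (λ b → a u i ∧ not b) (==-≢ i≢v)) (Bool.∧-identityʳ _)))

      D-v : ∀ i → D v i ≡ a v i ∧ not (i == u)
      D-v i = go (i Fin.≟ u)
        where
        go : Dec (i ≡ u) → D v i ≡ a v i ∧ not (i == u)
        go (yes refl) = ≡.trans (adj-sym (delete-edge G u v) v u)
                          (≡.trans D-edge (≡.sym (≡.trans (cong (λ b → a v u ∧ not b) (==-refl u)) (Bool.∧-zeroʳ _))))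
        go (no i≢u)   = ≡.trans (D-old v i (λ (p , _) → u≢v (≡.sym p)) (λ (_ , p) → i≢u p))
                          (≡.sym (≡.trans (cong (λ b → a v i ∧ not b) (==-≢ i≢u)) (Bool.∧-identityʳ _)))

      consistent-at : ∀ i → consistent (i == u) (i == v) (a u i) (a v i) ≡ true
      consistent-at i with i Fin.≟ u | i Fin.≟ v
      ... | yes refl | yes refl = cong₂ (λ p q → not p ∧ not q) aᵤᵤ aᵤᵤ
      ... | yes refl | no _     = cong (λ p → not p ∧ true) aᵤᵤ
      ... | no _     | yes refl = cong not aᵥᵥ
      ... | no _     | no _     = refl

      by-table : (l r : Formula) →
        (∀ᵇ λ bᵤ → ∀ᵇ λ bᵥ → ∀ᵇ λ p → ∀ᵇ λ q → ∀ᵇ λ c → agree l r bᵤ bᵥ p q c) ≡ true →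
        ∀ i c → l (i == u) (i == v) (a u i) (a v i) c ≡ r (i == u) (i == v) (a u i) (a v i) c
      by-table l r t i c = table l r t (i == u) (i == v) (a u i) (a v i) c (consistent-at i)

      cl-D : ∀ B → ¬ (B u ≡ true × B v ≡ true) → cl D B ≈ cl a B
      cl-D B p = reflexive (cl-cong (λ _ → refl) λ i j s t →
        D-old i j (λ { (refl , refl) → p (s , t) }) (λ { (refl , refl) → p (t , s) }))

      common-link : (Fin m → Bool) → Fin m → Bool
      common-link C i = a u i ∧ (a v i ∧ C i)

      M : (Fin m → Bool) → Carrier
      M C = cl a (common-link C)

      cl-D-M : ∀ C → cl D (common-link C) ≈ M C
      cl-D-M C = cl-D (common-link C) λ (p , _) → true≢false (proj₁ (∧-true p)) aᵤᵤ

      -- The cliques lost with the edge are those containing u and v, that is, the cliques of the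
      -- link of the edge enlarged by two vertices.
      cl-delete-edge : ∀ B → B u ≡ true → B v ≡ true → cl D B + x * (x * M B) ≈ cl a B
      cl-delete-edge B Bu Bv = begin
        cl D B + x * (x * M B)
          ≈⟨ +-congʳ (cl-deleteᴰ B u Bu) ⟩
        (cl D (B ∖ u) + x * cl D (λ i → B i ∧ D u i)) + x * (x * M B)
          ≈⟨ +-congʳ (+-cong (cl-D (B ∖ u) λ (p , _) → no-u p)
               (*-congˡ (trans (cl-D (λ i → B i ∧ D u i) λ (p , _) → true≢false (proj₂ (∧-true {B u} p)) (adj-irrefl (delete-edge G u v) u))
                 (cl-set λ i → ≡.trans (cong (B i ∧_) (D-u i)) (≡.sym (Bool.∧-assoc (B i) _ _)))))) ⟩
        (cl a (B ∖ u) + x * cl a (Bᵤ ∖ v)) + x * (x * M B)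
          ≈⟨ solve 4 (λ x p q r → (p :+ x :* q) :+ x :* (x :* r) := p :+ x :* (q :+ x :* r)) R.refl x (cl a (B ∖ u)) (cl a (Bᵤ ∖ v)) (M B) ⟩
        cl a (B ∖ u) + x * (cl a (Bᵤ ∖ v) + x * M B)
          ≈⟨ +-congˡ (*-congˡ (+-congˡ (*-congˡ (cl-set λ i → rotate (B i) (a u i) (a v i))))) ⟩
        cl a (B ∖ u) + x * (cl a (Bᵤ ∖ v) + x * cl a (λ i → Bᵤ i ∧ a v i))
          ≈⟨ +-congˡ (*-congˡ (cl-deleteᵃ Bᵤ v (cong₂ _∧_ Bv uv))) ⟨
        cl a (B ∖ u) + x * cl a Bᵤ
          ≈⟨ cl-deleteᵃ B u Bu ⟨
        cl a B ∎
        where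
        Bᵤ : Fin m → Bool
        Bᵤ i = B i ∧ a u i
        no-u : (B ∖ u) u ≡ true → ∀ {A : Set} → A
        no-u p = true≢false (proj₂ (∧-true {B u} p)) (cong not (==-refl u))
        rotate : ∀ b p q → p ∧ (q ∧ b) ≡ (b ∧ p) ∧ q
        rotate false p q = ≡.trans (cong (p ∧_) (Bool.∧-zeroʳ q)) (Bool.∧-zeroʳ p)
        rotate true  p q = cong (p ∧_) (Bool.∧-identityʳ q)

      private
        star-u : star G u v u ≡ true
        star-u = cong (_∨ ((u == v) ∨ (a u u ∧ a v u))) (==-refl u)

        star-v : star G u v v ≡ true
        star-v = ≡.trans (cong (λ b → (v == u) ∨ (b ∨ (a u v ∧ a v v))) (==-refl v)) (Bool.∨-zeroʳ _)

      -- Once the edge is deleted, its star is the suspension of its link with poles u and v.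
      cl-star : ∀ C → C u ≡ true → C v ≡ true → cl D (λ i → star G u v i ∧ C i) ≈ α * M C
      cl-star C Cu Cv = begin
        cl D B
          ≈⟨ cl-deleteᴰ B u (cong₂ _∧_ star-u Cu) ⟩
        cl D (B ∖ u) + x * cl D (λ i → B i ∧ D u i)
          ≈⟨ +-congʳ (cl-deleteᴰ (B ∖ u) v (cong₂ _∧_ (cong₂ _∧_ star-v Cv) (cong not (==-≢ (u≢v ∘ ≡.sym))))) ⟩
        (cl D (B ∖ u ∖ v) + x * cl D (λ i → (B ∖ u) i ∧ D v i)) + x * cl D (λ i → B i ∧ D u i)
          ≈⟨ +-cong (+-cong (cl-set e₁) (*-congˡ (cl-set e₂))) (*-congˡ (cl-set e₃)) ⟩
        (cl D (common-link C) + x * cl D (common-link C)) + x * cl D (common-link C)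
          ≈⟨ solve 2 (λ x c → (c :+ x :* c) :+ x :* c := (:1 :+ (x :+ x)) :* c) R.refl x (cl D (common-link C)) ⟩
        α * cl D (common-link C)
          ≈⟨ *-congˡ (cl-D-M C) ⟩
        α * M C ∎
        where
        B : Fin m → Bool
        B i = star G u v i ∧ C i
        e₁ : ∀ i → (B ∖ u ∖ v) i ≡ common-link C i
        e₁ i = by-table (λ bᵤ bᵥ p q c → (((bᵤ ∨ (bᵥ ∨ (p ∧ q))) ∧ c) ∧ not bᵤ) ∧ not bᵥ) (λ bᵤ bᵥ p q c → p ∧ (q ∧ c)) refl i (C i)
        e₂ : ∀ i → (B ∖ u) i ∧ D v i ≡ common-link C i
        e₂ i = ≡.trans (cong ((B ∖ u) i ∧_) (D-v i))
          (by-table (λ bᵤ bᵥ p q c → (((bᵤ ∨ (bᵥ ∨ (p ∧ q))) ∧ c) ∧ not bᵤ) ∧ (q ∧ not bᵤ)) (λ bᵤ bᵥ p q c → p ∧ (q ∧ c)) refl i (C i))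
        e₃ : ∀ i → B i ∧ D u i ≡ common-link C i
        e₃ i = ≡.trans (cong (B i ∧_) (D-u i))
          (by-table (λ bᵤ bᵥ p q c → ((bᵤ ∨ (bᵥ ∨ (p ∧ q))) ∧ c) ∧ (p ∧ not bᵥ)) (λ bᵤ bᵥ p q c → p ∧ (q ∧ c)) refl i (C i))

      private
        a′ : Adj (suc m)
        a′ = adj (subdivide G u v)

      -- For faces containing u and the new vertex: the edge between these has the link that u v
      -- had.
      cl-edge : ∀ (B′ : Fin (suc m) → Bool) (C : Fin m → Bool) → B′ zero ≡ false →
                (∀ i → B′ (suc i) ≡ D u i ∧ (star G u v i ∧ C i)) → cl a′ B′ ≈ M C
      cl-edge B′ C p q rewrite p = trans (+-identityʳ _) (trans (cl-set λ i → ≡.trans (q i) (e i)) (cl-D-M C))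
        where
        e : ∀ i → D u i ∧ (star G u v i ∧ C i) ≡ common-link C i
        e i = ≡.trans (cong (_∧ (star G u v i ∧ C i)) (D-u i))
          (by-table (λ bᵤ bᵥ p q c → (p ∧ not bᵥ) ∧ ((bᵤ ∨ (bᵥ ∨ (p ∧ q))) ∧ c)) (λ bᵤ bᵥ p q c → p ∧ (q ∧ c)) refl i (C i))

      -- For faces containing u but not the new vertex: in the link of u the new vertex simply takes
      -- the place of v.
      cl-pole : ∀ (B′ : Fin (suc m) → Bool) (C : Fin m → Bool) → C v ≡ true → B′ zero ≡ true →
                (∀ i → B′ (suc i) ≡ D u i ∧ C i) → cl a′ B′ ≈ cl a (λ i → a u i ∧ C i)
      cl-pole B′ C Cv p q rewrite p = begin
        cl D (B′ ∘ suc) + x * cl D (λ i → B′ (suc i) ∧ star G u v i)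
          ≈⟨ +-cong (trans (cl-set λ i → ≡.trans (q i) (e₁ i)) (cl-D (B ∖ v) λ (s , _) → true≢false (proj₁ (∧-true (proj₁ (∧-true s)))) aᵤᵤ))
                    (*-congˡ (trans (cl-set λ i → ≡.trans (cong (_∧ star G u v i) (q i)) (e₂ i))
                      (cl-D (λ i → B i ∧ a v i) λ (s , _) → true≢false (proj₁ (∧-true (proj₁ (∧-true s)))) aᵤᵤ))) ⟩
        cl a (B ∖ v) + x * cl a (λ i → B i ∧ a v i)
          ≈⟨ cl-deleteᵃ B v (cong₂ _∧_ uv Cv) ⟨
        cl a B ∎
        where
        B : Fin m → Bool
        B i = a u i ∧ C i
        e₁ : ∀ i → D u i ∧ C i ≡ (B ∖ v) i
        e₁ i = ≡.trans (cong (_∧ C i) (D-u i))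
          (by-table (λ bᵤ bᵥ p q c → (p ∧ not bᵥ) ∧ c) (λ bᵤ bᵥ p q c → (p ∧ c) ∧ not bᵥ) refl i (C i))
        e₂ : ∀ i → (D u i ∧ C i) ∧ star G u v i ≡ B i ∧ a v i
        e₂ i = ≡.trans (cong (λ b → (b ∧ C i) ∧ star G u v i) (D-u i))
          (by-table (λ bᵤ bᵥ p q c → ((p ∧ not bᵥ) ∧ c) ∧ (bᵤ ∨ (bᵥ ∨ (p ∧ q)))) (λ bᵤ bᵥ p q c → (p ∧ c) ∧ q) refl i (C i))

      -- For faces containing the new vertex but not u: the link of the new vertex is the suspension
      -- of the link of the edge.
      cl-vertex : ∀ (B′ : Fin (suc m) → Bool) (C : Fin m → Bool) → C u ≡ true → C v ≡ true → B′ zero ≡ false →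
                  (∀ i → B′ (suc i) ≡ star G u v i ∧ C i) → cl a′ B′ ≈ α * M C
      cl-vertex B′ C Cu Cv p q rewrite p = trans (+-identityʳ _) (trans (cl-set q) (cl-star C Cu Cv))

      -- For faces containing neither: x² M is lost with the edge and x (1 + 2x) M is gained with
      -- the new vertex, in balance β M.
      cl-whole : ∀ (B′ : Fin (suc m) → Bool) (C : Fin m → Bool) → C u ≡ true → C v ≡ true → B′ zero ≡ true →
                 (∀ i → B′ (suc i) ≡ C i) → cl a′ B′ ≈ cl a C + β * M C
      cl-whole B′ C Cu Cv p q rewrite p = begin
        cl D (B′ ∘ suc) + x * cl D (λ i → B′ (suc i) ∧ star G u v i)
          ≈⟨ +-cong (cl-set q) (*-congˡ (trans (cl-set λ i → ≡.trans (cong (_∧ star G u v i) (q i)) (Bool.∧-comm (C i) _)) (cl-star C Cu Cv))) ⟩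
        cl D C + x * (α * M C)
          ≈⟨ solve 3 (λ x d k → d :+ x :* ((:1 :+ (x :+ x)) :* k) := (d :+ x :* (x :* k)) :+ (x :+ x :* x) :* k) R.refl x (cl D C) (M C) ⟩
        (cl D C + x * (x * M C)) + β * M C
          ≈⟨ +-congʳ (cl-delete-edge C Cu Cv) ⟩
        cl a C + β * M C ∎

-- Realized flag spheres with a facet, and the effect of events on its links.

module FlagSpheres where

  open RationalGeometry
  open EdgeSubdivision
  open Suspensions
  open CliquePolynomials
  open Graphs
  open Realizations
  open import Algebra.Bundles using (CommutativeRing)
  open import Level using (0ℓ)
  open import Data.Bool.Base using (Bool; true; false; if_then_else_; _∨_; _∧_; not)
  import Data.Bool.Properties as Bool
  open import Data.Fin.Base as Fin using (Fin; zero; suc)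
  import Data.Fin.Properties as Fin
  open import Data.Fin.Subset using (Subset)
  open import Data.Nat.Base as ℕ using (ℕ; zero; suc)
  open import Data.Vec.Base as Vec using (Vec; []; _∷_; lookup; _[_]≔_)
  import Data.Vec.Properties as Vec
  open import Function.Base using (_∘_)
  open import Relation.Binary.PropositionalEquality as ≡ using (_≡_; _≢_; refl; cong; cong₂)
  open import Relation.Nullary using (yes; no; contradiction)

  allOf : ∀ {n} → Subset n → (Fin n → Bool) → Bool
  allOf []      ρ = true
  allOf (b ∷ σ) ρ = (not b ∨ ρ zero) ∧ allOf σ (ρ ∘ suc)

  allOf-cong : ∀ {n} (σ : Subset n) {ρ ρ′} → (∀ i → lookup σ i ≡ true → ρ i ≡ ρ′ i) → allOf σ ρ ≡ allOf σ ρ′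
  allOf-cong []          p = refl
  allOf-cong (true ∷ σ)  p = cong₂ _∧_ (p zero refl) (allOf-cong σ (p ∘ suc))
  allOf-cong (false ∷ σ) p = allOf-cong σ (p ∘ suc)

  allOf-true : ∀ {n} (σ : Subset n) {ρ} → (∀ i → lookup σ i ≡ true → ρ i ≡ true) → allOf σ ρ ≡ true
  allOf-true []          p = refl
  allOf-true (true ∷ σ)  p = cong₂ _∧_ (p zero refl) (allOf-true σ (p ∘ suc))
  allOf-true (false ∷ σ) p = allOf-true σ (p ∘ suc)

  allOf-split : ∀ {n} (σ : Subset n) j ρ → allOf σ ρ ≡ (not (lookup σ j) ∨ ρ j) ∧ allOf (σ [ j ]≔ false) ρ
  allOf-split (b ∷ σ) zero    ρ = refl
  allOf-split (b ∷ σ) (suc j) ρ = ≡.trans (cong ((not b ∨ ρ zero) ∧_) (allOf-split σ j (ρ ∘ suc)))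
    (≡.trans (≡.sym (Bool.∧-assoc (not b ∨ ρ zero) _ _))
      (≡.trans (cong (_∧ allOf (σ [ j ]≔ false) (ρ ∘ suc)) (Bool.∧-comm (not b ∨ ρ zero) _)) (Bool.∧-assoc (not (lookup σ j) ∨ ρ (suc j)) _ _)))

  module Spheres (R : CommutativeRing 0ℓ 0ℓ) (x : CommutativeRing.Carrier R) where
    open CommutativeRing R hiding (zero; refl)
    private module R = CommutativeRing R
    open CliquePolynomial R x

    -- A realized flag sphere with a distinguished facet, such that H σ is the
    -- clique polynomial of the link of the face σ of that facet.
    record Sphere (n : ℕ) (H : Subset n → Carrier) : Set where
      field
        {#vertices} : ℕ
        graph       : Graph #vertices
        realization : Realization n graph
        facet       : Fin n → Fin #vertices
        clique      : ∀ i j → i ≢ j → adj graph (facet i) (facet j) ≡ true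
      common : Subset n → Fin #vertices → Bool
      common σ y = allOf σ (λ i → adj graph (facet i) y)
      field
        links       : ∀ σ → cl (adj graph) (common σ) ≈ H σ

    Sphere-cong : ∀ {n} {H H′ : Subset n → Carrier} → (∀ σ → H σ ≈ H′ σ) → Sphere n H → Sphere n H′
    Sphere-cong p S = record { Sphere S ; links = λ σ → trans (Sphere.links S σ) (p σ) }

    pointSphere : Sphere 0 (λ _ → 1#)
    pointSphere = record
      { graph = emptyGraph ; realization = pointRealization ; facet = λ () ; clique = λ () ; links = λ _ → R.refl }

    suspended : ∀ {n} → (Subset n → Carrier) → Subset (suc n) → Carrier
    suspended H (true  ∷ σ) = H σ
    suspended H (false ∷ σ) = α * H σ

    suspendSphere : ∀ {n} {H : Subset n → Carrier} → Sphere n H → Sphere (suc n) (suspended H)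
    suspendSphere {n} {H} S = record
      { graph       = suspend graph
      ; realization = Suspension.realization graph realization
      ; facet       = facet′
      ; clique      = λ where
          zero    zero    ne → contradiction refl ne
          zero    (suc j) ne → refl
          (suc i) zero    ne → refl
          (suc i) (suc j) ne → clique i j (ne ∘ cong suc)
      ; links       = links′ }
      where
      open Sphere S
      open Suspended graph
      facet′ : Fin (suc n) → Fin (2 ℕ.+ #vertices)
      facet′ zero    = zero
      facet′ (suc i) = suc (suc (facet i))
      common′ : Subset (suc n) → Fin (2 ℕ.+ #vertices) → Bool
      common′ σ y = allOf σ (λ i → adj (suspend graph) (facet′ i) y)
      links′ : ∀ σ → cl (adj (suspend graph)) (common′ σ) ≈ suspended H σ
      links′ (true ∷ σ)  = trans (cl-link (common′ (true ∷ σ)) refl refl) (links σ)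
      links′ (false ∷ σ) = trans
        (cl-whole (common′ (false ∷ σ)) (allOf-true σ λ _ _ → refl) (allOf-true σ λ _ _ → refl)) (*-congˡ (links σ))

    -- The effect of subdividing the edge between the vertex 0 and the vertex
    -- 1 + j of the facet, where the new vertex replaces the latter.
    event : ∀ {n} → Fin n → (Subset (suc n) → Carrier) → Subset (suc n) → Carrier
    event j H (true  ∷ σ) = H (true ∷ σ)
    event j H (false ∷ σ) = if lookup σ j then α * H (true ∷ σ) else H (false ∷ σ) + β * H (true ∷ (σ [ j ]≔ true))

    eventSphere : ∀ {n} {H : Subset (suc n) → Carrier} j → Sphere (suc n) H → Sphere (suc n) (event j H)
    eventSphere {n} {H} j S = record
      { graph       = G′
      ; realization = Subdivision.realization graph u v uv realization
      ; facet       = facet′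
      ; clique      = clique′
      ; links       = links′ }
      where
      open Sphere S
      u v : Fin #vertices
      u = facet zero
      v = facet (suc j)
      uv : adj graph u v ≡ true
      uv = clique zero (suc j) λ ()
      open Subdivided graph u v uv
      G′ : Graph (suc #vertices)
      G′ = subdivide graph u v
      facet-injective : ∀ i k → i ≢ k → facet i ≢ facet k
      facet-injective i k i≢k eq = true≢false (clique i k i≢k) (≡.trans (cong (adj graph (facet i)) (≡.sym eq)) (adj-irrefl graph (facet i)))
      facet′ : Fin (suc n) → Fin (suc #vertices)
      facet′ zero    = suc u
      facet′ (suc i) = if i == j then zero else suc (facet (suc i))
      facet′-j : facet′ (suc j) ≡ zero
      facet′-j rewrite ==-refl j = refl
      facet′-≢ : ∀ {i} → i ≢ j → facet′ (suc i) ≡ suc (facet (suc i))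
      facet′-≢ i≢j rewrite ==-≢ i≢j = refl
      star-uv : star graph u v u ≡ true
      star-uv = cong (_∨ ((u == v) ∨ (adj graph u u ∧ adj graph v u))) (==-refl u)
      star-facet : ∀ {i} → i ≢ j → star graph u v (facet (suc i)) ≡ true
      star-facet {i} i≢j = ≡.trans (cong (λ b → (facet (suc i) == u) ∨ ((facet (suc i) == v) ∨ b))
          (cong₂ _∧_ (clique zero (suc i) λ ()) (clique (suc j) (suc i) (i≢j ∘ ≡.sym ∘ Fin.suc-injective))))
        (≡.trans (cong ((facet (suc i) == u) ∨_) (Bool.∨-zeroʳ _)) (Bool.∨-zeroʳ _))
      row : ∀ {i} → i ≢ j → ∀ y → adj (delete-edge graph u v) (facet (suc i)) y ≡ adj graph (facet (suc i)) y
      row {i} i≢j = D-row (facet-injective (suc i) zero λ ()) (facet-injective (suc i) (suc j) (i≢j ∘ Fin.suc-injective))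
      clique′ : ∀ i k → i ≢ k → adj G′ (facet′ i) (facet′ k) ≡ true
      clique′ zero zero ne = contradiction refl ne
      clique′ zero (suc k) ne with k Fin.≟ j
      ... | yes _  = star-uv
      ... | no k≢j = ≡.trans (adj-sym (delete-edge graph u v) u (facet (suc k))) (≡.trans (row k≢j u) (clique (suc k) zero λ ()))
      clique′ (suc i) zero ne with i Fin.≟ j
      ... | yes _  = star-uv
      ... | no i≢j = ≡.trans (row i≢j u) (clique (suc i) zero λ ())
      clique′ (suc i) (suc k) ne with i Fin.≟ j | k Fin.≟ j
      ... | yes refl | yes refl = contradiction refl ne
      ... | yes refl | no k≢j   = star-facet k≢j
      ... | no i≢j   | yes refl = star-facet i≢j
      ... | no i≢j   | no k≢j   = ≡.trans (row i≢j _) (clique (suc i) (suc k) ne)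
      module _ (σ : Subset n) where
        -- The common neighbours of the face without the vertices 0 and 1 + j. The other vertices of
        -- the facet lie in the star of the edge, and their old adjacencies survive the subdivision.
        C : Fin #vertices → Bool
        C y = allOf (σ [ j ]≔ false) (λ i → adj graph (facet (suc i)) y)
        others : ∀ {i} → lookup (σ [ j ]≔ false) i ≡ true → i ≢ j
        others p refl = true≢false p (Vec.lookup∘update j σ false)
        Cu : C u ≡ true
        Cu = allOf-true (σ [ j ]≔ false) λ i _ → clique (suc i) zero λ ()
        Cv : C v ≡ true
        Cv = allOf-true (σ [ j ]≔ false) λ i p → clique (suc i) (suc j) (others p ∘ Fin.suc-injective)
        at-old : ∀ y → allOf σ (λ i → adj G′ (facet′ (suc i)) (suc y)) ≡ (not (lookup σ j) ∨ star graph u v y) ∧ C y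
        at-old y = ≡.trans (allOf-split σ j _) (cong₂ (λ a b → (not (lookup σ j) ∨ a) ∧ b)
          (cong (λ w → adj G′ w (suc y)) facet′-j)
          (allOf-cong (σ [ j ]≔ false) λ i p → ≡.trans (cong (λ w → adj G′ w (suc y)) (facet′-≢ (others p))) (row (others p) y)))
        at-new : allOf σ (λ i → adj G′ (facet′ (suc i)) zero) ≡ not (lookup σ j)
        at-new = ≡.trans (allOf-split σ j _) (≡.trans (cong₂ (λ a b → (not (lookup σ j) ∨ a) ∧ b)
          (cong (λ w → adj G′ w zero) facet′-j)
          (allOf-true (σ [ j ]≔ false) λ i p → ≡.trans (cong (λ w → adj G′ w zero) (facet′-≢ (others p))) (star-facet (others p))))
          (≡.trans (Bool.∧-identityʳ _) (Bool.∨-identityʳ _)))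
        before : ∀ y → allOf σ (λ i → adj graph (facet (suc i)) y) ≡ (not (lookup σ j) ∨ adj graph v y) ∧ C y
        before y = allOf-split σ j _
      common′ : Subset (suc n) → Fin (suc #vertices) → Bool
      common′ σ y = allOf σ (λ i → adj G′ (facet′ i) y)
      -- The head of σ tells whether the face contains u, and the entry j whether it contains the
      -- new vertex. The four cases are `cl-edge`, `cl-pole`, `cl-vertex` and `cl-whole`.
      links′ : ∀ σ → cl (adj G′) (common′ σ) ≈ event j H σ
      links′ (true ∷ σ) with lookup σ j in eq
      ... | true  = trans
        (cl-edge (common′ (true ∷ σ)) (C σ) (≡.trans (cong (star graph u v u ∧_) (≡.trans (at-new σ) (cong not eq))) (Bool.∧-zeroʳ _))
          (λ y → cong (adj (delete-edge graph u v) u y ∧_) (≡.trans (at-old σ y) (cong (λ b → (not b ∨ star graph u v y) ∧ C σ y) eq))))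
        (trans (cl-set λ y → cong (adj graph u y ∧_) (≡.sym (≡.trans (before σ y) (cong (λ b → (not b ∨ adj graph v y) ∧ C σ y) eq))))
          (links (true ∷ σ)))
      ... | false = trans
        (cl-pole (common′ (true ∷ σ)) (C σ) (Cv σ) (cong₂ _∧_ star-uv (≡.trans (at-new σ) (cong not eq)))
          (λ y → cong (adj (delete-edge graph u v) u y ∧_) (≡.trans (at-old σ y) (cong (λ b → (not b ∨ star graph u v y) ∧ C σ y) eq))))
        (trans (cl-set λ y → cong (adj graph u y ∧_) (≡.sym (≡.trans (before σ y) (cong (λ b → (not b ∨ adj graph v y) ∧ C σ y) eq))))
          (links (true ∷ σ)))
      links′ (false ∷ σ) with lookup σ j in eq
      ... | true  = trans
        (cl-vertex (common′ (false ∷ σ)) (C σ) (Cu σ) (Cv σ) (≡.trans (at-new σ) (cong not eq))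
          (λ y → ≡.trans (at-old σ y) (cong (λ b → (not b ∨ star graph u v y) ∧ C σ y) eq)))
        (*-congˡ (trans (cl-set λ y → cong (adj graph u y ∧_) (≡.sym (≡.trans (before σ y) (cong (λ b → (not b ∨ adj graph v y) ∧ C σ y) eq))))
          (links (true ∷ σ))))
      ... | false = trans
        (cl-whole (common′ (false ∷ σ)) (C σ) (Cu σ) (Cv σ) (≡.trans (at-new σ) (cong not eq))
          (λ y → ≡.trans (at-old σ y) (cong (λ b → (not b ∨ star graph u v y) ∧ C σ y) eq)))
        (+-cong
          (trans (cl-set λ y → ≡.sym (≡.trans (before σ y) (cong (λ b → (not b ∨ adj graph v y) ∧ C σ y) eq))) (links (false ∷ σ)))
          (*-congˡ (trans (cl-set λ y → cong (adj graph u y ∧_) (≡.sym (with-j y))) (links (true ∷ (σ [ j ]≔ true))))))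
        where
        with-j : ∀ y → allOf (σ [ j ]≔ true) (λ i → adj graph (facet (suc i)) y) ≡ adj graph v y ∧ C σ y
        with-j y = ≡.trans (before (σ [ j ]≔ true) y) (cong₂ (λ b τ → (not b ∨ adj graph v y) ∧ allOf τ (λ i → adj graph (facet (suc i)) y))
          (Vec.lookup∘update j σ true) (Vec.[]≔-idempotent σ j))

-- The schedule of subdivisions that produces the Eulerian spheres.

module EventSchedule where

  open EulerianRecursion
  open CliquePolynomials
  open FlagSpheres
  open import Algebra.Bundles using (CommutativeRing)
  open import Level using (0ℓ)
  open import Data.Bool.Base using (Bool; true; false; if_then_else_)
  open import Data.Fin.Base as Fin using (Fin; zero; suc; toℕ)
  import Data.Fin.Properties as Fin
  open import Data.Fin.Subset using (Subset)
  open import Data.List.Base as List using (List; []; _∷_; _++_)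
  open import Data.List.Relation.Unary.All as All using (All; []; _∷_)
  open import Data.Nat.Base as ℕ using (ℕ; zero; suc; _∸_; _<_; z≤n; s≤s)
  import Data.Nat.Properties as ℕ
  open import Data.Product.Base using (_×_; _,_; ∃-syntax)
  open import Data.Sum.Base using (_⊎_; inj₁; inj₂)
  open import Data.Vec.Base using ([]; _∷_; lookup; _[_]≔_)
  open import Relation.Binary.PropositionalEquality as ≡ using (_≡_; refl; cong; cong₂)

  member : ∀ {n} → Subset n → ℕ → Bool
  member []      i       = false
  member (b ∷ σ) zero    = b
  member (b ∷ σ) (suc i) = member σ i

  insert : ∀ {n} → ℕ → Subset n → Subset n
  insert i       []      = []
  insert zero    (b ∷ σ) = true ∷ σ
  insert (suc i) (b ∷ σ) = b ∷ insert i σ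

  member-toℕ : ∀ {n} (σ : Subset n) j → member σ (toℕ j) ≡ lookup σ j
  member-toℕ (b ∷ σ) zero    = refl
  member-toℕ (b ∷ σ) (suc j) = member-toℕ σ j

  insert-toℕ : ∀ {n} (σ : Subset n) j → insert (toℕ j) σ ≡ σ [ j ]≔ true
  insert-toℕ (b ∷ σ) zero    = refl
  insert-toℕ (b ∷ σ) (suc j) = cong (b ∷_) (insert-toℕ σ j)

  data Least : ∀ {n} → Subset n → ℕ → Set where
    here  : ∀ {n} {σ : Subset n} → Least (true ∷ σ) zero
    there : ∀ {n} {σ : Subset n} {j} → Least σ j → Least (false ∷ σ) (suc j)

  ∅ : ∀ n → Subset n
  ∅ zero    = []
  ∅ (suc n) = false ∷ ∅ n

  ∅-or-least : ∀ {n} (σ : Subset n) → σ ≡ ∅ n ⊎ ∃[ j ] Least σ j × j < n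
  ∅-or-least []          = inj₁ refl
  ∅-or-least (true ∷ σ)  = inj₂ (0 , here , s≤s z≤n)
  ∅-or-least (false ∷ σ) with ∅-or-least σ
  ... | inj₁ refl            = inj₁ refl
  ... | inj₂ (j , least , p) = inj₂ (suc j , there least , s≤s p)

  least-member : ∀ {n} {σ : Subset n} {j} → Least σ j → member σ j ≡ true
  least-member here      = refl
  least-member (there l) = least-member l

  below-least : ∀ {n} {σ : Subset n} {j i} → Least σ j → i < j → member σ i ≡ false
  below-least {i = zero}  (there l) _       = refl
  below-least {i = suc i} (there l) (s≤s p) = below-least l p

  member-∅ : ∀ n i → member (∅ n) i ≡ false
  member-∅ zero    i       = refl
  member-∅ (suc n) zero    = refl
  member-∅ (suc n) (suc i) = member-∅ n i

  module Schedule (R : CommutativeRing 0ℓ 0ℓ) (x : CommutativeRing.Carrier R) (s : ℕ) where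
    open CommutativeRing R hiding (zero; refl)
    private module R = CommutativeRing R
    open CliquePolynomial R x using (α; β)
    open Spheres R x
    open Eulerian R α β s
    open import Relation.Binary.Reasoning.Setoid setoid

    -- The sets σ index faces of the facet with vertices 1, 2, …, d + n, where
    -- the first d vertices are not in the face; the link is a join of spheres,
    -- one for each maximal gap.
    Q : ∀ {n} → ℕ → Subset n → Carrier
    Q d []          = F d
    Q d (true  ∷ σ) = E (suc d) * Q 0 σ
    Q d (false ∷ σ) = Q (suc d) σ

    module _ {k} (b : Subset k → Carrier) where

      -- One event, seen on the links `a` of the faces without the pole. The links `b` of the faces
      -- with the pole never change, so `a` is the whole state.
      step : ℕ → (Subset k → Carrier) → Subset k → Carrier
      step i a σ = if member σ i then α * b σ else a σ + β * b (insert i σ)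

      run : List ℕ → (Subset k → Carrier) → Subset k → Carrier
      run []       a = a
      run (i ∷ is) a = run is (step i a)

      run-++ : ∀ is js a → run (is ++ js) a ≡ run js (run is a)
      run-++ []       js a = refl
      run-++ (i ∷ is) js a = run-++ is js (step i a)

      run-disjoint : ∀ {σ} is a → All (λ i → member σ i ≡ false) is →
                     run is a σ ≈ a σ + β * Σ[ is ] (λ i → b (insert i σ))
      run-disjoint {σ} []       a []       = sym (trans (+-congˡ (zeroʳ β)) (+-identityʳ (a σ)))
      run-disjoint {σ} (i ∷ is) a (p ∷ ps) = begin
        run is (step i a) σ
          ≈⟨ run-disjoint is (step i a) ps ⟩
        step i a σ + β * Σ[ is ] (λ i → b (insert i σ))
          ≡⟨ cong (λ c → (if c then α * b σ else a σ + β * b (insert i σ)) + β * Σ[ is ] (λ i → b (insert i σ))) p ⟩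
        (a σ + β * b (insert i σ)) + β * Σ[ is ] (λ i → b (insert i σ))
          ≈⟨ trans (+-assoc _ _ _) (+-congˡ (sym (distribˡ β _ _))) ⟩
        a σ + β * (b (insert i σ) + Σ[ is ] (λ i → b (insert i σ))) ∎

      -- Only the events after the one at the least element of σ matter.
      run-Ω : ∀ {σ j} l a → Least σ j → j < suc l →
              run (l ∷ Ω l) a σ ≈ α * b σ + β * Σ[ Ω j ] (λ i → b (insert i σ))
      run-Ω {σ} {j} l a least (s≤s j≤l) with ℕ.m≤n⇒m<n∨m≡n j≤l
      ... | inj₂ refl = trans (run-disjoint (Ω j) (step j a) (All.map (below-least least) (Ω-< j)))
        (+-congʳ (reflexive (cong (λ c → if c then α * b σ else a σ + β * b (insert j σ)) (least-member least))))
      run-Ω {σ} {j} (suc l) a least _ | inj₁ j<l = trans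
        (reflexive (cong (λ f → f σ) (run-++ (0 ∷ List.map suc (Ω l)) (l ∷ Ω l) (step (suc l) a))))
        (run-Ω l (run (0 ∷ List.map suc (Ω l)) (step (suc l) a)) least j<l)

      joint : (Subset k → Carrier) → Subset (suc k) → Carrier
      joint a (true  ∷ σ) = b σ
      joint a (false ∷ σ) = a σ

      runSphere : ∀ is → All (_< k) is → ∀ a → Sphere (suc k) (joint a) → Sphere (suc k) (joint (run is a))
      runSphere []       []       a S = S
      runSphere (i ∷ is) (p ∷ ps) a S = runSphere is ps (step i a) (Sphere-cong translate (eventSphere (Fin.fromℕ< p) S))
        where
        j : Fin k
        j = Fin.fromℕ< p
        translate : ∀ σ → event j (joint a) σ ≈ joint (step i a) σ
        translate (true ∷ σ)  = R.refl
        translate (false ∷ σ) = reflexive (≡.trans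
          (cong₂ (λ c τ → if c then α * b σ else a σ + β * b τ) (≡.sym (member-toℕ σ j)) (≡.sym (insert-toℕ σ j)))
          (cong (λ i → step i a σ) (Fin.toℕ-fromℕ< p)))

    rest : ∀ {n} → Subset n → ℕ → Carrier
    rest []      j       = 0#
    rest (c ∷ σ) zero    = Q 0 σ
    rest (c ∷ σ) (suc j) = rest σ j

    Q-least : ∀ {n} {σ : Subset n} {j} d → Least σ j → Q d σ ≡ E (suc (d ℕ.+ j)) * rest σ j
    Q-least {σ = true ∷ σ}  d here            = cong (λ e → E (suc e) * Q 0 σ) (≡.sym (ℕ.+-identityʳ d))
    Q-least {σ = false ∷ σ} {suc j} d (there least) =
      ≡.trans (Q-least (suc d) least) (cong (λ e → E (suc e) * rest σ j) (≡.sym (ℕ.+-suc d j)))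

    -- Inserting i splits the first gap: the d + i positions before it give one factor E, the j - i
    -- - 1 positions between i and j the other.
    Q-insert : ∀ {n} {σ : Subset n} {j} d i → Least σ j → i < j →
               Q d (insert i σ) ≡ E (suc (d ℕ.+ i)) * (E (j ∸ i) * rest σ j)
    Q-insert {σ = false ∷ σ} {suc j} d zero    (there least) _ =
      cong₂ (λ e q → E (suc e) * q) (≡.sym (ℕ.+-identityʳ d)) (Q-least 0 least)
    Q-insert {σ = false ∷ σ} {suc j} d (suc i) (there least) (s≤s p) =
      ≡.trans (Q-insert (suc d) i least p) (cong (λ e → E (suc e) * (E (j ∸ i) * rest σ j)) (≡.sym (ℕ.+-suc d i)))

    Q-∅ : ∀ n d → Q d (∅ n) ≡ F (d ℕ.+ n)
    Q-∅ zero    d = cong F (≡.sym (ℕ.+-identityʳ d))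
    Q-∅ (suc n) d = ≡.trans (Q-∅ n (suc d)) (cong F (≡.sym (ℕ.+-suc d n)))

    Q-insert-∅ : ∀ n d i → i < n → Q d (insert i (∅ n)) ≡ E (suc (d ℕ.+ i)) * F (n ∸ suc i)
    Q-insert-∅ (suc n) d zero    _       = cong₂ (λ e q → E (suc e) * q) (≡.sym (ℕ.+-identityʳ d)) (Q-∅ n 0)
    Q-insert-∅ (suc n) d (suc i) (s≤s p) =
      ≡.trans (Q-insert-∅ n (suc d) i p) (cong (λ e → E (suc e) * F (n ∸ suc i)) (≡.sym (ℕ.+-suc d i)))

    -- For the empty face no event resets the link, every event adds its term, and `F-step` sums
    -- them up. For any other face the prefix `pre` with the extra repetitions is forgotten, and the
    -- closing events realize `E-step` on the first gap, with the remaining gaps as a common factor.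
    run-word : ∀ k (σ : Subset k) → run (Q 0) (word s k) (λ σ → α * Q 0 σ) σ ≈ Q 1 σ
    run-word k σ with ∅-or-least σ
    run-word zero σ | inj₁ refl = trans (*-congˡ F₀) (trans (*-identityʳ α) (sym F₁))
    run-word (suc n) σ | inj₁ refl = begin
      run (Q 0) (word s (suc n)) (λ σ → α * Q 0 σ) (∅ (suc n))
        ≈⟨ run-disjoint (Q 0) (word s (suc n)) (λ σ → α * Q 0 σ) (All.universal (member-∅ (suc n)) _) ⟩
      α * Q 0 (∅ (suc n)) + β * Σ[ word s (suc n) ] (λ i → Q 0 (insert i (∅ (suc n))))
        ≈⟨ +-cong (*-congˡ (reflexive (Q-∅ (suc n) 0))) (*-congˡ (Σ-cong (All.map (λ p → reflexive (Q-insert-∅ (suc n) 0 _ p)) (word-< s (suc n))))) ⟩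
      α * F (suc n) + β * Σ[ word s (suc n) ] (λ i → E (suc i) * F (n ∸ i))
        ≈⟨ F-step n ⟨
      F (2 ℕ.+ n)
        ≡⟨ Q-∅ (suc n) 1 ⟨
      Q 1 (∅ (suc n)) ∎
    run-word (suc n) σ | inj₂ (j , least , j<k) = begin
      run (Q 0) (word s (suc n)) (λ σ → α * Q 0 σ) σ
        ≡⟨ cong (λ f → f σ) (run-++ (Q 0) pre (n ∷ Ω n) (λ σ → α * Q 0 σ)) ⟩
      run (Q 0) (n ∷ Ω n) (run (Q 0) pre (λ σ → α * Q 0 σ)) σ
        ≈⟨ run-Ω (Q 0) n (run (Q 0) pre (λ σ → α * Q 0 σ)) least j<k ⟩
      α * Q 0 σ + β * Σ[ Ω j ] (λ i → Q 0 (insert i σ))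
        ≈⟨ +-cong (*-congˡ (reflexive (Q-least 0 least)))
             (*-congˡ (Σ-cong (All.map (λ {i} p → trans (reflexive (Q-insert 0 i least p)) (sym (*-assoc _ _ _))) (Ω-< j)))) ⟩
      α * (E (suc j) * ρ) + β * Σ[ Ω j ] (λ i → (E (suc i) * E (j ∸ i)) * ρ)
        ≈⟨ +-cong (sym (*-assoc _ _ _)) (trans (*-congˡ (sym (Σ-*ʳ (Ω j) _ ρ))) (sym (*-assoc _ _ _))) ⟩
      (α * E (suc j)) * ρ + (β * Σ[ Ω j ] (λ i → E (suc i) * E (j ∸ i))) * ρ
        ≈⟨ trans (*-congʳ (E-step j)) (distribʳ ρ _ _) ⟨
      E (2 ℕ.+ j) * ρ
        ≡⟨ Q-least 1 least ⟨
      Q 1 σ ∎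
      where
      ρ : Carrier
      ρ = rest σ j
      pre : List ℕ
      pre = List.concatMap (λ i → List.replicate (ℕ.pred (difference s (suc i))) i) (n ∷ Ω n)

    -- The pole becomes the first vertex of the next facet. For faces containing it the first gap is
    -- empty and contributes `E 1 = 1`; for the others the first gap is longer by one position,
    -- which turns `Q 0` into `Q 1`.
    eulerianSphere : ∀ k → Sphere k (Q 0)
    eulerianSphere zero    = Sphere-cong (λ { [] → sym F₀ }) pointSphere
    eulerianSphere (suc k) = Sphere-cong final
      (runSphere (Q 0) (word s k) (word-< s k) (λ σ → α * Q 0 σ) (Sphere-cong initial (suspendSphere (eulerianSphere k))))
      where
      initial : ∀ σ → suspended (Q 0) σ ≈ joint (Q 0) (λ σ → α * Q 0 σ) σ
      initial (true ∷ σ)  = R.refl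
      initial (false ∷ σ) = R.refl
      final : ∀ σ → joint (Q 0) (run (Q 0) (word s k) (λ σ → α * Q 0 σ)) σ ≈ Q 0 σ
      final (true ∷ σ)  = sym (trans (*-congʳ E₁) (*-identityˡ _))
      final (false ∷ σ) = run-word k σ

    eulerianSphere-∅ : ∀ k → Q 0 (∅ k) ≈ F k
    eulerianSphere-∅ k = reflexive (Q-∅ k 0)

-- From f-polynomials to h-polynomials, and from weights to γ-vectors.

module GammaPolynomials where

  open import Defs
  open ExponentialSeries
  open Polynomials
  open EulerianRecursion
  open DescentEnumeration
  open DescentSeriesEquation
  open BinomialEulerian
  open RationalGeometry
  open import Algebra.Bundles using (CommutativeRing)
  import Algebra.Construct.DirectProduct as DirectProduct
  open import Level using (0ℓ)
  open import Data.Fin.Base using (zero; suc; toℕ)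
  open import Data.Integer.Base as ℤ using (ℤ; 0ℤ; 1ℤ; +_)
  import Data.Integer.Properties as ℤ
  open import Data.List.Base using ([]; _∷_)
  open import Data.Nat.Base as ℕ using (ℕ; zero; suc; _∸_; _<_; z≤n; s≤s; ⌊_/2⌋)
  import Data.Nat.Properties as ℕ
  open import Data.Product.Base using (_×_; _,_; proj₁; proj₂; Σ-syntax)
  open import Data.Sum.Base using (inj₁; inj₂)
  open import Function.Base using (_∘_)
  open import Relation.Binary.PropositionalEquality as ≡ using (_≡_; refl; cong; cong₂)

  -- A `Γ` derivation over the product ring evaluates one expression in α and β in both rings at
  -- once, which makes the two values comparable by induction on the derivation.
  module EulerianProduct (R S : CommutativeRing 0ℓ 0ℓ)
    (α₁ β₁ : CommutativeRing.Carrier R) (α₂ β₂ : CommutativeRing.Carrier S) (s : ℕ) where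

    R×S : CommutativeRing 0ℓ 0ℓ
    R×S = DirectProduct.commutativeRing R S

    private
      module R = CommutativeRing R
      module S = CommutativeRing S
      module H₁ = Hurwitz R
      module H₂ = Hurwitz S
      module H  = Hurwitz R×S
      module E₁ = Eulerian R α₁ β₁ s
      module E₂ = Eulerian S α₂ β₂ s
    open Eulerian R×S (α₁ , α₂) (β₁ , β₂) s public renaming (_·′_ to _·″_)

    ⊛-proj : ∀ f g n → (f H.⊛ g) n ≡ (((proj₁ ∘ f) H₁.⊛ (proj₁ ∘ g)) n , ((proj₂ ∘ f) H₂.⊛ (proj₂ ∘ g)) n)
    ⊛-proj f g zero    = refl
    ⊛-proj f g (suc n) = cong₂ (λ p q → (proj₁ p R.+ proj₁ q) , (proj₂ p S.+ proj₂ q)) (⊛-proj (H.∂ f) g n) (⊛-proj f (H.∂ g) n)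

    ·-proj : ∀ n p → n ·″ p ≡ ((n E₁.·′ proj₁ p) , (n E₂.·′ proj₂ p))
    ·-proj zero    p = refl
    ·-proj (suc n) p = cong (λ q → (proj₁ p R.+ proj₁ q) , (proj₂ p S.+ proj₂ q)) (·-proj n p)

    const-proj : ∀ n → H.const (R.1# , S.1#) n ≡ (H₁.const R.1# n , H₂.const S.1# n)
    const-proj zero    = refl
    const-proj (suc n) = refl

    E-proj₁ : ∀ n → proj₁ (E n) R.≈ E₁.E n
    E-proj₁ = E₁.E-unique (proj₁ E₀) λ n → R.trans (proj₁ (∂E n)) (R.reflexive
      (cong₂ (λ c p → proj₁ c R.+ α₁ R.* proj₁ (E n) R.+ β₁ R.* proj₁ p) (const-proj n) (⊛-proj E E n)))

    E-proj₂ : ∀ n → proj₂ (E n) S.≈ E₂.E n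
    E-proj₂ = E₂.E-unique (proj₂ E₀) λ n → S.trans (proj₂ (∂E n)) (S.reflexive
      (cong₂ (λ c p → proj₂ c S.+ α₂ S.* proj₂ (E n) S.+ β₂ S.* proj₂ p) (const-proj n) (⊛-proj E E n)))

    F-proj₁ : ∀ n → proj₁ (F n) R.≈ E₁.F n
    F-proj₁ = E₁.F-unique (proj₁ F₀) λ n → R.trans (proj₁ (∂F n)) (R.+-congˡ (R.*-congˡ (R.trans
      (R.reflexive (cong proj₁ (⊛-proj K F n)))
      (H₁.⊛-cong (λ j → R.trans (R.reflexive (cong proj₁ (·-proj (difference s j) (E j)))) (Mult.×-congʳ (difference s j) (E-proj₁ j))) (λ _ → R.refl) n))))
      where import Algebra.Properties.Semiring.Mult R.semiring as Mult

    F-proj₂ : ∀ n → proj₂ (F n) S.≈ E₂.F n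
    F-proj₂ = E₂.F-unique (proj₂ F₀) λ n → S.trans (proj₂ (∂F n)) (S.+-congˡ (S.*-congˡ (S.trans
      (S.reflexive (cong proj₂ (⊛-proj K F n)))
      (H₂.⊛-cong (λ j → S.trans (S.reflexive (cong proj₂ (·-proj (difference s j) (E j)))) (Mult.×-congʳ (difference s j) (E-proj₂ j))) (λ _ → S.refl) n))))
      where import Algebra.Properties.Semiring.Mult S.semiring as Mult

  -- The substitution x = t / (1 - t), multiplied by (1 - t)ⁿ.
  module Substitution (R : CommutativeRing 0ℓ 0ℓ) (t : CommutativeRing.Carrier R)
    (constant : ℤ → CommutativeRing.Carrier R)
    (constant-+ : ∀ a b → CommutativeRing._≈_ R (constant (a ℤ.+ b)) (CommutativeRing._+_ R (constant a) (constant b)))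
    (constant-0 : CommutativeRing._≈_ R (constant 0ℤ) (CommutativeRing.0# R)) where
    private module R = CommutativeRing R
    open CommutativeRing R hiding (zero; refl)
    open IntegerSolver R renaming (solve to solveᴿ; _:=_ to _:=ᴿ_; _:+_ to _:+ᴿ_; _:*_ to _:*ᴿ_; :0 to :0ᴿ; :1 to :1ᴿ) using ()
    open import Algebra.Properties.Semiring.Exp semiring using () renaming (_^_ to _^″_)

    private
      u : Carrier
      u = 1# - t

    -- The sum of c i tⁱ (1 - t)ⁿ⁻ⁱ in Horner form.
    Tr : ℕ → (ℕ → ℤ) → Carrier
    Tr zero    c = constant (c 0)
    Tr (suc n) c = constant (c 0) * u ^″ suc n + t * Tr n (c ∘ suc)

    Tr-cong : ∀ n {c d} → (∀ i → c i ≡ d i) → Tr n c ≈ Tr n d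
    Tr-cong zero    p = reflexive (cong constant (p 0))
    Tr-cong (suc n) p = +-cong (*-congʳ (reflexive (cong constant (p 0)))) (*-congˡ (Tr-cong n (p ∘ suc)))

    Tr-+ : ∀ n c d → Tr n (λ i → c i ℤ.+ d i) ≈ Tr n c + Tr n d
    Tr-+ zero    c d = constant-+ (c 0) (d 0)
    Tr-+ (suc n) c d = trans
      (+-cong (*-congʳ (constant-+ (c 0) (d 0))) (*-congˡ (Tr-+ n (c ∘ suc) (d ∘ suc))))
      (solveᴿ 6 (λ a b z x p q → (a :+ᴿ b) :*ᴿ z :+ᴿ x :*ᴿ (p :+ᴿ q) :=ᴿ (a :*ᴿ z :+ᴿ x :*ᴿ p) :+ᴿ (b :*ᴿ z :+ᴿ x :*ᴿ q)) R.refl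
        (constant (c 0)) (constant (d 0)) (u ^″ suc n) t (Tr n (c ∘ suc)) (Tr n (d ∘ suc)))

    Tr-0 : ∀ n → Tr n (λ _ → 0ℤ) ≈ 0#
    Tr-0 zero    = constant-0
    Tr-0 (suc n) = trans (+-cong (trans (*-congʳ constant-0) (zeroˡ _)) (trans (*-congˡ (Tr-0 n)) (zeroʳ t))) (+-identityˡ _)

    Tr-shift : ∀ n {c} → c 0 ≡ 0ℤ → Tr (suc n) c ≈ t * Tr n (c ∘ suc)
    Tr-shift n c₀ = trans (+-congʳ (trans (*-congʳ (trans (reflexive (cong constant c₀)) constant-0)) (zeroˡ _))) (+-identityˡ _)

    -- Homogenizing in one degree more multiplies by 1 - t, provided that no coefficient of index n
    -- + 1 comes in. This is why degree bounds accompany the transform in `Γ⇒Tr`.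
    Tr-raise : ∀ n c → c (suc n) ≡ 0ℤ → Tr (suc n) c ≈ u * Tr n c
    Tr-raise zero c c₁ = trans
      (+-congˡ (trans (*-congˡ (trans (reflexive (cong constant c₁)) constant-0)) (zeroʳ t)))
      (solveᴿ 2 (λ c y → c :*ᴿ (y :*ᴿ :1ᴿ) :+ᴿ :0ᴿ :=ᴿ y :*ᴿ c) R.refl (constant (c 0)) u)
    Tr-raise (suc n) c cₙ = trans
      (+-congˡ (*-congˡ (Tr-raise n (c ∘ suc) cₙ)))
      (solveᴿ 5 (λ c y z x p → c :*ᴿ (y :*ᴿ z) :+ᴿ x :*ᴿ (y :*ᴿ p) :=ᴿ y :*ᴿ (c :*ᴿ z :+ᴿ x :*ᴿ p)) R.refl
        (constant (c 0)) u (u ^″ suc n) t (Tr n (c ∘ suc)))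

  module GammaSubstitution
    (R : CommutativeRing 0ℓ 0ℓ) (x : CommutativeRing.Carrier R)
    (coef : CommutativeRing.Carrier R → ℕ → ℤ)
    (coef-cong : ∀ {p q} → CommutativeRing._≈_ R p q → ∀ k → coef p k ≡ coef q k)
    (coef-0 : ∀ k → coef (CommutativeRing.0# R) k ≡ 0ℤ)
    (coef-1-0 : coef (CommutativeRing.1# R) 0 ≡ 1ℤ)
    (coef-1-suc : ∀ k → coef (CommutativeRing.1# R) (suc k) ≡ 0ℤ)
    (coef-+ : ∀ p q k → coef (CommutativeRing._+_ R p q) k ≡ coef p k ℤ.+ coef q k)
    (coef-x*-0 : ∀ p → coef (CommutativeRing._*_ R x p) 0 ≡ 0ℤ)
    (coef-x*-suc : ∀ p k → coef (CommutativeRing._*_ R x p) (suc k) ≡ coef p k)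
    (S : CommutativeRing 0ℓ 0ℓ) (t : CommutativeRing.Carrier S)
    (constant : ℤ → CommutativeRing.Carrier S)
    (constant-+ : ∀ a b → CommutativeRing._≈_ S (constant (a ℤ.+ b)) (CommutativeRing._+_ S (constant a) (constant b)))
    (constant-0 : CommutativeRing._≈_ S (constant 0ℤ) (CommutativeRing.0# S))
    (constant-1 : CommutativeRing._≈_ S (constant 1ℤ) (CommutativeRing.1# S))
    (s : ℕ) where

    private
      module R = CommutativeRing R
      module S = CommutativeRing S
      module Rˢ = IntegerSolver R
      module Sˢ = IntegerSolver S
    open Substitution S t constant constant-+ constant-0 public

    αₓ βₓ : R.Carrier
    αₓ = R.1# R.+ (x R.+ x)
    βₓ = x R.+ x R.* x

    αₜ : S.Carrier
    αₜ = S.1# S.+ t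

    open EulerianProduct R S αₓ βₓ αₜ t s

    Bounded : ℕ → R.Carrier → Set
    Bounded n p = ∀ k → n < k → coef p k ≡ 0ℤ

    bounded-+ : ∀ {n} p q → Bounded n p → Bounded n q → Bounded n (p R.+ q)
    bounded-+ p q f g k l = ≡.trans (coef-+ p q k) (cong₂ ℤ._+_ (f k l) (g k l))

    bounded-x* : ∀ {n} p → Bounded n p → Bounded (suc n) (x R.* p)
    bounded-x* p f (suc k) (s≤s l) = ≡.trans (coef-x*-suc p k) (f k l)

    bounded-suc : ∀ {n p} → Bounded n p → Bounded (suc n) p
    bounded-suc f k l = f k (ℕ.<-trans (ℕ.n<1+n _) l)

    bounded-≈ : ∀ {n p q} → p R.≈ q → Bounded n p → Bounded n q
    bounded-≈ e f k l = ≡.trans (≡.sym (coef-cong e k)) (f k l)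

    Tr-≈ : ∀ n {p q} → p R.≈ q → Tr n (coef p) S.≈ Tr n (coef q)
    Tr-≈ n e = Tr-cong n (coef-cong e)

    Tr-x* : ∀ n p → Tr (suc n) (coef (x R.* p)) S.≈ t S.* Tr n (coef p)
    Tr-x* n p = S.trans (Tr-shift n {coef (x R.* p)} (coef-x*-0 p)) (S.*-congˡ (Tr-cong n (coef-x*-suc p)))

    Tr-plus : ∀ n p q → Tr n (coef (p R.+ q)) S.≈ Tr n (coef p) S.+ Tr n (coef q)
    Tr-plus n p q = S.trans (Tr-cong n (coef-+ p q)) (Tr-+ n (coef p) (coef q))

    -- Raising the degree gives 1 - t, and multiplication by x gives t. So 1 + 2x becomes (1 - t) +
    -- 2t = 1 + t in one degree more, and x (1 + x) becomes t ((1 - t) + t) = t in two degrees more.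
    Γ⇒Tr : ∀ {n z} → Γ n z → Bounded n (proj₁ z) × Tr n (coef (proj₁ z)) S.≈ proj₂ z
    Γ⇒Tr Γ-1 = (λ { (suc k) _ → coef-1-suc k }) , S.trans (S.reflexive (cong constant coef-1-0)) constant-1
    Γ⇒Tr (Γ-α {n} {p , q} g) with Γ⇒Tr g
    ... | bound , eq = bounded-≈ (R.sym expand)
          (bounded-+ p (x R.* p R.+ x R.* p) (bounded-suc {p = p} bound) (bounded-+ (x R.* p) (x R.* p) (bounded-x* p bound) (bounded-x* p bound)))
      , (begin
        Tr (suc n) (coef (αₓ R.* p))                         ≈⟨ Tr-≈ (suc n) expand ⟩
        Tr (suc n) (coef (p R.+ (x R.* p R.+ x R.* p)))      ≈⟨ S.trans (Tr-plus (suc n) p _) (S.+-congˡ (Tr-plus (suc n) (x R.* p) (x R.* p))) ⟩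
        Tr (suc n) (coef p) S.+ (Tr (suc n) (coef (x R.* p)) S.+ Tr (suc n) (coef (x R.* p)))
          ≈⟨ S.+-cong (S.trans (Tr-raise n (coef p) (bound (suc n) ℕ.≤-refl)) (S.*-congˡ eq))
                      (S.+-cong (S.trans (Tr-x* n p) (S.*-congˡ eq)) (S.trans (Tr-x* n p) (S.*-congˡ eq))) ⟩
        (S.1# S.- t) S.* q S.+ (t S.* q S.+ t S.* q)         ≈⟨ Sˢ.solve 2 (λ x q → (Sˢ.:1 Sˢ.:- x) Sˢ.:* q Sˢ.:+ (x Sˢ.:* q Sˢ.:+ x Sˢ.:* q) Sˢ.:= (Sˢ.:1 Sˢ.:+ x) Sˢ.:* q) S.refl t q ⟩
        αₜ S.* q                                             ∎)
      where
      open import Relation.Binary.Reasoning.Setoid S.setoid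
      expand : αₓ R.* p R.≈ p R.+ (x R.* p R.+ x R.* p)
      expand = Rˢ.solve 2 (λ x p → (Rˢ.:1 Rˢ.:+ (x Rˢ.:+ x)) Rˢ.:* p Rˢ.:= p Rˢ.:+ (x Rˢ.:* p Rˢ.:+ x Rˢ.:* p)) R.refl x p
    Γ⇒Tr (Γ-β {n} {p , q} g) with Γ⇒Tr g
    ... | bound , eq = bounded-≈ (R.sym expand) (bounded-x* (p R.+ x R.* p) (bounded-+ p (x R.* p) (bounded-suc {p = p} bound) (bounded-x* p bound)))
      , (begin
        Tr (2 ℕ.+ n) (coef (βₓ R.* p))                       ≈⟨ Tr-≈ (2 ℕ.+ n) expand ⟩
        Tr (2 ℕ.+ n) (coef (x R.* (p R.+ x R.* p)))          ≈⟨ Tr-x* (suc n) (p R.+ x R.* p) ⟩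
        t S.* Tr (suc n) (coef (p R.+ x R.* p))              ≈⟨ S.*-congˡ (Tr-plus (suc n) p (x R.* p)) ⟩
        t S.* (Tr (suc n) (coef p) S.+ Tr (suc n) (coef (x R.* p)))
          ≈⟨ S.*-congˡ (S.+-cong (S.trans (Tr-raise n (coef p) (bound (suc n) ℕ.≤-refl)) (S.*-congˡ eq)) (S.trans (Tr-x* n p) (S.*-congˡ eq))) ⟩
        t S.* ((S.1# S.- t) S.* q S.+ t S.* q)               ≈⟨ Sˢ.solve 2 (λ x q → x Sˢ.:* ((Sˢ.:1 Sˢ.:- x) Sˢ.:* q Sˢ.:+ x Sˢ.:* q) Sˢ.:= x Sˢ.:* q) S.refl t q ⟩
        t S.* q                                              ∎)
      where
      open import Relation.Binary.Reasoning.Setoid S.setoid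
      expand : βₓ R.* p R.≈ x R.* (p R.+ x R.* p)
      expand = Rˢ.solve 2 (λ x p → (x Rˢ.:+ x Rˢ.:* x) Rˢ.:* p Rˢ.:= x Rˢ.:* (p Rˢ.:+ x Rˢ.:* p)) R.refl x p
    Γ⇒Tr (Γ-0 {n}) = (λ k _ → coef-0 k) , S.trans (Tr-cong n coef-0) (Tr-0 n)
    Γ⇒Tr (Γ-+ {n} {p , q} {p′ , q′} g h) with Γ⇒Tr g | Γ⇒Tr h
    ... | bound , eq | bound′ , eq′ = bounded-+ p p′ bound bound′ , S.trans (Tr-plus n p p′) (S.+-cong eq eq′)
    Γ⇒Tr (Γ-≈ {n} (e , e′) g) with Γ⇒Tr g
    ... | bound , eq = bounded-≈ e bound , S.trans (Tr-≈ n (R.sym e)) (S.trans eq e′)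

    F-substitution : ∀ n → Tr n (coef (Eulerian.F R αₓ βₓ s n)) S.≈ Eulerian.F S αₜ t s n
    F-substitution n = S.trans (Tr-≈ n (R.sym (F-proj₁ n))) (S.trans (proj₂ (Γ⇒Tr (Γ-F n))) (F-proj₂ n))

  module GammaExpansion (R : CommutativeRing 0ℓ 0ℓ) (t : CommutativeRing.Carrier R) (s : ℕ) where
    open CommutativeRing R hiding (zero; refl)
    private module R = CommutativeRing R
    open IntegerSolver R
    open import Algebra.Properties.Semiring.Sum semiring using (sum; sum-cong-≋; ∑-distrib-+; *-distribˡ-sum)
    open import Algebra.Properties.Semiring.Mult semiring using (×-congʳ; ×-homo-+; ×-comm-*) renaming (_×_ to _·′_)
    open import Algebra.Properties.Semiring.Exp semiring using () renaming (_^_ to _^′_)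

    αₜ : Carrier
    αₜ = 1# + t

    open Eulerian R αₜ t s using (Γ; Γ-1; Γ-α; Γ-β; Γ-0; Γ-+; Γ-≈)
    open Binomial R using (sum-last)

    monomial : ℕ → ℕ → Carrier
    monomial d i = (t ^′ i) * (αₜ ^′ (d ∸ 2 ℕ.* i))

    -- Sums run up to i = d; the terms beyond d / 2 vanish.
    Expansion : ℕ → Carrier → Set
    Expansion d q = Σ[ γ ∈ (ℕ → ℕ) ] (∀ i → d < 2 ℕ.* i → γ i ≡ 0) × q ≈ sum {suc d} (λ i → γ (toℕ i) ·′ monomial d (toℕ i))

    private
      vanishing : ∀ {k} p → k ≡ 0 → k ·′ p ≈ 0#
      vanishing p refl = R.refl

      double-suc : ∀ i → 2 ℕ.* suc i ≡ 2 ℕ.+ 2 ℕ.* i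
      double-suc i = cong suc (ℕ.+-suc i (i ℕ.+ 0))

    Γ⇒Expansion : ∀ {d q} → Γ d q → Expansion d q
    Γ⇒Expansion Γ-1 = (λ { zero → 1 ; (suc i) → 0 }) , (λ { (suc i) _ → refl })
      , solve 0 (:1 := (:1 :* :1 :+ :0) :+ :0) R.refl
    Γ⇒Expansion (Γ-α {d} {q} g) with Γ⇒Expansion g
    ... | γ , zeros , eq = γ , (λ i l → zeros i (ℕ.<-trans (ℕ.n<1+n d) l)) , (begin
        αₜ * q
          ≈⟨ R.*-congˡ {αₜ} eq ⟩
        αₜ * sum {suc d} (λ i → γ (toℕ i) ·′ monomial d (toℕ i))
          ≈⟨ *-distribˡ-sum {suc d} αₜ (λ i → γ (toℕ i) ·′ monomial d (toℕ i)) ⟩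
        sum {suc d} (λ i → αₜ * (γ (toℕ i) ·′ monomial d (toℕ i)))
          ≈⟨ sum-cong-≋ {n = suc d} (λ i → raise (toℕ i)) ⟩
        sum {suc d} (λ i → γ (toℕ i) ·′ monomial (suc d) (toℕ i))
          ≈⟨ R.+-identityʳ _ ⟨
        sum {suc d} (λ i → γ (toℕ i) ·′ monomial (suc d) (toℕ i)) + 0#
          ≈⟨ R.+-congˡ {sum {suc d} (λ i → γ (toℕ i) ·′ monomial (suc d) (toℕ i))} (vanishing (monomial (suc d) (suc d)) (zeros (suc d) (ℕ.m≤m+n (suc d) _))) ⟨
        sum {suc d} (λ i → γ (toℕ i) ·′ monomial (suc d) (toℕ i)) + γ (suc d) ·′ monomial (suc d) (suc d)
          ≈⟨ sum-last (suc d) (λ i → γ i ·′ monomial (suc d) i) ⟨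
        sum {2 ℕ.+ d} (λ i → γ (toℕ i) ·′ monomial (suc d) (toℕ i)) ∎)
      where
      open import Relation.Binary.Reasoning.Setoid setoid
      -- For 2 i > d the truncated exponent does not grow with d, but there γ i is zero.
      raise : ∀ i → αₜ * (γ i ·′ monomial d i) ≈ γ i ·′ monomial (suc d) i
      raise i with ℕ.≤-<-connex (2 ℕ.* i) d
      ... | inj₁ 2i≤d = R.trans (×-comm-* (γ i) αₜ (monomial d i)) (×-congʳ (γ i)
            (R.trans (solve 3 (λ a x y → a :* (x :* y) := x :* (a :* y)) R.refl αₜ (t ^′ i) (αₜ ^′ (d ∸ 2 ℕ.* i)))
              (R.*-congˡ {t ^′ i} (R.reflexive (cong (αₜ ^′_) (≡.sym (ℕ.+-∸-assoc 1 2i≤d)))))))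
      ... | inj₂ d<2i = R.trans (R.trans (R.*-congˡ {αₜ} (vanishing (monomial d i) (zeros i d<2i))) (R.zeroʳ αₜ))
                          (R.sym (vanishing (monomial (suc d) i) (zeros i d<2i)))
    Γ⇒Expansion (Γ-β {d} {q} g) with Γ⇒Expansion g
    ... | γ , zeros , eq = γ′ , zeros′ , (begin
        t * q
          ≈⟨ R.*-congˡ {t} eq ⟩
        t * sum {suc d} (λ i → γ (toℕ i) ·′ monomial d (toℕ i))
          ≈⟨ *-distribˡ-sum {suc d} t (λ i → γ (toℕ i) ·′ monomial d (toℕ i)) ⟩
        sum {suc d} (λ i → t * (γ (toℕ i) ·′ monomial d (toℕ i)))
          ≈⟨ sum-cong-≋ {n = suc d} (λ i → shift (toℕ i)) ⟩
        sum {suc d} (λ i → γ (toℕ i) ·′ monomial (2 ℕ.+ d) (suc (toℕ i)))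
          ≈⟨ R.+-identityʳ _ ⟨
        sum {suc d} (λ i → γ (toℕ i) ·′ monomial (2 ℕ.+ d) (suc (toℕ i))) + 0#
          ≈⟨ R.+-congˡ {sum {suc d} (λ i → γ (toℕ i) ·′ monomial (2 ℕ.+ d) (suc (toℕ i)))}
               (vanishing (monomial (2 ℕ.+ d) (2 ℕ.+ d)) (zeros (suc d) (ℕ.m≤m+n (suc d) _))) ⟨
        sum {suc d} (λ i → γ (toℕ i) ·′ monomial (2 ℕ.+ d) (suc (toℕ i))) + γ (suc d) ·′ monomial (2 ℕ.+ d) (2 ℕ.+ d)
          ≈⟨ sum-last (suc d) (λ i → γ i ·′ monomial (2 ℕ.+ d) (suc i)) ⟨
        sum {2 ℕ.+ d} (λ i → γ (toℕ i) ·′ monomial (2 ℕ.+ d) (suc (toℕ i)))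
          ≈⟨ R.+-identityˡ _ ⟨
        sum {3 ℕ.+ d} (λ i → γ′ (toℕ i) ·′ monomial (2 ℕ.+ d) (toℕ i)) ∎)
      where
      open import Relation.Binary.Reasoning.Setoid setoid
      γ′ : ℕ → ℕ
      γ′ zero    = 0
      γ′ (suc i) = γ i
      zeros′ : ∀ i → 2 ℕ.+ d < 2 ℕ.* i → γ′ i ≡ 0
      zeros′ (suc i) l = zeros i (ℕ.≤-pred (ℕ.≤-pred (≡.subst (2 ℕ.+ d <_) (double-suc i) l)))
      shift : ∀ i → t * (γ i ·′ monomial d i) ≈ γ i ·′ monomial (2 ℕ.+ d) (suc i)
      shift i = R.trans (×-comm-* (γ i) t (monomial d i)) (×-congʳ (γ i)
        (R.trans (R.sym (R.*-assoc t (t ^′ i) _))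
          (R.*-congˡ {t * (t ^′ i)} (R.reflexive (cong (λ k → αₜ ^′ (2 ℕ.+ d ∸ k)) (≡.sym (double-suc i)))))))
    Γ⇒Expansion (Γ-0 {d}) = (λ _ → 0) , (λ _ _ → refl) , R.sym (Enumeration.sum-0 R t (suc d) λ _ → R.refl)
    Γ⇒Expansion (Γ-+ {d} g h) with Γ⇒Expansion g | Γ⇒Expansion h
    ... | γ , zeros , eq | δ , zeros′ , eq′ = (λ i → γ i ℕ.+ δ i) , (λ i l → cong₂ ℕ._+_ (zeros i l) (zeros′ i l))
      , R.trans (R.+-cong eq eq′) (R.trans
          (R.sym (∑-distrib-+ {suc d} (λ i → γ (toℕ i) ·′ monomial d (toℕ i)) (λ i → δ (toℕ i) ·′ monomial d (toℕ i))))
          (sum-cong-≋ {n = suc d} λ i → R.sym (×-homo-+ (monomial d (toℕ i)) (γ (toℕ i)) (δ (toℕ i)))))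
    Γ⇒Expansion (Γ-≈ e g) with Γ⇒Expansion g
    ... | γ , zeros , eq = γ , zeros , R.trans (R.sym e) eq

    private
      cut : ∀ a b (f : ℕ → Carrier) → (∀ i → a ℕ.≤ i → f i ≈ 0#) → sum {a ℕ.+ b} (λ i → f (toℕ i)) ≈ sum {a} (λ i → f (toℕ i))
      cut zero    b f z = Enumeration.sum-0 R t b (λ i → z (toℕ i) z≤n)
      cut (suc a) b f z = R.+-congˡ {f 0} (cut a b (f ∘ suc) (λ i l → z (suc i) (s≤s l)))

      <2*⌈⌉ : ∀ d → d < 2 ℕ.* suc ⌊ d /2⌋
      <2*⌈⌉ zero          = s≤s z≤n
      <2*⌈⌉ (suc zero)    = s≤s (s≤s z≤n)
      <2*⌈⌉ (suc (suc d)) = ≡.subst (2 ℕ.+ d <_) (≡.sym (double-suc (suc ⌊ d /2⌋))) (s≤s (s≤s (<2*⌈⌉ d)))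

    Γ⇒sum : ∀ {d q} → Γ d q → Σ[ γ ∈ (ℕ → ℕ) ] q ≈ sum {suc ⌊ d /2⌋} (λ i → γ (toℕ i) ·′ monomial d (toℕ i))
    Γ⇒sum {d} {q} g with Γ⇒Expansion g
    ... | γ , zeros , eq = γ , trans eq truncate
      where
      terms : ℕ → Carrier
      terms i = γ i ·′ monomial d i
      truncate : sum {suc d} (λ i → terms (toℕ i)) ≈ sum {suc ⌊ d /2⌋} (λ i → terms (toℕ i))
      truncate = ≡.subst (λ n → sum {suc n} (λ i → terms (toℕ i)) ≈ sum {suc ⌊ d /2⌋} (λ i → terms (toℕ i)))
        (ℕ.m+[n∸m]≡n (ℕ.⌊n/2⌋≤n d))
        (cut (suc ⌊ d /2⌋) (d ∸ ⌊ d /2⌋) terms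
          λ i l → vanishing (monomial d i) (zeros i (ℕ.<-≤-trans (<2*⌈⌉ d) (ℕ.*-monoʳ-≤ 2 l))))

  open Coherence

  coeff-X* : ∀ p k → coeff (X *ₚ p) (suc k) ≡ coeff p k
  coeff-X* p k = ≡.trans (coeff-* X p (suc k)) (≡.trans (cong₂ ℤ._+_ (ℤ.*-zeroˡ (coeff p (suc k))) (tail k)) (ℤ.+-identityˡ _))
    where
    open Convolution using (_∗_)
    tail : ∀ k → ((λ j → coeff X (suc j)) ∗ coeff p) k ≡ coeff p k
    tail k = ≡.trans (≡.sym (coeff-* 1ₚ p k)) (at (P.*-identityˡ p) k)

  coeff-X*-0 : ∀ p → coeff (X *ₚ p) 0 ≡ 0ℤ
  coeff-X*-0 p = ≡.trans (coeff-* X p 0) (ℤ.*-zeroˡ (coeff p 0))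


  constantₚ : ℤ → Poly
  constantₚ c = c ∷ []

  constantₚ-0 : constantₚ 0ℤ ≐ 0ₚ
  constantₚ-0 = pointwise λ { zero → refl ; (suc k) → refl }

  module PolySubstitution (s : ℕ) where
    open GammaSubstitution polyRing X coeff at (λ _ → refl) refl (λ _ → refl) coeff-+ coeff-X*-0 coeff-X*
      polyRing X constantₚ (λ _ _ → P.refl) constantₚ-0 P.refl s public

  module PolyExpansion (s : ℕ) where
    private module G = GammaExpansion polyRing X s
    open Eulerian polyRing (1ₚ +ₚ X) X s using (Γ)
    import Algebra.Properties.Semiring.Mult P.semiring as Mult

    Γ⇒GammaPositive : ∀ {d q} → Γ d q → GammaPositive d q
    Γ⇒GammaPositive {d} {q} g with G.Γ⇒sum g
    ... | γ , eq = (λ i → γ (toℕ i)) , at (P.trans eq (P.reflexive (≡.sym (≡.trans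
        (sum≡ {suc ⌊ d /2⌋} λ i → γ (toℕ i) · ((X ^ toℕ i) *ₚ ((1ₚ +ₚ X) ^ (d ∸ 2 ℕ.* toℕ i))))
        (Sum.sum-cong-≗ {n = suc ⌊ d /2⌋} λ i → ≡.trans (·≡ (γ (toℕ i)) _)
          (cong₂ (λ p q → γ (toℕ i) Mult.× (p *ₚ q)) (^≡ X (toℕ i)) (^≡ (1ₚ +ₚ X) (d ∸ 2 ℕ.* toℕ i))))))))
      where import Algebra.Properties.Semiring.Sum P.semiring as Sum

-- Clique complexes: flagness, face numbers and the h-polynomial.

module CliqueComplexes where

  open import Defs
  open Polynomials
  open DescentEnumeration using (bit)
  open BinomialEulerian
  open RationalGeometry
  open EdgeSubdivision
  open CliquePolynomials
  open GammaPolynomials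
  open Graphs
  open import Level using (0ℓ)
  open import Data.Bool.Base using (Bool; true; false; if_then_else_; _∧_)
  import Data.Bool.Properties as Bool
  open import Data.Fin.Base as Fin using (Fin; zero; suc; toℕ)
  import Data.Fin.Properties as Fin
  open import Data.Fin.Subset as Subset using (Subset; ∣_∣; _∈_; _⊆_; ⁅_⁆; _∪_)
  import Data.Fin.Subset.Properties as Subset
  open import Data.Integer.Base as ℤ using (ℤ; +_)
  open import Data.List.Base as List using (List; []; _∷_; _++_; filter; length)
  open import Data.Nat.Base as ℕ using (ℕ; zero; suc; _∸_; _≡ᵇ_)
  import Data.Nat.Properties as ℕ
  open import Data.Product.Base using (_×_; _,_; proj₁; proj₂)
  open import Data.Sum.Base using (inj₁; inj₂)
  open import Data.Vec.Base as Vec using (Vec; []; _∷_; lookup)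
  import Data.Vec.Properties as Vec
  open import Function.Base using (_∘_)
  open import Relation.Binary.PropositionalEquality as ≡ using (_≡_; _≢_; refl; cong; cong₂)
  open import Relation.Nullary using (Dec; does; yes; no; contradiction)
  open import Relation.Nullary.Decidable using (_×-dec_)
  open import Relation.Unary using (Pred; Decidable)

  ∈⇒lookup : ∀ {m} {i : Fin m} {S : Subset m} → i ∈ S → lookup S i ≡ true
  ∈⇒lookup = Vec.[]=⇒lookup

  lookup⇒∈ : ∀ {m} (i : Fin m) (S : Subset m) → lookup S i ≡ true → i ∈ S
  lookup⇒∈ i S = Vec.lookup⇒[]= i S

  ∣p∪q∣≤∣p∣+∣q∣ : ∀ {m} (p q : Subset m) → ∣ p ∪ q ∣ ℕ.≤ ∣ p ∣ ℕ.+ ∣ q ∣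
  ∣p∪q∣≤∣p∣+∣q∣ []          []          = ℕ.z≤n
  ∣p∪q∣≤∣p∣+∣q∣ (false ∷ p) (false ∷ q) = ∣p∪q∣≤∣p∣+∣q∣ p q
  ∣p∪q∣≤∣p∣+∣q∣ (false ∷ p) (true  ∷ q) =
    ℕ.≤-trans (ℕ.s≤s (∣p∪q∣≤∣p∣+∣q∣ p q)) (ℕ.≤-reflexive (≡.sym (ℕ.+-suc ∣ p ∣ ∣ q ∣)))
  ∣p∪q∣≤∣p∣+∣q∣ (true  ∷ p) (false ∷ q) = ℕ.s≤s (∣p∪q∣≤∣p∣+∣q∣ p q)
  ∣p∪q∣≤∣p∣+∣q∣ (true  ∷ p) (true  ∷ q) =
    ℕ.s≤s (ℕ.≤-trans (∣p∪q∣≤∣p∣+∣q∣ p q) (ℕ.+-monoʳ-≤ ∣ p ∣ (ℕ.n≤1+n ∣ q ∣)))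

  cliqueComplex : ∀ {m} → Graph m → SimplicialComplex m
  cliqueComplex {m} G = record
    { Face     = Clique G
    ; face?    = clique? G
    ; ∅-face   = λ i j p _ _ → contradiction (lookup⇒∈ i Subset.⊥ p) Subset.∉⊥
    ; ⊆-closed = λ {S} {T} T⊆S cl i j p q → cl i j (∈⇒lookup (T⊆S (lookup⇒∈ i T p))) (∈⇒lookup (T⊆S (lookup⇒∈ j T q))) }

  cliqueComplex-flag : ∀ {m} (G : Graph m) → Flag (cliqueComplex G)
  cliqueComplex-flag {m} G S small i j p q i≢j = small pair pair⊆S ∣pair∣≤2 i j
    (∈⇒lookup (Subset.p⊆p∪q ⁅ j ⁆ (Subset.x∈⁅x⁆ i)))
    (∈⇒lookup (Subset.q⊆p∪q ⁅ i ⁆ ⁅ j ⁆ (Subset.x∈⁅x⁆ j))) i≢j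
    where
    pair : Subset m
    pair = ⁅ i ⁆ ∪ ⁅ j ⁆
    pair⊆S : pair ⊆ S
    pair⊆S x∈ with Subset.x∈p∪q⁻ ⁅ i ⁆ ⁅ j ⁆ x∈
    ... | inj₁ x∈i = ≡.subst (_∈ S) (≡.sym (Subset.x∈⁅y⁆⇒x≡y i x∈i)) (lookup⇒∈ i S p)
    ... | inj₂ x∈j = ≡.subst (_∈ S) (≡.sym (Subset.x∈⁅y⁆⇒x≡y j x∈j)) (lookup⇒∈ j S q)
    ∣pair∣≤2 : ∣ pair ∣ ℕ.≤ 2
    ∣pair∣≤2 = ℕ.≤-trans (∣p∪q∣≤∣p∣+∣q∣ ⁅ i ⁆ ⁅ j ⁆)
                 (ℕ.≤-reflexive (cong₂ ℕ._+_ (Subset.∣⁅x⁆∣≡1 i) (Subset.∣⁅x⁆∣≡1 j)))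

  module Counting where

    count : ∀ {A : Set} → List A → (A → Bool) → ℕ
    count []       f = 0
    count (x ∷ xs) f = bit (f x) ℕ.+ count xs f

    length-filter : ∀ {A : Set} {P : Pred A 0ℓ} (P? : Decidable P) xs → length (filter P? xs) ≡ count xs (does ∘ P?)
    length-filter P? []       = refl
    length-filter P? (x ∷ xs) with does (P? x)
    ... | true  = cong suc (length-filter P? xs)
    ... | false = length-filter P? xs

    count-cong : ∀ {A : Set} (xs : List A) {f g} → (∀ x → f x ≡ g x) → count xs f ≡ count xs g
    count-cong []       p = refl
    count-cong (x ∷ xs) p = cong₂ ℕ._+_ (cong bit (p x)) (count-cong xs p)

    count-++ : ∀ {A : Set} (xs ys : List A) f → count (xs ++ ys) f ≡ count xs f ℕ.+ count ys f
    count-++ []       ys f = refl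
    count-++ (x ∷ xs) ys f = ≡.trans (cong (bit (f x) ℕ.+_) (count-++ xs ys f)) (≡.sym (ℕ.+-assoc (bit (f x)) _ _))

    count-map : ∀ {A B : Set} (g : A → B) xs f → count (List.map g xs) f ≡ count xs (f ∘ g)
    count-map g []       f = refl
    count-map g (x ∷ xs) f = cong (bit (f (g x)) ℕ.+_) (count-map g xs f)

    count-false : ∀ {A : Set} (xs : List A) {f} → (∀ x → f x ≡ false) → count xs f ≡ 0
    count-false []       p = refl
    count-false (x ∷ xs) p = cong₂ ℕ._+_ (cong bit (p x)) (count-false xs p)

    count-subsets : ∀ m (f : Subset (suc m) → Bool) →
                    count (subsets (suc m)) f ≡ count (subsets m) (f ∘ (true ∷_)) ℕ.+ count (subsets m) (f ∘ (false ∷_))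
    count-subsets m f = ≡.trans (count-++ (List.map (true ∷_) (subsets m)) _ f)
      (cong₂ ℕ._+_ (count-map (true ∷_) (subsets m) f)
        (≡.trans (count-++ (List.map (false ∷_) (subsets m)) [] f)
          (≡.trans (ℕ.+-identityʳ _) (count-map (false ∷_) (subsets m) f))))

  open Counting

  open CliquePolynomial polyRing X using (Adj; cl)

  -- A clique test that follows the recursion of `cl`, so that the coefficients of `cl` count the
  -- subsets passing it.
  cliqueᵇ : ∀ {m} → Adj m → (Fin m → Bool) → Subset m → Bool
  cliqueᵇ a B []          = true
  cliqueᵇ a B (true ∷ S)  = B zero ∧ cliqueᵇ (λ i j → a (suc i) (suc j)) (λ i → B (suc i) ∧ a zero (suc i)) S
  cliqueᵇ a B (false ∷ S) = cliqueᵇ (λ i j → a (suc i) (suc j)) (B ∘ suc) S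

  coeff-cl : ∀ {m} (a : Adj m) B i → coeff (cl a B) i ≡ + count (subsets m) (λ S → cliqueᵇ a B S ∧ (∣ S ∣ ≡ᵇ i))
  coeff-cl {zero}  a B zero    = refl
  coeff-cl {zero}  a B (suc i) = refl
  coeff-cl {suc m} a B i = begin
    coeff (cl t (B ∘ suc) +ₚ link) i
      ≡⟨ coeff-+ (cl t (B ∘ suc)) link i ⟩
    coeff (cl t (B ∘ suc)) i ℤ.+ coeff link i
      ≡⟨ cong₂ ℤ._+_ (coeff-cl t (B ∘ suc) i) (link-count i) ⟩
    + count (subsets m) (f ∘ (false ∷_)) ℤ.+ + count (subsets m) (f ∘ (true ∷_))
      ≡⟨ cong +_ (ℕ.+-comm (count (subsets m) (f ∘ (false ∷_))) _) ⟩
    + (count (subsets m) (f ∘ (true ∷_)) ℕ.+ count (subsets m) (f ∘ (false ∷_)))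
      ≡⟨ cong +_ (count-subsets m f) ⟨
    + count (subsets (suc m)) f ∎
    where
    open ≡.≡-Reasoning
    t : Adj m
    t i j = a (suc i) (suc j)
    B₀ : Fin m → Bool
    B₀ i = B (suc i) ∧ a zero (suc i)
    link : Poly
    link = if B zero then X *ₚ cl t B₀ else 0ₚ
    f : Subset (suc m) → Bool
    f S = cliqueᵇ a B S ∧ (∣ S ∣ ≡ᵇ i)
    link-count : ∀ i → coeff link i ≡ + count (subsets m) (λ S → (B zero ∧ cliqueᵇ t B₀ S) ∧ (suc ∣ S ∣ ≡ᵇ i))
    link-count i with B zero
    link-count i       | false = cong +_ (≡.sym (count-false (subsets m) λ S → refl))
    link-count zero    | true  = ≡.trans (coeff-X*-0 (cl t B₀)) (cong +_ (≡.sym (count-false (subsets m) λ S → Bool.∧-zeroʳ (cliqueᵇ t B₀ S))))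
    link-count (suc i) | true  = ≡.trans (coeff-X* (cl t B₀) i) (coeff-cl t B₀ i)

  cliqueᵇ-sound : ∀ {m} (a : Adj m) B S → (∀ i j → a i j ≡ a j i) → cliqueᵇ a B S ≡ true →
    (∀ i → lookup S i ≡ true → B i ≡ true) × (∀ i j → lookup S i ≡ true → lookup S j ≡ true → i ≢ j → a i j ≡ true)
  cliqueᵇ-sound a B [] sy p = (λ ()) , (λ ())
  cliqueᵇ-sound a B (true ∷ S) sy p with ∧-true {B zero} p
  ... | B0 , rest with cliqueᵇ-sound (λ i j → a (suc i) (suc j)) _ S (λ i j → sy (suc i) (suc j)) rest
  ...   | inB , pairs = (λ { zero _ → B0 ; (suc i) q → proj₁ (∧-true {B (suc i)} (inB i q)) })
        , λ where
            zero    zero    _ _ ne → contradiction refl ne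
            zero    (suc j) _ q _  → proj₂ (∧-true {B (suc j)} (inB j q))
            (suc i) zero    q _ _  → ≡.trans (sy (suc i) zero) (proj₂ (∧-true {B (suc i)} (inB i q)))
            (suc i) (suc j) q r ne → pairs i j q r (ne ∘ cong suc)
  cliqueᵇ-sound a B (false ∷ S) sy p with cliqueᵇ-sound (λ i j → a (suc i) (suc j)) _ S (λ i j → sy (suc i) (suc j)) p
  ... | inB , pairs = (λ { (suc i) q → inB i q }) , λ where
            zero    _       () _ _
            (suc i) zero    _ () _
            (suc i) (suc j) q r ne → pairs i j q r (ne ∘ cong suc)

  cliqueᵇ-complete : ∀ {m} (a : Adj m) B S → (∀ i → lookup S i ≡ true → B i ≡ true) →
    (∀ i j → lookup S i ≡ true → lookup S j ≡ true → i ≢ j → a i j ≡ true) → cliqueᵇ a B S ≡ true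
  cliqueᵇ-complete a B [] p q = refl
  cliqueᵇ-complete a B (true ∷ S) p q = cong₂ _∧_ (p zero refl)
    (cliqueᵇ-complete (λ i j → a (suc i) (suc j)) _ S (λ i s → cong₂ _∧_ (p (suc i) s) (q zero (suc i) refl s λ ()))
      (λ i j s r ne → q (suc i) (suc j) s r (ne ∘ Fin.suc-injective)))
  cliqueᵇ-complete a B (false ∷ S) p q =
    cliqueᵇ-complete (λ i j → a (suc i) (suc j)) _ S (λ i → p (suc i)) (λ i j s r ne → q (suc i) (suc j) s r (ne ∘ Fin.suc-injective))

  does-≡ : ∀ {P : Set} (P? : Dec P) b → (b ≡ true → P) → (P → b ≡ true) → does P? ≡ b
  does-≡ (yes p) b     f g = ≡.sym (g p)
  does-≡ (no ¬p) false f g = refl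
  does-≡ (no ¬p) true  f g = contradiction (f refl) ¬p

  faceCount-cl : ∀ {m} (G : Graph m) i → + faceCount (cliqueComplex G) i ≡ coeff (cl (adj G) (λ _ → true)) i
  faceCount-cl {m} G i = ≡.trans
    (cong +_ (≡.trans (length-filter (λ S → clique? G S ×-dec (∣ S ∣ ℕ.≟ i)) (subsets m))
      (count-cong (subsets m) λ S → cong (_∧ (∣ S ∣ ≡ᵇ i)) (decides S))))
    (≡.sym (coeff-cl (adj G) (λ _ → true) i))
    where
    decides : ∀ S → does (clique? G S) ≡ cliqueᵇ (adj G) (λ _ → true) S
    decides S = does-≡ (clique? G S) _
      (λ p → proj₂ (cliqueᵇ-sound (adj G) (λ _ → true) S (adj-sym G) p))
      (cliqueᵇ-complete (adj G) (λ _ → true) S (λ _ _ → refl))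

  module _ (s : ℕ) where
    open PolySubstitution s using (Tr; Tr-cong)
    open Coherence
    open import Algebra.Properties.Semiring.Sum P.semiring using (sum; sum-cong-≋; *-distribˡ-sum)
    import Algebra.Properties.Semiring.Sum P.semiring as Sum
    import Algebra.Properties.Semiring.Mult P.semiring as Mult
    import Algebra.Properties.Semiring.Exp P.semiring as Exp

    ·-constant : ∀ n p → n Mult.× p ≐ ((+ n) ∷ []) *ₚ p
    ·-constant n p = P.trans (P.trans (Mult.×-congʳ n (P.sym (P.*-identityˡ p))) (P.sym (Mult.×-assoc-* n 1ₚ p))) (P.*-congʳ (go n))
      where
      go : ∀ n → n Mult.× 1ₚ ≐ (+ n) ∷ []
      go zero    = pointwise λ { zero → refl ; (suc k) → refl }
      go (suc n) = P.+-congˡ {1ₚ} (go n)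

    Tr-sum : ∀ n (c : ℕ → ℕ) →
             sum {suc n} (λ i → c (toℕ i) Mult.× ((X Exp.^ toℕ i) *ₚ ((1ₚ +ₚ (-ₚ X)) Exp.^ (n ∸ toℕ i)))) ≐ Tr n (λ i → + c i)
    Tr-sum zero c = P.trans (P.+-identityʳ _) (P.trans (Mult.×-congʳ (c 0) (P.*-identityˡ 1ₚ)) (P.trans (·-constant (c 0) 1ₚ) (P.*-identityʳ _)))
    Tr-sum (suc n) c = P.+-cong
      (P.trans (Mult.×-congʳ (c 0) (P.*-identityˡ ((1ₚ +ₚ (-ₚ X)) Exp.^ suc n))) (·-constant (c 0) ((1ₚ +ₚ (-ₚ X)) Exp.^ suc n)))
      (P.trans (sum-cong-≋ {n = suc n} λ i → P.trans
          (Mult.×-congʳ (c (suc (toℕ i))) (P.*-assoc X (X Exp.^ toℕ i) ((1ₚ +ₚ (-ₚ X)) Exp.^ (n ∸ toℕ i))))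
          (P.sym (Mult.×-comm-* (c (suc (toℕ i))) X ((X Exp.^ toℕ i) *ₚ ((1ₚ +ₚ (-ₚ X)) Exp.^ (n ∸ toℕ i))))))
        (P.trans (P.sym (*-distribˡ-sum {suc n} X (λ i → c (suc (toℕ i)) Mult.× ((X Exp.^ toℕ i) *ₚ ((1ₚ +ₚ (-ₚ X)) Exp.^ (n ∸ toℕ i))))))
          (P.*-congˡ {X} (Tr-sum n (c ∘ suc)))))

    hPolynomial-cl : ∀ n {m} (G : Graph m) → hPolynomial n (cliqueComplex G) ≐ Tr n (coeff (cl (adj G) (λ _ → true)))
    hPolynomial-cl n G = P.trans
      (P.reflexive (≡.trans (sum≡ {suc n} λ i → faceCount Δ (toℕ i) · ((X ^ toℕ i) *ₚ ((1ₚ +ₚ (-ₚ X)) ^ (n ∸ toℕ i))))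
        (Sum.sum-cong-≗ {n = suc n} λ i → ≡.trans (·≡ (faceCount Δ (toℕ i)) _)
          (cong₂ (λ p q → faceCount Δ (toℕ i) Mult.× (p *ₚ q)) (^≡ X (toℕ i)) (^≡ (1ₚ +ₚ (-ₚ X)) (n ∸ toℕ i))))))
      (P.trans (Tr-sum n (faceCount Δ)) (Tr-cong n (faceCount-cl G)))
      where
      Δ = cliqueComplex G

-- The real polytope of a rational realization.

module RealPolytopes where

  open import Defs
  open RationalGeometry
  open EdgeSubdivision
  open CliqueComplexes
  open Graphs
  open Vectors
  open Realizations
  open SmallNumbers using (p≤∣p∣)
  open import Data.Bool.Base using (Bool; true; false)
  open import Data.Fin.Base as Fin using (Fin; zero; suc)
  import Data.Fin.Properties as Fin
  open import Data.Fin.Subset as Subset using (Subset; _∈_; ⁅_⁆)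
  import Data.Fin.Subset.Properties as Subset
  open import Data.Nat.Base as ℕ using (ℕ; zero; suc)
  import Data.Nat.Properties as ℕ
  open import Data.Product.Base using (_×_; _,_; proj₁; proj₂; ∃-syntax)
  open import Data.Rational.Base as ℚ using (ℚ; 0ℚ; 1ℚ; ½; _+_; _*_; -_; _-_; _<_; _≤_)
  import Data.Rational.Properties as ℚ
  open import Data.Rational.Solver using (module +-*-Solver)
  open import Data.Sum.Base using (inj₁; inj₂)
  open import Data.Vec.Base as Vec using (Vec; []; _∷_; lookup)
  import Data.Vec.Properties as Vec
  open import Data.Vec.Functional using (Vector)
  open import Function.Base using (_∘_)
  open import Function.Bundles using (mk⇔; Equivalence)
  open import Relation.Binary.PropositionalEquality using (_≡_; _≢_; refl; sym; trans; cong; cong₂; module ≡-Reasoning)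
  open import Relation.Nullary using (¬_; Dec; yes; no; contradiction)
  open import Relation.Nullary.Decidable using (_×-dec_; ¬?)
  import Data.Bool.Properties as Bool
  open +-*-Solver using (solve; _:=_; _:+_; _:*_; :-_; _:-_; con)

  -- _≤ᵣ_ and _≈ᵣ_ only depend on the underlying sequences.
  module Sequences where

    Seq : Set
    Seq = ℕ → ℚ

    infix 4 _≼_ _≃_
    record _≼_ (s t : Seq) : Set where
      constructor eventually-≤
      field close : ∀ ε → 0ℚ < ε → ∃[ N ] ∀ n → N ℕ.≤ n → s n ≤ t n + ε

    record _≃_ (s t : Seq) : Set where
      constructor eventually-≈
      field close : ∀ ε → 0ℚ < ε → ∃[ N ] ∀ n → N ℕ.≤ n → ℚ.∣ s n - t n ∣ ≤ ε

    private
      half : ∀ {ε} → 0ℚ < ε → 0ℚ < ½ * ε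
      half 0<ε = ℚ.<-respˡ-≡ (ℚ.*-zeroʳ ½) (ℚ.*-monoʳ-<-pos ½ 0<ε)

      halves : ∀ ε → ½ * ε + ½ * ε ≡ ε
      halves ε = trans (sym (ℚ.*-distribʳ-+ ε ½ ½)) (ℚ.*-identityˡ ε)

    ≤⇒≼ : ∀ {s t} → (∀ n → s n ≤ t n) → s ≼ t
    ≤⇒≼ {s} {t} p = eventually-≤ λ ε 0<ε → 0 , λ n _ → ℚ.≤-trans (p n)
      (ℚ.≤-trans (ℚ.≤-reflexive (sym (ℚ.+-identityʳ (t n)))) (ℚ.+-monoʳ-≤ (t n) (ℚ.<⇒≤ 0<ε)))

    ≡⇒≼ : ∀ {s t} → (∀ n → s n ≡ t n) → s ≼ t
    ≡⇒≼ p = ≤⇒≼ (ℚ.≤-reflexive ∘ p)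

    ≼-trans : ∀ {s t u} → s ≼ t → t ≼ u → s ≼ u
    ≼-trans {s} {t} {u} p q = eventually-≤ λ ε 0<ε →
      let M , pM = _≼_.close p (½ * ε) (half 0<ε)
          N , qN = _≼_.close q (½ * ε) (half 0<ε)
      in M ℕ.⊔ N , λ n l → ℚ.≤-trans (pM n (ℕ.m⊔n≤o⇒m≤o M N l))
           (ℚ.≤-trans (ℚ.+-monoˡ-≤ (½ * ε) (qN n (ℕ.m⊔n≤o⇒n≤o M N l)))
             (ℚ.≤-reflexive (trans (ℚ.+-assoc (u n) _ _) (cong (u n +_) (halves ε)))))

    ≼-+ : ∀ {s s′ t t′} → s ≼ s′ → t ≼ t′ → (λ n → s n + t n) ≼ (λ n → s′ n + t′ n)
    ≼-+ {s} {s′} {t} {t′} p q = eventually-≤ λ ε 0<ε →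
      let M , pM = _≼_.close p (½ * ε) (half 0<ε)
          N , qN = _≼_.close q (½ * ε) (half 0<ε)
      in M ℕ.⊔ N , λ n l → ℚ.≤-trans (ℚ.+-mono-≤ (pM n (ℕ.m⊔n≤o⇒m≤o M N l)) (qN n (ℕ.m⊔n≤o⇒n≤o M N l)))
           (ℚ.≤-reflexive (trans (solve 3 (λ a b e → (a :+ e) :+ (b :+ e) := (a :+ b) :+ (e :+ e)) refl (s′ n) (t′ n) (½ * ε))
             (cong (s′ n + t′ n +_) (halves ε))))

    ≼-* : ∀ q {s t} → 0ℚ ≤ q → s ≼ t → (λ n → q * s n) ≼ (λ n → q * t n)
    ≼-* q {s} {t} 0≤q p = eventually-≤ λ ε 0<ε →
      let 0<1+q : 0ℚ < 1ℚ + q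
          0<1+q = ℚ.+-mono-<-≤ (ℚ.positive⁻¹ 1ℚ) 0≤q
          -- Dividing by 1 + q covers q = 0 as well.
          δ , 0<δ , eq = quotient ε (1ℚ + q) 0<ε 0<1+q
          N , pN = _≼_.close p δ 0<δ
          qδ≤ε : q * δ ≤ ε
          qδ≤ε = ℚ.≤-trans (ℚ.≤-reflexive (ℚ.*-comm q δ)) (ℚ.≤-trans
            (ℚ.*-monoˡ-≤-nonNeg δ {{ℚ.nonNegative (ℚ.<⇒≤ 0<δ)}}
              (ℚ.≤-trans (ℚ.≤-reflexive (sym (ℚ.+-identityˡ q))) (ℚ.+-monoˡ-≤ q (ℚ.nonNegative⁻¹ 1ℚ))))
            (ℚ.≤-reflexive eq))
      in N , λ n l → ℚ.≤-trans (ℚ.*-monoˡ-≤-nonNeg q {{ℚ.nonNegative 0≤q}} (pN n l))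
           (ℚ.≤-trans (ℚ.≤-reflexive (ℚ.*-distribˡ-+ q (t n) δ)) (ℚ.+-monoʳ-≤ (q * t n) qδ≤ε))

    ≃⇒≼ : ∀ {s t} → s ≃ t → s ≼ t
    ≃⇒≼ {s} {t} p = eventually-≤ λ ε 0<ε → let N , pN = _≃_.close p ε 0<ε in N , λ n l →
      ℚ.≤-trans (ℚ.≤-reflexive (solve 2 (λ a b → a := b :+ (a :- b)) refl (s n) (t n)))
        (ℚ.+-monoʳ-≤ (t n) (ℚ.≤-trans (p≤∣p∣ (s n - t n)) (pN n l)))

    ≃-sym : ∀ {s t} → s ≃ t → t ≃ s
    ≃-sym {s} {t} p = eventually-≈ λ ε 0<ε → let N , pN = _≃_.close p ε 0<ε in N , λ n l → ℚ.≤-trans (ℚ.≤-reflexive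
      (trans (cong ℚ.∣_∣ (solve 2 (λ a b → b :- a := :- (a :- b)) refl (s n) (t n))) (ℚ.∣-p∣≡∣p∣ (s n - t n)))) (pN n l)

    ≼-antisym : ∀ {s t} → s ≼ t → t ≼ s → s ≃ t
    ≼-antisym {s} {t} p q = eventually-≈ λ ε 0<ε →
      let M , pM = _≼_.close p ε 0<ε
          N , qN = _≼_.close q ε 0<ε
      in M ℕ.⊔ N , λ n l → bound ε n (pM n (ℕ.m⊔n≤o⇒m≤o M N l)) (qN n (ℕ.m⊔n≤o⇒n≤o M N l))
      where
      move : ∀ ε a b → a ≤ b + ε → a - b ≤ ε
      move ε a b le = ℚ.≤-trans (ℚ.+-monoˡ-≤ (- b) le) (ℚ.≤-reflexive (solve 2 (λ b e → (b :+ e) :- b := e) refl b ε))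
      bound : ∀ ε n → s n ≤ t n + ε → t n ≤ s n + ε → ℚ.∣ s n - t n ∣ ≤ ε
      bound ε n le ge with ℚ.≤-total 0ℚ (s n - t n)
      ... | inj₁ 0≤ = ℚ.≤-trans (ℚ.≤-reflexive (ℚ.0≤p⇒∣p∣≡p 0≤)) (move ε (s n) (t n) le)
      ... | inj₂ ≤0 = ℚ.≤-trans (ℚ.≤-reflexive (trans (sym (ℚ.∣-p∣≡∣p∣ (s n - t n)))
                        (trans (ℚ.0≤p⇒∣p∣≡p (ℚ.neg-antimono-≤ ≤0)) (solve 2 (λ a b → :- (a :- b) := b :- a) refl (s n) (t n)))))
                        (move ε (t n) (s n) ge)

    ≡⇒≃ : ∀ {s t} → (∀ n → s n ≡ t n) → s ≃ t
    ≡⇒≃ p = ≼-antisym (≡⇒≼ p) (≡⇒≼ (sym ∘ p))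

    ≃-trans : ∀ {s t u} → s ≃ t → t ≃ u → s ≃ u
    ≃-trans p q = ≼-antisym (≼-trans (≃⇒≼ p) (≃⇒≼ q)) (≼-trans (≃⇒≼ (≃-sym q)) (≃⇒≼ (≃-sym p)))

    ≃-+ : ∀ {s s′ t t′} → s ≃ s′ → t ≃ t′ → (λ n → s n + t n) ≃ (λ n → s′ n + t′ n)
    ≃-+ p q = ≼-antisym (≼-+ (≃⇒≼ p) (≃⇒≼ q)) (≼-+ (≃⇒≼ (≃-sym p)) (≃⇒≼ (≃-sym q)))

    ≃-neg : ∀ {s t} → s ≃ t → (λ n → - s n) ≃ (λ n → - t n)
    ≃-neg {s} {t} p = eventually-≈ λ ε 0<ε → let N , pN = _≃_.close p ε 0<ε in N , λ n l → ℚ.≤-trans (ℚ.≤-reflexive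
      (trans (cong ℚ.∣_∣ (solve 2 (λ a b → :- a :- :- b := :- (a :- b)) refl (s n) (t n))) (ℚ.∣-p∣≡∣p∣ (s n - t n)))) (pN n l)

    ≃-* : ∀ q {s t} → s ≃ t → (λ n → q * s n) ≃ (λ n → q * t n)
    ≃-* q {s} {t} p with ℚ.≤-total 0ℚ q
    ... | inj₁ 0≤q = ≼-antisym (≼-* q 0≤q (≃⇒≼ p)) (≼-* q 0≤q (≃⇒≼ (≃-sym p)))
    ... | inj₂ q≤0 = ≃-trans (≡⇒≃ λ n → solve 2 (λ q s → q :* s := :- (:- q :* s)) refl q (s n))
      (≃-trans (≃-neg (≼-antisym (≼-* (- q) 0≤-q (≃⇒≼ p)) (≼-* (- q) 0≤-q (≃⇒≼ (≃-sym p)))))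
        (≡⇒≃ λ n → solve 2 (λ q s → :- (:- q :* s) := q :* s) refl q (t n)))
      where
      0≤-q : 0ℚ ≤ - q
      0≤-q = ℚ.neg-antimono-≤ q≤0

    ≼-sum : ∀ {m} {f g : Fin m → Seq} → (∀ i → f i ≼ g i) → (λ n → sum (λ i → f i n)) ≼ (λ n → sum (λ i → g i n))
    ≼-sum {zero}  p = ≡⇒≼ λ _ → refl
    ≼-sum {suc m} p = ≼-+ (p zero) (≼-sum (p ∘ suc))

    ≃-sum : ∀ {m} {f g : Fin m → Seq} → (∀ i → f i ≃ g i) → (λ n → sum (λ i → f i n)) ≃ (λ n → sum (λ i → g i n))
    ≃-sum p = ≼-antisym (≼-sum (≃⇒≼ ∘ p)) (≼-sum (λ i → ≃⇒≼ (≃-sym (p i))))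

    constant-≃ : ∀ {p q} → p < q → ¬ (λ _ → p) ≃ (λ _ → q)
    constant-≃ {p} {q} p<q eq =
      let d = q - p
          0<d : 0ℚ < d
          0<d = ℚ.<-respˡ-≡ (ℚ.+-inverseʳ p) (ℚ.+-monoˡ-< (- p) p<q)
          N , le = _≼_.close (≃⇒≼ (≃-sym eq)) (½ * d) (half 0<d)
          d≤½d : d ≤ ½ * d
          d≤½d = ℚ.≤-trans (ℚ.+-monoˡ-≤ (- p) (le N ℕ.≤-refl))
            (ℚ.≤-reflexive (solve 2 (λ p h → (p :+ h) :- p := h) refl p (½ * d)))
          ½d<d : ½ * d < d
          ½d<d = ℚ.<-≤-trans (ℚ.≤-<-trans (ℚ.≤-reflexive (sym (ℚ.+-identityʳ (½ * d)))) (ℚ.+-monoʳ-< (½ * d) (half 0<d)))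
            (ℚ.≤-reflexive (halves d))
      in ℚ.<-irrefl refl (ℚ.≤-<-trans d≤½d ½d<d)

  open Sequences

  from-≈ᵣ : ∀ x y → x ≈ᵣ y → seq x ≃ seq y
  from-≈ᵣ x y = eventually-≈

  from-≤ᵣ : ∀ x y → x ≤ᵣ y → seq x ≼ seq y
  from-≤ᵣ x y = eventually-≤

  seq-sum : ∀ {m} (f : Vector ℝ m) n → seq (sumᵣ f) n ≡ sum (λ i → seq (f i) n)
  seq-sum {zero}  f n = refl
  seq-sum {suc m} f n = cong (seq (f zero) n +_) (seq-sum (f ∘ suc) n)

  dot-comm : ∀ {n} (c p : Vecℚ n) → dot c p ≡ dot p c
  dot-comm {n} c p = sum-cong {n} λ k → ℚ.*-comm (c k) (p k)

  sum-linear-comb : ∀ {m n} (a : Vecℚ m) (v : Fin m → Vecℚ n) (c : Vecℚ n) →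
                    dot c (λ k → sum λ i → a i * v i k) ≡ sum λ i → a i * dot c (v i)
  sum-linear-comb {m} {n} a v c = begin
    sum (λ k → c k * sum (λ i → a i * v i k))
      ≡⟨ sum-cong {n} (λ k → *-distribˡ-sum {m} (c k) (λ i → a i * v i k)) ⟩
    sum (λ k → sum (λ i → c k * (a i * v i k)))
      ≡⟨ ∑-comm {n} {m} (λ k i → c k * (a i * v i k)) ⟩
    sum (λ i → sum (λ k → c k * (a i * v i k)))
      ≡⟨ sum-cong {m} (λ i → trans (sum-cong {n} λ k → solve 3 (λ c a v → c :* (a :* v) := a :* (c :* v)) refl (c k) (a i) (v i k))
           (sym (*-distribˡ-sum {n} (a i) (λ k → c k * v i k)))) ⟩
    sum (λ i → a i * dot c (v i)) ∎
    where open ≡-Reasoning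

  module RealPolytope {n m} (G : Graph m) (R : Realization (suc n) G) where
    open Realization R

    vertices : Vector (Point (suc n)) m
    vertices i k = fromℚ (pt i k)

    seq-inner : ∀ (c : Vector ℝ (suc n)) (x : Point (suc n)) N → seq ⟨ c , x ⟩ N ≡ dot (λ k → seq (c k) N) (λ k → seq (x k) N)
    seq-inner c x N = seq-sum (λ k → c k *ᵣ x k) N

    seq-combination : ∀ (a : Vector ℝ m) k N → seq (combination vertices a k) N ≡ sum λ i → seq (a i) N * pt i k
    seq-combination a k N = seq-sum (λ i → a i *ᵣ vertices i k) N

    functional-combination : ∀ (c : Vecℚ (suc n)) (x : Point (suc n)) (a : Vector ℝ m) → x ≈ᵥ combination vertices a →
      (λ N → dot c (λ k → seq (x k) N)) ≃ (λ N → sum λ i → dot c (pt i) * seq (a i) N)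
    functional-combination c x a x≈ = ≃-trans (≃-sum λ k → ≃-* (c k) (from-≈ᵣ (x k) (combination vertices a k) (x≈ k))) (≡⇒≃ λ N → trans
      (sum-cong {suc n} λ k → cong (c k *_) (seq-combination a k N))
      (trans (sum-linear-comb (λ i → seq (a i) N) pt c) (sum-cong {m} λ i → ℚ.*-comm (seq (a i) N) (dot c (pt i)))))

    face-cut : ∀ S → Clique G S → CutsOutFace vertices S
    face-cut S cl = (λ k → fromℚ (functional k)) , 1ᵣ , valid , λ i → mk⇔ (to i) (from i)
      where
      open Support (supports S cl)
      inner : ∀ x N → seq ⟨ (λ k → fromℚ (functional k)) , x ⟩ N ≡ dot functional (λ k → seq (x k) N)
      inner x N = seq-inner (λ k → fromℚ (functional k)) x N
      ≤1 : ∀ i → dot functional (pt i) ≤ 1ℚ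
      ≤1 i with lookup S i in eq
      ... | true  = ℚ.≤-reflexive (on i eq)
      ... | false = ℚ.<⇒≤ (off i eq)
      valid : ∀ x → InConvexHull vertices x → ⟨ (λ k → fromℚ (functional k)) , x ⟩ ≤ᵣ 1ᵣ
      valid x (a , 0≤a , Σa , x≈) = _≼_.close (≼-trans (≡⇒≼ (inner x)) (≼-trans (≃⇒≼ (functional-combination functional x a x≈))
        (≼-trans (≼-sum term) (≼-trans (≡⇒≼ λ N → sym (seq-sum a N)) (≃⇒≼ (from-≈ᵣ (sumᵣ a) 1ᵣ Σa))))))
        where
        -- The sign of `a i` is known only in the limit, so the bound is not termwise: (1 - d) * 0 ≼
        -- (1 - d) * a i is added to d * a i.
        term : ∀ i → (λ N → dot functional (pt i) * seq (a i) N) ≼ seq (a i)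
        term i = ≼-trans (≡⇒≼ λ N → solve 2 (λ d a → d :* a := d :* a :+ (con 1ℚ :- d) :* con 0ℚ) refl d (seq (a i) N))
          (≼-trans (≼-+ {s = λ N → d * seq (a i) N} (≤⇒≼ λ N → ℚ.≤-refl) (≼-* (1ℚ - d) 0≤1-d (from-≤ᵣ 0ᵣ (a i) (0≤a i))))
            (≡⇒≼ λ N → solve 2 (λ d a → d :* a :+ (con 1ℚ :- d) :* a := a) refl d (seq (a i) N)))
          where
          d : ℚ
          d = dot functional (pt i)
          0≤1-d : 0ℚ ≤ 1ℚ - d
          0≤1-d = ℚ.≤-trans (ℚ.≤-reflexive (sym (ℚ.+-inverseʳ d))) (ℚ.+-monoˡ-≤ (- d) (≤1 i))
      to : ∀ i → i ∈ S → ⟨ (λ k → fromℚ (functional k)) , vertices i ⟩ ≈ᵣ 1ᵣ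
      to i i∈S = _≃_.close (≡⇒≃ λ N → trans (inner (vertices i) N) (on i (∈⇒lookup i∈S)))
      from : ∀ i → ⟨ (λ k → fromℚ (functional k)) , vertices i ⟩ ≈ᵣ 1ᵣ → i ∈ S
      from i eq with lookup S i in Si
      ... | true  = lookup⇒∈ i S Si
      ... | false = contradiction (≃-trans (≡⇒≃ λ N → sym (inner (vertices i) N)) (from-≈ᵣ ⟨ (λ k → fromℚ (functional k)) , vertices i ⟩ 1ᵣ eq)) (constant-≃ (off i Si))

    vertex-in-hull : ∀ i → InConvexHull vertices (vertices i)
    vertex-in-hull i = (λ l → fromℚ (unit i l)) , (λ l → _≼_.close (≤⇒≼ λ N → unit-nonNeg i l))
      , _≃_.close (≡⇒≃ λ N → trans (seq-sum (λ l → fromℚ (unit i l)) N) (total-unit i))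
      , λ k → _≃_.close (≡⇒≃ λ N → sym (trans (seq-combination (λ l → fromℚ (unit i l)) k N) (sum-unit i (λ l → pt l k))))

    non-edge : ∀ S → ¬ Clique G S → ∃[ i ] ∃[ j ] i ∈ S × j ∈ S × i ≢ j × adj G i j ≡ false
    non-edge S ¬cl with Fin.any? (λ i → Fin.any? λ j → (i Subset.∈? S) ×-dec ((j Subset.∈? S) ×-dec (¬? (i Fin.≟ j) ×-dec (adj G i j Bool.≟ false))))
    ... | yes found = found
    ... | no none   = contradiction (λ i j p q i≢j → go i j p q i≢j (adj G i j) refl) ¬cl
      where
      go : ∀ i j → lookup S i ≡ true → lookup S j ≡ true → i ≢ j → ∀ b → adj G i j ≡ b → adj G i j ≡ true
      go i j p q i≢j true  eq = eq
      go i j p q i≢j false eq = contradiction (i , j , lookup⇒∈ i S p , lookup⇒∈ j S q , i≢j , eq) none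

    all-true : ∀ {m} (S : Subset m) → (∀ i → i ∈ S) → S ≡ Subset.⊤
    all-true []      p = refl
    all-true (b ∷ S) p = cong₂ _∷_ (∈⇒lookup (p zero)) (all-true S λ i → Subset.drop-there (p (suc i)))

    -- A hyperplane through a non-edge passes through the origin, and then
    -- through all vertices.
    cut-clique : ∀ S → CutsOutFace vertices S → S ≢ Subset.⊤ → Clique G S
    cut-clique S (c , b , valid , iff) S≢⊤ with clique? G S
    ... | yes cl = cl
    ... | no ¬cl = contradiction (all-true S everything) S≢⊤
      where
      edge = non-edge S ¬cl
      i j : Fin m
      i = proj₁ edge
      j = proj₁ (proj₂ edge)
      i∈S = proj₁ (proj₂ (proj₂ edge))
      j∈S = proj₁ (proj₂ (proj₂ (proj₂ edge)))
      open Separation (separate i j (proj₁ (proj₂ (proj₂ (proj₂ (proj₂ edge))))) (proj₂ (proj₂ (proj₂ (proj₂ (proj₂ edge))))))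
      C : ℕ → Vecℚ (suc n)
      C N k = seq (c k) N
      L : Fin m → Seq
      L l N = dot (C N) (pt l)
      inner : ∀ l N → seq ⟨ c , vertices l ⟩ N ≡ L l N
      inner l N = seq-inner c (vertices l) N
      L≼b : ∀ l → L l ≼ seq b
      L≼b l = ≼-trans (≡⇒≼ λ N → sym (inner l N)) (from-≤ᵣ ⟨ c , vertices l ⟩ b (valid (vertices l) (vertex-in-hull l)))
      b≼L : ∀ l → l ∈ S → seq b ≼ L l
      b≼L l l∈S = ≼-trans (≃⇒≼ (≃-sym (from-≈ᵣ ⟨ c , vertices l ⟩ b (Equivalence.to (iff l) l∈S)))) (≡⇒≼ (inner l))
      -- This is c applied to `relation`: i and j lie on the hyperplane, and on the right each
      -- vertex has value at most b and a nonnegative weight.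
      2b≼sb : (λ N → seq b N + seq b N) ≼ (λ N → sum weight * seq b N)
      2b≼sb = ≼-trans (≼-+ (b≼L i i∈S) (b≼L j j∈S)) (≼-trans (≡⇒≼ related)
        (≼-trans (≼-sum λ l → ≼-* (weight l) (nonNeg l) (L≼b l)) (≡⇒≼ λ N → sym (distribute N))))
        where
        related : ∀ N → L i N + L j N ≡ sum (λ l → weight l * L l N)
        related N = trans (trans (cong₂ _+_ (sym (ℚ.*-identityˡ (L i N))) (sym (ℚ.*-identityˡ (L j N))))
            (sym (dot-linearʳ 1ℚ 1ℚ (C N) (pt i) (pt j))))
          (trans (sum-cong {suc n} λ k → cong (C N k *_) (trans (cong₂ _+_ (ℚ.*-identityˡ (pt i k)) (ℚ.*-identityˡ (pt j k))) (relation k)))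
            (sum-linear-comb weight pt (C N)))
        distribute : ∀ N → sum weight * seq b N ≡ sum (λ l → weight l * seq b N)
        distribute N = trans (ℚ.*-comm (sum weight) (seq b N)) (trans (*-distribˡ-sum {m} (seq b N) weight)
          (sum-cong {m} λ l → ℚ.*-comm (seq b N) (weight l)))
      -- If w is the total weight, (2 - w) b is at most 0; multiplying by δ = 1 / (2 - w) isolates
      -- b.
      b≼0 : seq b ≼ (λ _ → 0ℚ)
      b≼0 = ≼-trans (≡⇒≼ λ N → sym (trans (cong (λ z → z) (solve 3 (λ d s b → d :* ((b :+ b) :- s :* b) := (d :* (con 2ℚ :- s)) :* b) refl δ (sum weight) (seq b N)))
                       (trans (cong (_* seq b N) eq) (ℚ.*-identityˡ (seq b N)))))
          (≼-trans (≼-* δ (ℚ.<⇒≤ 0<δ) difference≼0) (≡⇒≼ λ _ → ℚ.*-zeroʳ δ))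
        where
        gap : 0ℚ < 2ℚ - sum weight
        gap = ℚ.<-respˡ-≡ (ℚ.+-inverseʳ (sum weight)) (ℚ.+-monoˡ-< (- sum weight) total<2)
        inverse = quotient 1ℚ (2ℚ - sum weight) (ℚ.positive⁻¹ 1ℚ) gap
        δ = proj₁ inverse
        0<δ = proj₁ (proj₂ inverse)
        eq = proj₂ (proj₂ inverse)
        difference≼0 : (λ N → (seq b N + seq b N) - sum weight * seq b N) ≼ (λ _ → 0ℚ)
        difference≼0 = ≼-trans (≼-+ 2b≼sb (≤⇒≼ {λ N → - (sum weight * seq b N)} λ N → ℚ.≤-refl))
          (≡⇒≼ λ N → ℚ.+-inverseʳ (sum weight * seq b N))
      positive negative : Fin (suc n) → Fin m
      positive k = proj₁ (axis⁺ k)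
      negative k = proj₁ (axis⁻ k)
      L-positive : ∀ k N → L (positive k) N ≡ C N k
      L-positive k N = trans (dot-comm (C N) (pt (positive k)))
        (trans (sum-cong {suc n} λ l → cong (_* C N l) (proj₂ (axis⁺ k) l)) (sum-unit k (C N)))
      L-negative : ∀ k N → L (negative k) N ≡ - C N k
      L-negative k N = trans (sum-cong {suc n} λ l → trans (cong (C N l *_) (proj₂ (axis⁻ k) l))
          (solve 2 (λ c u → c :* (:- u) := u :* (:- c)) refl (C N l) (unit k l)))
        (sum-unit k (λ l → - C N l))
      C≼b : ∀ k → (λ N → C N k) ≼ seq b
      C≼b k = ≼-trans (≡⇒≼ λ N → sym (L-positive k N)) (L≼b (positive k))
      -C≼b : ∀ k → (λ N → - C N k) ≼ seq b
      -C≼b k = ≼-trans (≡⇒≼ λ N → sym (L-negative k N)) (L≼b (negative k))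
      -- The k-th coordinate of c and its negative are the values of c at the vertices e_k and -
      -- e_k, so both are at most b and hence at most 0.
      C≃0 : ∀ k → (λ N → C N k) ≃ (λ _ → 0ℚ)
      C≃0 k = ≼-antisym (≼-trans (C≼b k) b≼0)
        (≼-trans (≡⇒≼ λ N → sym (ℚ.+-inverseˡ (C N k)))
          (≼-trans (≼-+ (≼-trans (-C≼b k) b≼0) (≤⇒≼ {λ N → C N k} λ N → ℚ.≤-refl)) (≡⇒≼ λ N → ℚ.+-identityˡ (C N k))))
      0≼b : (λ _ → 0ℚ) ≼ seq b
      0≼b = ≼-trans (≃⇒≼ (≃-sym (C≃0 zero))) (C≼b zero)
      everything : ∀ l → l ∈ S
      everything l = Equivalence.from (iff l) (_≃_.close (≃-trans (≡⇒≃ (inner l)) (≃-trans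
        (≃-sum λ k → ≃-trans (≡⇒≃ λ N → ℚ.*-comm (C N k) (pt l k)) (≃-* (pt l k) (C≃0 k)))
        (≃-trans (≡⇒≃ λ N → sum-zero (suc n) λ k → ℚ.*-zeroʳ (pt l k)) (≼-antisym 0≼b b≼0)))))

    -- A supporting functional cannot take the value 1 at both e₀ and - e₀.
    clique-≢⊤ : Clique G Subset.⊤ → ∀ {A : Set} → A
    clique-≢⊤ cl = contradiction one≡minus-one λ ()
      where
      open Support (supports Subset.⊤ cl)
      at⁺ : functional zero ≡ 1ℚ
      at⁺ = trans (sym (trans (dot-comm functional (pt (proj₁ (axis⁺ zero))))
          (trans (sum-cong {suc n} λ l → cong (_* functional l) (proj₂ (axis⁺ zero) l)) (sum-unit zero functional))))
        (on (proj₁ (axis⁺ zero)) (Vec.lookup-replicate (proj₁ (axis⁺ zero)) true))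
      at⁻ : - functional zero ≡ 1ℚ
      at⁻ = trans (sym (trans (sum-cong {suc n} λ l → trans (cong (functional l *_) (proj₂ (axis⁻ zero) l))
            (solve 2 (λ c u → c :* (:- u) := u :* (:- c)) refl (functional l) (unit zero l)))
          (sum-unit zero (λ l → - functional l))))
        (on (proj₁ (axis⁻ zero)) (Vec.lookup-replicate (proj₁ (axis⁻ zero)) true))
      one≡minus-one : - 1ℚ ≡ 1ℚ
      one≡minus-one = trans (cong -_ (sym at⁺)) at⁻

    singleton-clique : ∀ i → Clique G ⁅ i ⁆
    singleton-clique i j k p q j≢k = contradiction
      (trans (Subset.x∈⁅y⁆⇒x≡y i (lookup⇒∈ j ⁅ i ⁆ p)) (sym (Subset.x∈⁅y⁆⇒x≡y i (lookup⇒∈ k ⁅ i ⁆ q)))) j≢k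

    -- The combination of the e_k with coefficients x k already gives x. Adding h times e₀ and h
    -- times - e₀ with h = (1 - Σ x k) / 2 corrects the sum of the coefficients to 1 without moving
    -- the point.
    spans′ : ∀ x → InAffineHull vertices x
    spans′ x = a , _≃_.close (≡⇒≃ total) , λ l → _≃_.close (≡⇒≃ (coordinate l))
      where
      h : ℝ
      h = fromℚ ½ *ᵣ (1ᵣ +ᵣ (fromℚ (- 1ℚ) *ᵣ sumᵣ x))
      p⁺ : Fin (suc n) → Fin m
      p⁺ k = proj₁ (axis⁺ k)
      p⁻ : Fin m
      p⁻ = proj₁ (axis⁻ zero)
      a : Vector ℝ m
      a i = sumᵣ (λ k → x k *ᵣ fromℚ (unit (p⁺ k) i)) +ᵣ (h *ᵣ (fromℚ (unit (p⁺ zero) i) +ᵣ fromℚ (unit p⁻ i)))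
      module _ (N : ℕ) where
        ξ : Vecℚ (suc n)
        ξ k = seq (x k) N
        H : ℚ
        H = seq h N
        H≡ : H ≡ ½ * (1ℚ + - 1ℚ * sum ξ)
        H≡ = cong (λ y → ½ * (1ℚ + - 1ℚ * y)) (seq-sum x N)
        a≡ : ∀ i → seq (a i) N ≡ sum (λ k → ξ k * unit (p⁺ k) i) + H * (unit (p⁺ zero) i + unit p⁻ i)
        a≡ i = cong (_+ H * (unit (p⁺ zero) i + unit p⁻ i)) (seq-sum (λ k → x k *ᵣ fromℚ (unit (p⁺ k) i)) N)
        weighted : ∀ (v : Vecℚ m) → sum (λ i → seq (a i) N * v i) ≡ sum (λ k → ξ k * v (p⁺ k)) + H * (v (p⁺ zero) + v p⁻)
        weighted v = begin
          sum (λ i → seq (a i) N * v i)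
            ≡⟨ sum-cong {m} (λ i → trans (cong (_* v i) (a≡ i))
                 (solve 4 (λ s h u w → (s :+ h :* u) :* w := con 1ℚ :* (w :* s) :+ h :* (u :* w)) refl
                   (sum λ k → ξ k * unit (p⁺ k) i) H (unit (p⁺ zero) i + unit p⁻ i) (v i))) ⟩
          sum (λ i → 1ℚ * (v i * sum (λ k → ξ k * unit (p⁺ k) i)) + H * ((unit (p⁺ zero) i + unit p⁻ i) * v i))
            ≡⟨ sum-linear 1ℚ H (λ i → v i * sum (λ k → ξ k * unit (p⁺ k) i)) (λ i → (unit (p⁺ zero) i + unit p⁻ i) * v i) ⟩
          1ℚ * dot v (λ i → sum (λ k → ξ k * unit (p⁺ k) i)) + H * sum (λ i → (unit (p⁺ zero) i + unit p⁻ i) * v i)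
            ≡⟨ cong₂ (λ s t → 1ℚ * s + H * t)
                 (trans (sum-linear-comb ξ (λ k → unit (p⁺ k)) v) (sum-cong {suc n} λ k → cong (ξ k *_)
                   (trans (dot-comm v (unit (p⁺ k))) (sum-unit (p⁺ k) v))))
                 (trans (sum-cong {m} λ i → solve 3 (λ a b w → (a :+ b) :* w := con 1ℚ :* (a :* w) :+ con 1ℚ :* (b :* w)) refl (unit (p⁺ zero) i) (unit p⁻ i) (v i))
                   (trans (sum-linear 1ℚ 1ℚ (λ i → unit (p⁺ zero) i * v i) (λ i → unit p⁻ i * v i))
                     (cong₂ (λ s t → 1ℚ * s + 1ℚ * t) (sum-unit (p⁺ zero) v) (sum-unit p⁻ v)))) ⟩
          1ℚ * sum (λ k → ξ k * v (p⁺ k)) + H * (1ℚ * v (p⁺ zero) + 1ℚ * v p⁻)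
            ≡⟨ solve 4 (λ s h a b → con 1ℚ :* s :+ h :* (con 1ℚ :* a :+ con 1ℚ :* b) := s :+ h :* (a :+ b)) refl
                 (sum λ k → ξ k * v (p⁺ k)) H (v (p⁺ zero)) (v p⁻) ⟩
          sum (λ k → ξ k * v (p⁺ k)) + H * (v (p⁺ zero) + v p⁻) ∎
          where open ≡-Reasoning
        total : seq (sumᵣ a) N ≡ 1ℚ
        total = trans (seq-sum a N) (trans (sum-cong {m} λ i → sym (ℚ.*-identityʳ (seq (a i) N)))
          (trans (weighted (λ _ → 1ℚ)) (trans (cong₂ (λ s h → s + h * 2ℚ) (sum-cong {suc n} λ k → ℚ.*-identityʳ (ξ k)) H≡)
            (solve 1 (λ s → s :+ (con ½ :* (con 1ℚ :+ con (- 1ℚ) :* s)) :* con 2ℚ := con 1ℚ) refl (sum ξ)))))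
      coordinate : ∀ l N → seq (x l) N ≡ seq (combination vertices a l) N
      coordinate l N = sym (trans (seq-combination a l N) (trans (weighted N (λ i → pt i l)) (trans
        (cong₂ (λ s t → s + H N * t)
          (trans (sum-cong {suc n} λ k → trans (cong (ξ N k *_) (trans (proj₂ (axis⁺ k) l) (unit-sym k l))) (ℚ.*-comm (ξ N k) (unit l k))) (sum-unit l (ξ N)))
          (trans (cong₂ _+_ (proj₂ (axis⁺ zero) l) (proj₂ (axis⁻ zero) l)) (ℚ.+-inverseʳ (unit zero l))))
        (trans (cong (ξ N l +_) (ℚ.*-zeroʳ (H N))) (ℚ.+-identityʳ (ξ N l))))))
        where
        unit-sym : ∀ {n} (k l : Fin n) → unit k l ≡ unit l k
        unit-sym zero    zero    = refl
        unit-sym zero    (suc l) = refl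
        unit-sym (suc k) zero    = refl
        unit-sym (suc k) (suc l) = unit-sym k l

    polytope : Polytope (suc n)
    polytope = record
      { #vertices = m
      ; vertex    = vertices
      ; isVertex  = λ i → face-cut ⁅ i ⁆ (singleton-clique i)
      ; spans     = spans′ }

    boundary : IsBoundaryComplex polytope (cliqueComplex G)
    boundary S = mk⇔ (λ cl → face-cut S cl , λ { refl → clique-≢⊤ cl }) (λ (cut , S≢⊤) → cut-clique S cut S≢⊤)

    -- Applying the dual vector of i to the vanishing combination isolates `a i`: the other points
    -- of S have dual value 0, and outside S the coefficients vanish.
    simplicial : Simplicial polytope
    simplicial S (cut , S≢⊤) a off-S _ comb≈0 i with lookup S i in Si
    ... | false = off-S i λ i∈S → true≢false (∈⇒lookup i∈S) Si
    ... | true  = _≃_.close (≃-trans (≡⇒≃ rearranged) (≃-trans (≃-+ vanishing (≃-neg rest≃0)) (≡⇒≃ λ _ → refl)))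
      where
      open Support (supports S (cut-clique S cut S≢⊤))
      d : Fin m → ℚ
      d l = dot (dual i) (pt l)
      vanishing : (λ N → sum λ l → d l * seq (a l) N) ≃ (λ _ → 0ℚ)
      vanishing = ≃-trans (≃-sym (functional-combination (dual i) 0ᵥ a (λ k → _≃_.close (≃-sym (from-≈ᵣ (combination vertices a k) 0ᵣ (comb≈0 k))))))
        (≡⇒≃ λ N → sum-zero (suc n) λ k → ℚ.*-zeroʳ (dual i k))
      term≃0 : ∀ l → (λ N → (d l - unit i l) * seq (a l) N) ≃ (λ _ → 0ℚ)
      term≃0 l with lookup S l in Sl
      ... | false = ≃-trans (≃-* (d l - unit i l) (from-≈ᵣ (a l) 0ᵣ (off-S l λ l∈S → true≢false (∈⇒lookup l∈S) Sl))) (≡⇒≃ λ _ → ℚ.*-zeroʳ (d l - unit i l))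
      ... | true  = ≡⇒≃ λ N → trans (cong (_* seq (a l) N) (trans (cong (_- unit i l) (d-unit (i Fin.≟ l))) (ℚ.+-inverseʳ (unit i l)))) (ℚ.*-zeroˡ (seq (a l) N))
        where
        unit-self : ∀ {m} (i : Fin m) → unit i i ≡ 1ℚ
        unit-self zero    = refl
        unit-self (suc i) = unit-self i
        unit-other : ∀ {m} (i j : Fin m) → i ≢ j → unit i j ≡ 0ℚ
        unit-other zero    zero    ne = contradiction refl ne
        unit-other zero    (suc j) ne = refl
        unit-other (suc i) zero    ne = refl
        unit-other (suc i) (suc j) ne = unit-other i j (ne ∘ cong suc)
        d-unit : Dec (i ≡ l) → d l ≡ unit i l
        d-unit (yes refl) = trans (dual-self i Si) (sym (unit-self i))
        d-unit (no i≢l)   = trans (dual-other i l Si Sl i≢l) (sym (unit-other i l i≢l))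
      rest≃0 : (λ N → sum λ l → (d l - unit i l) * seq (a l) N) ≃ (λ _ → 0ℚ)
      rest≃0 = ≃-trans (≃-sum term≃0) (≡⇒≃ λ _ → sum-zero m {λ _ → 0ℚ} λ _ → refl)
      rearranged : ∀ N → seq (a i) N ≡ sum (λ l → d l * seq (a l) N) - sum (λ l → (d l - unit i l) * seq (a l) N)
      rearranged N = begin
        seq (a i) N
          ≡⟨ sum-unit i (λ l → seq (a l) N) ⟨
        sum (λ l → unit i l * seq (a l) N)
          ≡⟨ sum-cong {m} (λ l → solve 3 (λ d u a → u :* a := con 1ℚ :* (d :* a) :+ con (- 1ℚ) :* ((d :- u) :* a)) refl (d l) (unit i l) (seq (a l) N)) ⟩
        sum (λ l → 1ℚ * (d l * seq (a l) N) + - 1ℚ * ((d l - unit i l) * seq (a l) N))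
          ≡⟨ sum-linear 1ℚ (- 1ℚ) (λ l → d l * seq (a l) N) (λ l → (d l - unit i l) * seq (a l) N) ⟩
        1ℚ * sum (λ l → d l * seq (a l) N) + - 1ℚ * sum (λ l → (d l - unit i l) * seq (a l) N)
          ≡⟨ solve 2 (λ s t → con 1ℚ :* s :+ con (- 1ℚ) :* t := s :- t) refl (sum λ l → d l * seq (a l) N) (sum λ l → (d l - unit i l) * seq (a l) N) ⟩
        sum (λ l → d l * seq (a l) N) - sum (λ l → (d l - unit i l) * seq (a l) N) ∎
        where open ≡-Reasoning

-- From the Eulerian sphere to the decomposition and its polytope.

open import Defs
open import Data.Nat.Base using (ℕ; suc; _≤_)
open import Data.Integer.Base using (0ℤ)
open import Data.Product.Base using (_×_; Σ-syntax)
open import Relation.Binary.PropositionalEquality using (_≡_)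
open ExponentialSeries
open Polynomials
open EulerianRecursion
open BinomialEulerian
open RationalGeometry
open CliquePolynomials
open FlagSpheres
open EventSchedule
open GammaPolynomials
open CliqueComplexes
open RealPolytopes
open Graphs
open import Data.Bool.Base using (true)
open import Data.Nat.Base using (zero; s≤s)
open import Data.Fin.Base using (Fin)
open import Data.Product.Base using (_,_)
import Relation.Binary.PropositionalEquality as ≡

module _ (s : ℕ) where
  open Schedule polyRing X s using (eulerianSphere; eulerianSphere-∅)
  open Spheres polyRing X using (module Sphere)
  open PolySubstitution s using (Tr-≈; F-substitution)
  open Eulerian polyRing (1ₚ +ₚ X) X s using (F)
  open CliquePolynomial polyRing X using (cl-set)

  -- The link of the empty face is the whole sphere, so its f-polynomial is F for 1 + 2x and x + x².
  -- The substitution turns it into the h-polynomial, and this F into the one for 1 + t and t.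
  eulerianSphere-h : ∀ n → F n ≐ hPolynomial n (cliqueComplex (Sphere.graph (eulerianSphere n)))
  eulerianSphere-h n = P.sym (P.trans (hPolynomial-cl s n graph) (P.trans
    (Tr-≈ n (P.trans (cl-set (λ y → ≡.sym (allOf-∅ n (λ i → adj graph (facet i) y)))) (P.trans (links (∅ n)) (eulerianSphere-∅ n))))
    (F-substitution n)))
    where
    open Sphere (eulerianSphere n)
    allOf-∅ : ∀ n ρ → allOf (∅ n) ρ ≡ true
    allOf-∅ zero    ρ = ≡.refl
    allOf-∅ (suc n) ρ = allOf-∅ n (λ i → ρ (Fin.suc i))

theorem1p2 : (n r : ℕ) → 1 ≤ n → 2 ≤ r →
    Σ[ A⁺ ∈ Poly ] Σ[ A⁻ ∈ Poly ]
    (Ã n r ≈ₚ A⁺ +ₚ A⁻)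
    × GammaPositive n A⁺
    × (GammaPositive (suc n) A⁻ × coeff A⁻ 0 ≡ 0ℤ)
    × (Σ[ P ∈ Polytope n ] Σ[ Δ ∈ SimplicialComplex (#vertices P) ]
    Simplicial P × IsBoundaryComplex P Δ × Flag Δ × (A⁺ ≈ₚ hPolynomial n Δ))
theorem1p2 n@(suc _) (suc s) (s≤s _) _ =
  F n , G n , at (EulerianPoly.Ã≐F+G s n)
  , PolyExpansion.Γ⇒GammaPositive s (Γ-F n)
  -- The constant term of G vanishes because of its factor β = X.
  , (PolyExpansion.Γ⇒GammaPositive s (Γ-G n) , coeff-X*-0 ((V ⊛ F) n))
  , polytope , cliqueComplex graph , simplicial , boundary , cliqueComplex-flag graph , at (eulerianSphere-h s n)
  where
  open Eulerian polyRing (1ₚ +ₚ X) X s using (F; G; V; Γ-F; Γ-G)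
  open Schedule polyRing X s using (eulerianSphere)
  open Spheres polyRing X using (module Sphere)
  open Hurwitz polyRing using (_⊛_)
  open Sphere (eulerianSphere n) using (graph; realization)
  open RealPolytope graph realization
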